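{- Let $q$ be a complex number with $0<|q|<1$. For each $n\in\{1,2,\dots,9\}$ let $$Y_n(q)=q^{n}\,\frac{\left(q^{19-2n},\,q^{57+2n};\,q^{76}\right)_\infty}{\left(q^{19+2n},\,q^{57-2n};\,q^{76}\right)_\infty}.$$ Then for every $n\in\{1,2,\dots,9\}$, $$\frac{1}{Y_n(q)}+Y_n(q)=\frac{\phi(-q^{19})\,f(q^{2n},q^{38-2n})}{q^{n}\,\psi(q^{38})\,f(-q^{19-2n},-q^{19+2n})}$$ and $$\frac{1}{Y_n(q)}-Y_n(q)=\frac{\phi(q^{19})\,f(-q^{2n},-q^{38-2n})}{q^{n}\,\psi(q^{38})\,f(-q^{19-2n},-q^{19+2n})}.$$
   Context: For complex $\lambda$ and $|q|<1$, $(\lambda;q)_\infty=\prod_{j\ge 0}(1-\lambda q^j)$ and $(\lambda_1,\lambda_2;q)_\infty=(\lambda_1;q)_\infty(\lambda_2;q)_\infty$. Ramanujan's general theta function is $f(a,b)=\sum_{j=-\infty}^{\infty}a^{j(j+1)/2}b^{j(j-1)/2}$ for $|ab|<1$. Special cases: $\phi(q)=f(q,q)=\sum_{j=-\infty}^\infty q^{j^2}$ and $\psi(q)=f(q,q^3)=\sum_{j=0}^\infty q^{j(j+1)/2}$. The functions $Y_n(q)$ are the continued fractions of order seventy-six. -}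

module Defs where

open import Algebra.Bundles.Raw using (RawSemiring)
open import Data.Fin.Base using (toℕ)
open import Data.Integer.Base as ℤ using (ℤ; -[1+_])
open import Data.Nat.Base as ℕ using (ℕ; _⊔_)
import Data.Nat.DivMod as ℕ
import Data.Nat.Properties as ℕ
open import Data.Product.Base using (_×_; _,_; ∃-syntax)
open import Data.Rational.Base as ℚ using (ℚ; 0ℚ; 1ℚ; ½; ∣_∣)
import Data.Rational.Properties as ℚ
open import Data.Rational.Solver using (module +-*-Solver)
open import Level using (0ℓ)
open import Relation.Binary.PropositionalEquality
  using (_≡_; refl; sym; trans; cong; cong₂; subst)

------------------------------------------------------------------------
-- Real numbers: Cauchy sequences of rationals, with setoid equality _≈ᴿ_

Eventually : (ℕ → Set) → Set
Eventually P = ∃[ N ] (∀ n → N ℕ.≤ n → P n)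

IsCauchy : (ℕ → ℚ) → Set
IsCauchy x = ∀ ε → 0ℚ ℚ.< ε →
  ∃[ N ] (∀ m n → N ℕ.≤ m → N ℕ.≤ n → ∣ x m ℚ.- x n ∣ ℚ.< ε)

record ℝ : Set where
  constructor mkℝ
  field
    seq    : ℕ → ℚ
    cauchy : IsCauchy seq
open ℝ public

infix 4 _≈ᴿ_ _<ᴿ_

_≈ᴿ_ : ℝ → ℝ → Set
x ≈ᴿ y = ∀ ε → 0ℚ ℚ.< ε → Eventually λ n → ∣ seq x n ℚ.- seq y n ∣ ℚ.< ε

_<ᴿ_ : ℝ → ℝ → Set
x <ᴿ y = ∃[ ε ] (0ℚ ℚ.< ε × Eventually λ n → seq x n ℚ.+ ε ℚ.< seq y n)

private
  open +-*-Solver using (solve; _:=_; _:+_; _:*_; _:-_; :-_; con)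

private abstract
  0<½* : ∀ {ε} → 0ℚ ℚ.< ε → 0ℚ ℚ.< ½ ℚ.* ε
  0<½* {ε} 0<ε = ℚ.positive⁻¹ (½ ℚ.* ε)
    {{ℚ.pos*pos⇒pos ½ ε {{ℚ.positive 0<ε}}}}

  halves : ∀ ε → ½ ℚ.* ε ℚ.+ ½ ℚ.* ε ≡ ε
  halves ε = trans (sym (ℚ.*-distribʳ-+ ε ½ ½)) (ℚ.*-identityˡ ε)

  cauchy-const : ∀ p → IsCauchy (λ _ → p)
  cauchy-const p ε 0<ε = 0 , λ _ _ _ _ →
    subst (λ t → ∣ t ∣ ℚ.< ε) (sym (ℚ.+-inverseʳ p)) 0<ε

  cauchy-+ : ∀ {x y} → IsCauchy x → IsCauchy y → IsCauchy (λ n → x n ℚ.+ y n)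
  cauchy-+ {x} {y} cx cy ε 0<ε with cx _ (0<½* 0<ε) | cy _ (0<½* 0<ε)
  ... | M , hx | N , hy = M ⊔ N , λ m n le le′ → begin-strict
    ∣ (x m ℚ.+ y m) ℚ.- (x n ℚ.+ y n) ∣
      ≡⟨ cong ∣_∣ (solve 4 (λ a b c d →
           (a :+ b) :- (c :+ d) := (a :- c) :+ (b :- d)) refl (x m) (y m) (x n) (y n)) ⟩
    ∣ (x m ℚ.- x n) ℚ.+ (y m ℚ.- y n) ∣
      ≤⟨ ℚ.∣p+q∣≤∣p∣+∣q∣ (x m ℚ.- x n) (y m ℚ.- y n) ⟩
    ∣ x m ℚ.- x n ∣ ℚ.+ ∣ y m ℚ.- y n ∣
      <⟨ ℚ.+-mono-< (hx m n (ℕ.m⊔n≤o⇒m≤o M N le) (ℕ.m⊔n≤o⇒m≤o M N le′))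
                    (hy m n (ℕ.m⊔n≤o⇒n≤o M N le) (ℕ.m⊔n≤o⇒n≤o M N le′)) ⟩
    ½ ℚ.* ε ℚ.+ ½ ℚ.* ε
      ≡⟨ halves ε ⟩
    ε ∎
    where open ℚ.≤-Reasoning

  cauchy-neg : ∀ {x} → IsCauchy x → IsCauchy (λ n → ℚ.- x n)
  cauchy-neg {x} cx ε 0<ε with cx ε 0<ε
  ... | N , h = N , λ m n le le′ → subst (ℚ._< ε)
    (trans (sym (ℚ.∣-p∣≡∣p∣ (x m ℚ.- x n)))
      (cong ∣_∣ (solve 2 (λ a b → :- (a :- b) := (:- a) :- (:- b)) refl (x m) (x n))))
    (h m n le le′)

  cauchy-bounded : ∀ {x} → IsCauchy x →
    ∃[ B ] (0ℚ ℚ.< B × Eventually λ n → ∣ x n ∣ ℚ.≤ B)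
  cauchy-bounded {x} cx with cx 1ℚ (ℚ.positive⁻¹ 1ℚ)
  ... | N , h = 1ℚ ℚ.+ ∣ x N ∣
    , ℚ.+-mono-<-≤ (ℚ.positive⁻¹ 1ℚ) (ℚ.0≤∣p∣ (x N))
    , N , λ n le → begin
      ∣ x n ∣
        ≡⟨ cong ∣_∣ (solve 2 (λ a b → a := (a :- b) :+ b) refl (x n) (x N)) ⟩
      ∣ (x n ℚ.- x N) ℚ.+ x N ∣
        ≤⟨ ℚ.∣p+q∣≤∣p∣+∣q∣ (x n ℚ.- x N) (x N) ⟩
      ∣ x n ℚ.- x N ∣ ℚ.+ ∣ x N ∣
        ≤⟨ ℚ.+-monoˡ-≤ ∣ x N ∣ (ℚ.<⇒≤ (h n N le ℕ.≤-refl)) ⟩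
      1ℚ ℚ.+ ∣ x N ∣ ∎
    where open ℚ.≤-Reasoning

  -- A radius δ with B * δ = ε / 2.
  shrink : ∀ {B ε} → 0ℚ ℚ.< B → 0ℚ ℚ.< ε →
    ∃[ δ ] (0ℚ ℚ.< δ × B ℚ.* δ ≡ ½ ℚ.* ε)
  shrink {B} {ε} 0<B 0<ε = 1/B ℚ.* (½ ℚ.* ε)
    , ℚ.positive⁻¹ _ {{ℚ.pos*pos⇒pos 1/B {{ℚ.1/pos⇒pos B}} (½ ℚ.* ε)
        {{ℚ.positive (0<½* 0<ε)}}}}
    , trans (sym (ℚ.*-assoc B 1/B _))
        (trans (cong (ℚ._* (½ ℚ.* ε)) (ℚ.*-inverseʳ B)) (ℚ.*-identityˡ _))
    where
      instance
        B>0 : ℚ.Positive B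
        B>0 = ℚ.positive 0<B
        B≢0 : ℚ.NonZero B
        B≢0 = ℚ.pos⇒nonZero B
      1/B : ℚ
      1/B = ℚ.1/ B

  bound-* : ∀ {B δ} a b → 0ℚ ℚ.< B → ∣ a ∣ ℚ.≤ B → ∣ b ∣ ℚ.< δ →
    ∣ a ℚ.* b ∣ ℚ.< B ℚ.* δ
  bound-* {B} {δ} a b 0<B a≤B b<δ = begin-strict
    ∣ a ℚ.* b ∣       ≡⟨ ℚ.∣p*q∣≡∣p∣*∣q∣ a b ⟩
    ∣ a ∣ ℚ.* ∣ b ∣   ≤⟨ ℚ.*-monoʳ-≤-nonNeg ∣ b ∣ {{ℚ.nonNegative (ℚ.0≤∣p∣ b)}} a≤B ⟩
    B ℚ.* ∣ b ∣       <⟨ ℚ.*-monoʳ-<-pos B {{ℚ.positive 0<B}} b<δ ⟩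
    B ℚ.* δ           ∎
    where open ℚ.≤-Reasoning

  ∣-∣-* : ∀ {A B δ η} a b c d → 0ℚ ℚ.< A → 0ℚ ℚ.< B →
    ∣ a ∣ ℚ.≤ A → ∣ d ∣ ℚ.≤ B → ∣ b ℚ.- d ∣ ℚ.< δ → ∣ a ℚ.- c ∣ ℚ.< η →
    ∣ a ℚ.* b ℚ.- c ℚ.* d ∣ ℚ.< A ℚ.* δ ℚ.+ B ℚ.* η
  ∣-∣-* {A} {B} {δ} {η} a b c d 0<A 0<B a≤A d≤B b-d<δ a-c<η = begin-strict
    ∣ a ℚ.* b ℚ.- c ℚ.* d ∣
      ≡⟨ cong ∣_∣ (solve 4 (λ a b c d →
           a :* b :- c :* d := a :* (b :- d) :+ d :* (a :- c)) refl a b c d) ⟩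
    ∣ a ℚ.* (b ℚ.- d) ℚ.+ d ℚ.* (a ℚ.- c) ∣
      ≤⟨ ℚ.∣p+q∣≤∣p∣+∣q∣ (a ℚ.* (b ℚ.- d)) (d ℚ.* (a ℚ.- c)) ⟩
    ∣ a ℚ.* (b ℚ.- d) ∣ ℚ.+ ∣ d ℚ.* (a ℚ.- c) ∣
      <⟨ ℚ.+-mono-< (bound-* a (b ℚ.- d) 0<A a≤A b-d<δ)
                    (bound-* d (a ℚ.- c) 0<B d≤B a-c<η) ⟩
    A ℚ.* δ ℚ.+ B ℚ.* η ∎
    where open ℚ.≤-Reasoning

  cauchy-* : ∀ {x y} → IsCauchy x → IsCauchy y → IsCauchy (λ n → x n ℚ.* y n)
  cauchy-* {x} {y} cx cy ε 0<ε =
    let A , 0<A , K , bx = cauchy-bounded {x} cx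
        B , 0<B , L , by = cauchy-bounded {y} cy
        δ , 0<δ , Aδ = shrink {A} {ε} 0<A 0<ε
        η , 0<η , Bη = shrink {B} {ε} 0<B 0<ε
        M , hy = cy δ 0<δ
        N , hx = cx η 0<η
    in (K ⊔ L) ⊔ (M ⊔ N) , λ m n le le′ →
      let K⊔L≤m = ℕ.m⊔n≤o⇒m≤o (K ⊔ L) (M ⊔ N) le
          K⊔L≤n = ℕ.m⊔n≤o⇒m≤o (K ⊔ L) (M ⊔ N) le′
          M⊔N≤m = ℕ.m⊔n≤o⇒n≤o (K ⊔ L) (M ⊔ N) le
          M⊔N≤n = ℕ.m⊔n≤o⇒n≤o (K ⊔ L) (M ⊔ N) le′
      in subst (∣ x m ℚ.* y m ℚ.- x n ℚ.* y n ∣ ℚ.<_)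
        (trans (cong₂ ℚ._+_ Aδ Bη) (halves ε))
        (∣-∣-* {A} {B} {δ} {η} (x m) (y m) (x n) (y n) 0<A 0<B
          (bx m (ℕ.m⊔n≤o⇒m≤o K L K⊔L≤m))
          (by n (ℕ.m⊔n≤o⇒n≤o K L K⊔L≤n))
          (hy m n (ℕ.m⊔n≤o⇒m≤o M N M⊔N≤m) (ℕ.m⊔n≤o⇒m≤o M N M⊔N≤n))
          (hx m n (ℕ.m⊔n≤o⇒n≤o M N M⊔N≤m) (ℕ.m⊔n≤o⇒n≤o M N M⊔N≤n)))

infixl 6 _+ᴿ_ _-ᴿ_
infixl 7 _*ᴿ_
infix  8 -ᴿ_

fromℚ : ℚ → ℝ
fromℚ p = mkℝ (λ _ → p) (cauchy-const p)

0ℝ 1ℝ : ℝ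
0ℝ = fromℚ 0ℚ
1ℝ = fromℚ 1ℚ

_+ᴿ_ _*ᴿ_ : ℝ → ℝ → ℝ
mkℝ x cx +ᴿ mkℝ y cy = mkℝ (λ n → x n ℚ.+ y n) (cauchy-+ {x} {y} cx cy)
mkℝ x cx *ᴿ mkℝ y cy = mkℝ (λ n → x n ℚ.* y n) (cauchy-* {x} {y} cx cy)

-ᴿ_ : ℝ → ℝ
-ᴿ mkℝ x cx = mkℝ (λ n → ℚ.- x n) (cauchy-neg {x} cx)

_-ᴿ_ : ℝ → ℝ → ℝ
x -ᴿ y = x +ᴿ (-ᴿ y)

------------------------------------------------------------------------
-- Complex numbers

record ℂ : Set where
  constructor _+i_
  field
    re im : ℝ
open ℂ public

infix  4 _≈_
infixl 6 _+_ _-_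
infixl 7 _*_
infix  8 -_

_≈_ : ℂ → ℂ → Set
z ≈ w = re z ≈ᴿ re w × im z ≈ᴿ im w

0ℂ 1ℂ : ℂ
0ℂ = 0ℝ +i 0ℝ
1ℂ = 1ℝ +i 0ℝ

_+_ _*_ : ℂ → ℂ → ℂ
z + w = (re z +ᴿ re w) +i (im z +ᴿ im w)
z * w = (re z *ᴿ re w -ᴿ im z *ᴿ im w) +i (re z *ᴿ im w +ᴿ im z *ᴿ re w)

-_ : ℂ → ℂ
- z = (-ᴿ re z) +i (-ᴿ im z)

_-_ : ℂ → ℂ → ℂ
z - w = z + (- w)

-- The squared modulus. For r ≥ 0, |z| < r and r < |z| are written as
-- ∣ z ∣² <ᴿ r² and r² <ᴿ ∣ z ∣², so that no real square root is needed.
∣_∣² : ℂ → ℝ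
∣ z ∣² = re z *ᴿ re z +ᴿ im z *ᴿ im z

ℂ-rawSemiring : RawSemiring 0ℓ 0ℓ
ℂ-rawSemiring = record
  { Carrier = ℂ ; _≈_ = _≈_ ; _+_ = _+_ ; _*_ = _*_ ; 0# = 0ℂ ; 1# = 1ℂ }

open import Algebra.Definitions.RawSemiring ℂ-rawSemiring public
  using (_^_; sum; product)

------------------------------------------------------------------------
-- Possibly undefined complex expressions

-- Limits and quotients need not exist, so a complex-valued expression is
-- represented by the predicate "z is a value of the expression". Limits are
-- unique, so every expression below has at most one value up to _≈_. The
-- equation D ≐ E asserts that both sides are defined (all limits exist and all
-- denominators are nonzero) and that their values agree.
Expr : Set₁
Expr = ℂ → Set

infix  4 _≐_
infixl 6 _⊕_ _⊖_
infixl 7 _⊗_ _⊘_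

_≐_ : Expr → Expr → Set
D ≐ E = ∃[ z ] (D z × E z)

⟨_⟩ : ℂ → Expr
⟨ w ⟩ z = z ≈ w

_⊕_ _⊖_ _⊗_ _⊘_ : Expr → Expr → Expr
(D ⊕ E) z = ∃[ x ] ∃[ y ] (D x × E y × z ≈ x + y)
(D ⊖ E) z = ∃[ x ] ∃[ y ] (D x × E y × z ≈ x - y)
(D ⊗ E) z = ∃[ x ] ∃[ y ] (D x × E y × z ≈ x * y)
(D ⊘ E) z = ∃[ x ] ∃[ y ] (D x × E y × 0ℝ <ᴿ ∣ y ∣² × z * y ≈ x)

∏∞ : (ℕ → ℂ) → Expr
∏∞ a z = ∀ ε → 0ℚ ℚ.< ε → Eventually λ n →
  ∣ product {n} (λ j → a (toℕ j)) - z ∣² <ᴿ fromℚ (ε ℚ.* ε)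

-- Bilateral series: the sum over -m ≤ j < n tends to z as m and n tend to
-- infinity independently.
∑ℤ : (ℤ → ℂ) → Expr
∑ℤ t z = ∀ ε → 0ℚ ℚ.< ε → ∃[ N ] (∀ m n → N ℕ.≤ m → N ℕ.≤ n →
  ∣ (sum {n} (λ j → t (ℤ.+ toℕ j)) + sum {m} (λ j → t -[1+ toℕ j ])) - z ∣²
    <ᴿ fromℚ (ε ℚ.* ε))

------------------------------------------------------------------------
-- q-products, theta functions and the functions Y n

-- (a; q)_∞ and (a, b; q)_∞
qPoch : ℂ → ℂ → Expr
qPoch a q = ∏∞ λ j → 1ℂ - a * q ^ j

qPoch₂ : ℂ → ℂ → ℂ → Expr
qPoch₂ a b q = qPoch a q ⊗ qPoch b q

-- j(j+1)/2 and j(j-1)/2 are nonnegative for every integer j, so ℤ.∣_∣ only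
-- changes their type. The domain |ab| < 1 is left to the convergence of the series.
f : ℂ → ℂ → Expr
f a b = ∑ℤ λ j →
  a ^ (ℤ.∣ j ℤ.* (j ℤ.+ ℤ.1ℤ) ∣ ℕ./ 2) * b ^ (ℤ.∣ j ℤ.* (j ℤ.- ℤ.1ℤ) ∣ ℕ./ 2)

φ ψ : ℂ → Expr
φ q = f q q
ψ q = f q (q ^ 3)

-- Only used for n ≤ 9, where the truncated subtractions are exact.
Y : ℕ → ℂ → Expr
Y n q = ⟨ q ^ n ⟩
  ⊗ (qPoch₂ (q ^ (19 ℕ.∸ 2 ℕ.* n)) (q ^ (57 ℕ.+ 2 ℕ.* n)) (q ^ 76)
  ⊘ qPoch₂ (q ^ (19 ℕ.+ 2 ℕ.* n)) (q ^ (57 ℕ.∸ 2 ℕ.* n)) (q ^ 76))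

{-# OPTIONS --safe #-}
module Submission where

-- Jacobi's triple product turns the numerator and the denominator of Y n q into
-- theta functions, up to the common factor (q^76; q^76)_∞:
--   Y = q^n θ₂ / θ₁,  θ₁ = f(-q^(19+2n), -q^(57-2n)),  θ₂ = f(-q^(19-2n), -q^(57+2n)).
-- So 1/Y ± Y = (θ₁² ± q^(2n) θ₂²) / (q^n θ₁ θ₂), and it remains to see that
--   φ(-q^19) f(q^(2n), q^(38-2n))   = θ₁² + q^(2n) θ₂²,
--   φ(q^19) f(-q^(2n), -q^(38-2n))  = θ₁² - q^(2n) θ₂²,
--   ψ(q^38) f(-q^(19-2n), -q^(19+2n)) = θ₁ θ₂.
-- Both sides are double series of signed powers of q, and a bijection between
-- the index sets preserves signs and exponents.
--
-- All estimates are made for one Gaussian rational g with |g| ≤ ρ < 1 and depend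
-- on ρ only. A limit of complex numbers Z n is then represented by the diagonal
-- of their rational approximations, and an identity between limits follows from
-- a bound O(n² ρ^n) on the difference of the n-th partial sums and products at
-- g. For the double series, the terms of degree less than n agree up to order and
-- the O(n²) others are at most ρ^n; for the triple product, the finite form given
-- by the q-binomial theorem has coefficients close to 1.

open import Algebra.Bundles using (CommutativeRing)
open import Algebra.Structures using (IsCommutativeRing)
open import Data.Empty using (⊥; ⊥-elim)
open import Data.Fin.Base using (toℕ)
open import Data.Integer.Base as ℤ using (ℤ; -[1+_])
import Data.Integer.Properties as ℤ
import Data.Integer.Tactic.RingSolver as ℤSolver
open import Data.Maybe.Base using (Maybe; just; nothing)
open import Data.Nat.Base as ℕ using (ℕ; zero; suc; _∸_)
import Data.Nat.DivMod as ℕ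
import Data.Nat.Properties as ℕ
import Data.Nat.Tactic.RingSolver as ℕSolver
open import Data.Product.Base using (_×_; _,_; ∃-syntax; proj₁; proj₂)
open import Data.Rational.Base as ℚ using (ℚ; 0ℚ; 1ℚ; ½)
import Data.Rational.Properties as ℚ
import Data.Rational.Unnormalised.Base as ℚᵘ
import Data.Rational.Unnormalised.Properties as ℚᵘ
open import Data.Sum.Base using (_⊎_; inj₁; inj₂)
open import Function.Base using (_∘_)
open import Level using (0ℓ)
open import Relation.Binary.PropositionalEquality
  using (_≡_; _≢_; refl; sym; trans; cong; cong₂; subst; subst₂; isEquivalence; module ≡-Reasoning)
import Relation.Binary.Reasoning.Setoid as SetoidReasoning
open import Relation.Nullary using (yes; no)
open import Tactic.RingSolver using (solve-∀)
open import Tactic.RingSolver.Core.AlmostCommutativeRing using (AlmostCommutativeRing; fromCommutativeRing)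

-- The double series match by the parallelogram law. Let s = 19, m = 2n, α = 19 - 2n. Once
-- multiplied out, the degrees are 2s k² - α k in θ₁, s i² - α i in f(±q^(2n), ±q^(38-2n)) and s j²
-- in φ(±q^19), so i = k + l, j = k - l turns f φ into θ₁². This reaches only the pairs with i + j
-- even. The odd ones are i = 1 - (k + l), j = l - k, where the reflection produces the linear term
-- of θ₂ and the constant 2n, hence q^(2n) θ₂². For ψ f the same substitution in θ₂ θ₁ leaves only
-- even, respectively odd, indices of f; so both sides are compared with a sum over two copies of ℤ
-- × ℤ.
--
-- Each equation also asserts that its sides are defined. The series alone give no lower bound for a
-- denominator; it comes from the products ∏(1 - w j), uniformly in the number of factors, and
-- reaches the theta functions through Jacobi's identity.
--
-- Ring operations on ℂ act termwise on the rational approximations, so finite identities hold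
-- exactly at every index and only truncation errors need estimates.

module GaussianRationals where
  open import Algebra.Properties.AbelianGroup ℤ.+-0-abelianGroup using (∙-cancelˡ; ∙-cancelʳ)
  open import Data.List.Base using (List; []; _∷_; _++_; map; filter; length; applyUpTo; cartesianProduct)
  open import Data.List.Membership.Propositional using (_∈_)
  import Data.List.Membership.Propositional.Properties as ∈
  open import Data.List.Membership.Propositional.Properties.WithK using (unique∧set⇒bag)
  import Data.List.Properties as List
  open import Data.List.Relation.Binary.BagAndSetEquality using (∼bag⇒↭)
  open import Data.List.Relation.Binary.Permutation.Propositional as ↭ using (_↭_)
  open import Data.List.Relation.Unary.Unique.Propositional using (Unique)
  import Data.List.Relation.Unary.Unique.Propositional.Properties as Unique
  open import Data.Rational.Base using (_+_; _*_; _-_; -_; _≤_; _<_)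
  open import Defs using (Eventually)
  open import Function.Bundles using (mk⇔)

  private variable
    𝕏 I J : Set

  ℚ-ring : AlmostCommutativeRing 0ℓ 0ℓ
  ℚ-ring = fromCommutativeRing ℚ.+-*-commutativeRing zero?
    where
    zero? : ∀ p → Maybe (0ℚ ≡ p)
    zero? p with 0ℚ ℚ.≟ p
    ... | yes eq = just eq
    ... | no  _  = nothing

  -- Gaussian rationals

  infixl 6 _+ᴳ_ _-ᴳ_
  infixl 7 _*ᴳ_
  infix  8 ⊝_

  record 𝔾 : Set where
    constructor _+ⁱ_
    field
      reᴳ imᴳ : ℚ
  open 𝔾 public

  0ᴳ 1ᴳ : 𝔾
  0ᴳ = 0ℚ +ⁱ 0ℚ
  1ᴳ = 1ℚ +ⁱ 0ℚ

  _+ᴳ_ _*ᴳ_ : 𝔾 → 𝔾 → 𝔾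
  x +ᴳ y = (reᴳ x ℚ.+ reᴳ y) +ⁱ (imᴳ x ℚ.+ imᴳ y)
  x *ᴳ y = (reᴳ x ℚ.* reᴳ y ℚ.- imᴳ x ℚ.* imᴳ y) +ⁱ (reᴳ x ℚ.* imᴳ y ℚ.+ imᴳ x ℚ.* reᴳ y)

  ⊝_ : 𝔾 → 𝔾
  ⊝ x = (ℚ.- reᴳ x) +ⁱ (ℚ.- imᴳ x)

  _-ᴳ_ : 𝔾 → 𝔾 → 𝔾
  x -ᴳ y = x +ᴳ (⊝ y)

  𝔾-isCommutativeRing : IsCommutativeRing _≡_ _+ᴳ_ _*ᴳ_ ⊝_ 0ᴳ 1ᴳ
  𝔾-isCommutativeRing = record
    { isRing = record
      { +-isAbelianGroup = record
        { isGroup = record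
          { isMonoid = record
            { isSemigroup = record
              { isMagma = record { isEquivalence = isEquivalence ; ∙-cong = cong₂ _+ᴳ_ }
              ; assoc = λ x y z → cong₂ _+ⁱ_ (ℚ.+-assoc (reᴳ x) (reᴳ y) (reᴳ z)) (ℚ.+-assoc (imᴳ x) (imᴳ y) (imᴳ z)) }
            ; identity = (λ x → cong₂ _+ⁱ_ (ℚ.+-identityˡ _) (ℚ.+-identityˡ _))
                       , (λ x → cong₂ _+ⁱ_ (ℚ.+-identityʳ _) (ℚ.+-identityʳ _)) }
          ; inverse = (λ x → cong₂ _+ⁱ_ (ℚ.+-inverseˡ (reᴳ x)) (ℚ.+-inverseˡ (imᴳ x)))
                    , (λ x → cong₂ _+ⁱ_ (ℚ.+-inverseʳ (reᴳ x)) (ℚ.+-inverseʳ (imᴳ x)))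
          ; ⁻¹-cong = cong ⊝_ }
        ; comm = λ x y → cong₂ _+ⁱ_ (ℚ.+-comm (reᴳ x) (reᴳ y)) (ℚ.+-comm (imᴳ x) (imᴳ y)) }
      ; *-cong = cong₂ _*ᴳ_
      ; *-assoc = λ (a +ⁱ b) (c +ⁱ d) (e +ⁱ f) → cong₂ _+ⁱ_ (assoc₁ a b c d e f) (assoc₂ a b c d e f)
      ; *-identity = (λ (a +ⁱ b) → cong₂ _+ⁱ_ (idˡ₁ a b) (idˡ₂ a b))
                   , (λ (a +ⁱ b) → cong₂ _+ⁱ_ (idʳ₁ a b) (idʳ₂ a b))
      ; distrib = (λ (a +ⁱ b) (c +ⁱ d) (e +ⁱ f) → cong₂ _+ⁱ_ (distˡ₁ a b c d e f) (distˡ₂ a b c d e f))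
                , (λ (a +ⁱ b) (c +ⁱ d) (e +ⁱ f) → cong₂ _+ⁱ_ (distʳ₁ a b c d e f) (distʳ₂ a b c d e f)) }
    ; *-comm = λ (a +ⁱ b) (c +ⁱ d) → cong₂ _+ⁱ_ (comm₁ a b c d) (comm₂ a b c d)
    }
    where
    assoc₁ : ∀ a b c d e f → (a * c - b * d) * e - (a * d + b * c) * f
      ≡ a * (c * e - d * f) - b * (c * f + d * e)
    assoc₁ = solve-∀ ℚ-ring
    assoc₂ : ∀ a b c d e f → (a * c - b * d) * f + (a * d + b * c) * e
      ≡ a * (c * f + d * e) + b * (c * e - d * f)
    assoc₂ = solve-∀ ℚ-ring
    idˡ₁ : ∀ a b → 1ℚ * a - 0ℚ * b ≡ a
    idˡ₁ = solve-∀ ℚ-ring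
    idˡ₂ : ∀ a b → 1ℚ * b + 0ℚ * a ≡ b
    idˡ₂ = solve-∀ ℚ-ring
    idʳ₁ : ∀ a b → a * 1ℚ - b * 0ℚ ≡ a
    idʳ₁ = solve-∀ ℚ-ring
    idʳ₂ : ∀ a b → a * 0ℚ + b * 1ℚ ≡ b
    idʳ₂ = solve-∀ ℚ-ring
    distˡ₁ : ∀ a b c d e f → a * (c + e) - b * (d + f) ≡ (a * c - b * d) + (a * e - b * f)
    distˡ₁ = solve-∀ ℚ-ring
    distˡ₂ : ∀ a b c d e f → a * (d + f) + b * (c + e) ≡ (a * d + b * c) + (a * f + b * e)
    distˡ₂ = solve-∀ ℚ-ring
    distʳ₁ : ∀ a b c d e f → (c + e) * a - (d + f) * b ≡ (c * a - d * b) + (e * a - f * b)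
    distʳ₁ = solve-∀ ℚ-ring
    distʳ₂ : ∀ a b c d e f → (c + e) * b + (d + f) * a ≡ (c * b + d * a) + (e * b + f * a)
    distʳ₂ = solve-∀ ℚ-ring
    comm₁ : ∀ a b c d → a * c - b * d ≡ c * a - d * b
    comm₁ = solve-∀ ℚ-ring
    comm₂ : ∀ a b c d → a * d + b * c ≡ c * b + d * a
    comm₂ = solve-∀ ℚ-ring

  𝔾-commutativeRing : CommutativeRing 0ℓ 0ℓ
  𝔾-commutativeRing = record { isCommutativeRing = 𝔾-isCommutativeRing }

  𝔾-ring : AlmostCommutativeRing 0ℓ 0ℓ
  𝔾-ring = fromCommutativeRing 𝔾-commutativeRing zero?
    where
    zero? : ∀ x → Maybe (0ᴳ ≡ x)
    zero? (a +ⁱ b) with 0ℚ ℚ.≟ a | 0ℚ ℚ.≟ b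
    ... | yes p | yes q = just (cong₂ _+ⁱ_ p q)
    ... | _     | _     = nothing

  open import Algebra.Properties.CommutativeSemiring.Exp
      (CommutativeRing.commutativeSemiring 𝔾-commutativeRing) public
    using (^-homo-*; ^-assocʳ; ^-distrib-*) renaming (_^_ to _^ᴳ_)

  open import Algebra.Definitions.RawSemiring ℚ.+-*-rawSemiring public
    using () renaming (_^_ to _^ℚ_)

  -- Ordered field facts

  p≤q⇒0≤q-p : ∀ {p q} → p ≤ q → 0ℚ ≤ q - p
  p≤q⇒0≤q-p {p} {q} p≤q = subst (_≤ q - p) (ℚ.+-inverseʳ p) (ℚ.+-monoˡ-≤ (- p) p≤q)

  0≤q-p⇒p≤q : ∀ {p q} → 0ℚ ≤ q - p → p ≤ q
  0≤q-p⇒p≤q {p} {q} 0≤ = subst₂ _≤_ (ℚ.+-identityˡ p) (cancel q p) (ℚ.+-monoˡ-≤ p 0≤)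
    where
    cancel : ∀ q p → q - p + p ≡ q
    cancel = solve-∀ ℚ-ring

  p<q⇒0<q-p : ∀ {p q} → p < q → 0ℚ < q - p
  p<q⇒0<q-p {p} {q} p<q = subst (_< q - p) (ℚ.+-inverseʳ p) (ℚ.+-monoˡ-< (- p) p<q)

  0≤p*q : ∀ {p q} → 0ℚ ≤ p → 0ℚ ≤ q → 0ℚ ≤ p * q
  0≤p*q {p} {q} 0≤p 0≤q =
    subst (_≤ p * q) (ℚ.*-zeroʳ p) (ℚ.*-monoˡ-≤-nonNeg p {{ℚ.nonNegative 0≤p}} 0≤q)

  0<p*q : ∀ {p q} → 0ℚ < p → 0ℚ < q → 0ℚ < p * q
  0<p*q {p} {q} 0<p 0<q =
    subst (_< p * q) (ℚ.*-zeroʳ p) (ℚ.*-monoʳ-<-pos p {{ℚ.positive 0<p}} 0<q)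

  0≤p+q : ∀ {p q} → 0ℚ ≤ p → 0ℚ ≤ q → 0ℚ ≤ p + q
  0≤p+q 0≤p 0≤q = ℚ.+-mono-≤ 0≤p 0≤q

  *-mono-≤ : ∀ {p q r s} → 0ℚ ≤ p → p ≤ q → 0ℚ ≤ r → r ≤ s → p * r ≤ q * s
  *-mono-≤ {p} {q} {r} {s} 0≤p p≤q 0≤r r≤s = ℚ.≤-trans
    (ℚ.*-monoˡ-≤-nonNeg p {{ℚ.nonNegative 0≤p}} r≤s)
    (ℚ.*-monoʳ-≤-nonNeg s {{ℚ.nonNegative (ℚ.≤-trans 0≤r r≤s)}} p≤q)

  0≤p*p : ∀ p → 0ℚ ≤ p * p
  0≤p*p p with ℚ.≤-total 0ℚ p
  ... | inj₁ 0≤p = 0≤p*q 0≤p 0≤p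
  ... | inj₂ p≤0 = subst (0ℚ ≤_) (square-neg p) (0≤p*q (ℚ.neg-antimono-≤ p≤0) (ℚ.neg-antimono-≤ p≤0))
    where
    square-neg : ∀ p → (- p) * (- p) ≡ p * p
    square-neg = solve-∀ ℚ-ring

  p*p≤q*q⇒p≤q : ∀ {p q} → 0ℚ ≤ q → p * p ≤ q * q → p ≤ q
  p*p≤q*q⇒p≤q {p} {q} 0≤q p²≤q² = ℚ.≮⇒≥ λ q<p → ℚ.<-irrefl refl (ℚ.≤-<-trans p²≤q² (ℚ.≤-<-trans
    (ℚ.*-monoˡ-≤-nonNeg q {{ℚ.nonNegative 0≤q}} (ℚ.<⇒≤ q<p))
    (ℚ.*-monoˡ-<-pos p {{ℚ.positive (ℚ.≤-<-trans 0≤q q<p)}} q<p)))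

  *-cancelʳ-≤ : ∀ {p q r} → 0ℚ < r → p * r ≤ q * r → p ≤ q
  *-cancelʳ-≤ {r = r} 0<r = ℚ.*-cancelʳ-≤-pos r {{ℚ.positive 0<r}}

  0≤1 : 0ℚ ≤ 1ℚ
  0≤1 = ℚ.nonNegative⁻¹ 1ℚ

  0<½ : 0ℚ < ½
  0<½ = ℚ.positive⁻¹ ½

  0<1 : 0ℚ < 1ℚ
  0<1 = ℚ.positive⁻¹ 1ℚ

  abstract
    reciprocal : ∀ {p} → 0ℚ < p → ∃[ r ] (0ℚ < r × r * p ≡ 1ℚ)
    reciprocal {p} 0<p = ℚ.1/ p , ℚ.positive⁻¹ _ {{ℚ.1/pos⇒pos p}} , ℚ.*-inverseˡ p
      where
      instance
        pos : ℚ.Positive p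
        pos = ℚ.positive 0<p
        nonZero : ℚ.NonZero p
        nonZero = ℚ.pos⇒nonZero p

  -- Recursive, so that `fromℕ (suc n)` unfolds in inductions; the comparison with numerators is
  -- confined to `archimedean`.
  fromℕ : ℕ → ℚ
  fromℕ zero    = 0ℚ
  fromℕ (suc n) = 1ℚ + fromℕ n

  0≤fromℕ : ∀ n → 0ℚ ≤ fromℕ n
  0≤fromℕ zero    = ℚ.≤-refl
  0≤fromℕ (suc n) = 0≤p+q 0≤1 (0≤fromℕ n)

  fromℕ-mono-≤ : ∀ {m n} → m ℕ.≤ n → fromℕ m ≤ fromℕ n
  fromℕ-mono-≤ {n = n} ℕ.z≤n = 0≤fromℕ n
  fromℕ-mono-≤ (ℕ.s≤s m≤n)   = ℚ.+-monoʳ-≤ 1ℚ (fromℕ-mono-≤ m≤n)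

  fromℕ-+ : ∀ m n → fromℕ (m ℕ.+ n) ≡ fromℕ m + fromℕ n
  fromℕ-+ zero    n = sym (ℚ.+-identityˡ _)
  fromℕ-+ (suc m) n = trans (cong (1ℚ +_) (fromℕ-+ m n)) (sym (ℚ.+-assoc 1ℚ (fromℕ m) (fromℕ n)))

  fromℕ-* : ∀ m n → fromℕ (m ℕ.* n) ≡ fromℕ m * fromℕ n
  fromℕ-* zero    n = sym (ℚ.*-zeroˡ (fromℕ n))
  fromℕ-* (suc m) n = begin
    fromℕ (n ℕ.+ m ℕ.* n)        ≡⟨ fromℕ-+ n (m ℕ.* n) ⟩
    fromℕ n + fromℕ (m ℕ.* n)    ≡⟨ cong (fromℕ n +_) (fromℕ-* m n) ⟩
    fromℕ n + fromℕ m * fromℕ n  ≡⟨ lemma (fromℕ m) (fromℕ n) ⟩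
    (1ℚ + fromℕ m) * fromℕ n     ∎
    where
    open ≡-Reasoning
    lemma : ∀ x y → y + x * y ≡ (1ℚ + x) * y
    lemma = solve-∀ ℚ-ring

  private
    toℚᵘ-fromℕ : ∀ n → ℚ.toℚᵘ (fromℕ n) ℚᵘ.≃ ℚᵘ.mkℚᵘ (ℤ.+ n) 0
    toℚᵘ-fromℕ zero    = ℚᵘ.≃-refl
    toℚᵘ-fromℕ (suc n) = ℚᵘ.≃-trans (ℚ.toℚᵘ-homo-+ 1ℚ (fromℕ n))
      (ℚᵘ.≃-trans (ℚᵘ.+-congʳ (ℚ.toℚᵘ 1ℚ) (toℚᵘ-fromℕ n))
        (ℚᵘ.*≡* (cong (λ t → (ℤ.1ℤ ℤ.+ t) ℤ.* ℤ.1ℤ) (ℤ.*-identityʳ (ℤ.+ n)))))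

  -- The absolute value of the numerator is large enough, because the denominator is at least 1.
  archimedean : ∀ p → ∃[ n ] (p ≤ fromℕ n)
  archimedean (ℚ.mkℚ i d-1 c) = ℤ.∣ i ∣ , ℚ.toℚᵘ-cancel-≤
    (ℚᵘ.≤-trans (ℚᵘ.*≤* below) (ℚᵘ.≤-reflexive (ℚᵘ.≃-sym (toℚᵘ-fromℕ ℤ.∣ i ∣))))
    where
    i≤∣i∣ : ∀ i → i ℤ.≤ ℤ.+ ℤ.∣ i ∣
    i≤∣i∣ (ℤ.+ n)      = ℤ.≤-refl
    i≤∣i∣ (ℤ.-[1+ n ]) = ℤ.-≤+
    open ℤ.≤-Reasoning
    below : i ℤ.* ℤ.1ℤ ℤ.≤ (ℤ.+ ℤ.∣ i ∣) ℤ.* (ℤ.+ suc d-1)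
    below = begin
      i ℤ.* ℤ.1ℤ                    ≡⟨ ℤ.*-identityʳ i ⟩
      i                             ≤⟨ i≤∣i∣ i ⟩
      ℤ.+ ℤ.∣ i ∣                   ≡⟨ cong ℤ.+_ (ℕ.*-identityʳ ℤ.∣ i ∣) ⟨
      ℤ.+ (ℤ.∣ i ∣ ℕ.* 1)           ≤⟨ ℤ.+≤+ (ℕ.*-monoʳ-≤ ℤ.∣ i ∣ (ℕ.s≤s ℕ.z≤n)) ⟩
      ℤ.+ (ℤ.∣ i ∣ ℕ.* suc d-1)     ≡⟨ ℤ.pos-* ℤ.∣ i ∣ (suc d-1) ⟩
      (ℤ.+ ℤ.∣ i ∣) ℤ.* (ℤ.+ suc d-1) ∎

  -- Null sequences

  -- An upper bound is enough: the sequences concerned bound norms and are nonnegative.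
  Null : (ℕ → ℚ) → Set
  Null x = ∀ ε → 0ℚ < ε → Eventually λ n → x n ≤ ε

  null-mono : ∀ {x y} → (∀ n → x n ≤ y n) → Null y → Null x
  null-mono x≤y ny ε 0<ε = proj₁ (ny ε 0<ε) , λ n N≤n → ℚ.≤-trans (x≤y n) (proj₂ (ny ε 0<ε) n N≤n)

  abstract
    -- Applying the hypothesis to ε / (1 + B) instead of ε / B covers B = 0.
    null-* : ∀ {x} B → 0ℚ ≤ B → Null x → Null (λ n → B * x n)
    null-* {x} B 0≤B nx ε 0<ε = N , λ n N≤n → begin
      B * x n                ≤⟨ ℚ.*-monoˡ-≤-nonNeg B {{ℚ.nonNegative 0≤B}} (h n N≤n) ⟩
      B * (r * ε)            ≤⟨ ℚ.*-monoʳ-≤-nonNeg (r * ε) {{ℚ.nonNegative (ℚ.<⇒≤ (0<p*q 0<r 0<ε))}} B≤1+B ⟩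
      (1ℚ + B) * (r * ε)     ≡⟨ lemma (1ℚ + B) r ε ⟩
      r * (1ℚ + B) * ε       ≡⟨ cong (_* ε) inv ⟩
      1ℚ * ε                 ≡⟨ ℚ.*-identityˡ ε ⟩
      ε ∎
      where
      open ℚ.≤-Reasoning
      lemma : ∀ a b c → a * (b * c) ≡ b * a * c
      lemma = solve-∀ ℚ-ring
      B≤1+B : B ≤ 1ℚ + B
      B≤1+B = subst (_≤ 1ℚ + B) (ℚ.+-identityˡ B) (ℚ.+-monoˡ-≤ B 0≤1)
      0<1+B : 0ℚ < 1ℚ + B
      0<1+B = ℚ.+-mono-<-≤ 0<1 0≤B
      r : ℚ
      r = proj₁ (reciprocal 0<1+B)
      0<r : 0ℚ < r
      0<r = proj₁ (proj₂ (reciprocal 0<1+B))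
      inv : r * (1ℚ + B) ≡ 1ℚ
      inv = proj₂ (proj₂ (reciprocal 0<1+B))
      N : ℕ
      N = proj₁ (nx (r * ε) (0<p*q 0<r 0<ε))
      h : ∀ n → N ℕ.≤ n → x n ≤ r * ε
      h = proj₂ (nx (r * ε) (0<p*q 0<r 0<ε))

  -- Geometric decay and a lower bound for ∏(1 - ρ^j)

  module Geometric (ρ : ℚ) (0≤ρ : 0ℚ ≤ ρ) (ρ<1 : ρ < 1ℚ) where

    0≤ρ^ : ∀ n → 0ℚ ≤ ρ ^ℚ n
    0≤ρ^ zero    = 0≤1
    0≤ρ^ (suc n) = 0≤p*q 0≤ρ (0≤ρ^ n)

    ρ^≤1 : ∀ n → ρ ^ℚ n ≤ 1ℚ
    ρ^≤1 zero    = ℚ.≤-refl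
    ρ^≤1 (suc n) = *-mono-≤ {s = 1ℚ} 0≤ρ (ℚ.<⇒≤ ρ<1) (0≤ρ^ n) (ρ^≤1 n)

    ρ^-anti : ∀ {m n} → m ℕ.≤ n → ρ ^ℚ n ≤ ρ ^ℚ m
    ρ^-anti {n = n} ℕ.z≤n = ρ^≤1 n
    ρ^-anti (ℕ.s≤s {m} m≤n) = ℚ.*-monoˡ-≤-nonNeg ρ {{ℚ.nonNegative 0≤ρ}} (ρ^-anti m≤n)

    0<1-ρ : 0ℚ < 1ℚ - ρ
    0<1-ρ = p<q⇒0<q-p ρ<1

    κ : ℚ
    κ = proj₁ (reciprocal 0<1-ρ)

    0<κ : 0ℚ < κ
    0<κ = proj₁ (proj₂ (reciprocal 0<1-ρ))

    0≤κ : 0ℚ ≤ κ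
    0≤κ = ℚ.<⇒≤ 0<κ

    κ[1-ρ]≡1 : κ * (1ℚ - ρ) ≡ 1ℚ
    κ[1-ρ]≡1 = proj₂ (proj₂ (reciprocal 0<1-ρ))

    -- The quotient (1 - ρ^n) / (1 - ρ) = 1 + ρ + ... + ρ^(n-1) has n terms, each at least ρ^n. The
    -- induction `bound` proves this with the denominator cleared.
    nρ^n≤κ : ∀ n → fromℕ n * ρ ^ℚ n ≤ κ
    nρ^n≤κ n = *-cancelʳ-≤ 0<1-ρ (begin
      fromℕ n * ρ ^ℚ n * (1ℚ - ρ)  ≤⟨ bound n ⟩
      1ℚ - ρ ^ℚ n                  ≤⟨ ℚ.+-monoʳ-≤ 1ℚ (ℚ.neg-antimono-≤ (0≤ρ^ n)) ⟩
      1ℚ                           ≡⟨ κ[1-ρ]≡1 ⟨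
      κ * (1ℚ - ρ)                 ∎)
      where
      open ℚ.≤-Reasoning
      step : ∀ x t r → 1ℚ - r * t - (1ℚ + x) * (r * t) * (1ℚ - r)
        ≡ r * (1ℚ - t - x * t * (1ℚ - r)) + (1ℚ - r) * (1ℚ - r * t)
      step = solve-∀ ℚ-ring
      base : ∀ r → 0ℚ * 1ℚ * (1ℚ - r) ≡ 1ℚ - 1ℚ
      base = solve-∀ ℚ-ring
      bound : ∀ n → fromℕ n * ρ ^ℚ n * (1ℚ - ρ) ≤ 1ℚ - ρ ^ℚ n
      bound zero    = ℚ.≤-reflexive (base ρ)
      bound (suc n) = 0≤q-p⇒p≤q (subst (0ℚ ≤_) (sym (step (fromℕ n) (ρ ^ℚ n) ρ))
        (0≤p+q (0≤p*q 0≤ρ (p≤q⇒0≤q-p (bound n)))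
          (0≤p*q (ℚ.<⇒≤ 0<1-ρ) (p≤q⇒0≤q-p (ρ^≤1 (suc n))))))

    abstract
      -- By `nρ^n≤κ`, ρ^n is at most κ / n, which is at most ε once n exceeds κ / ε. Starting at
      -- `suc N` keeps n positive for the division.
      null-ρ^ : Null (λ n → ρ ^ℚ n)
      null-ρ^ ε 0<ε with reciprocal 0<ε
      ... | r , 0<r , rε≡1 with archimedean (κ * r)
      ... | N , κr≤N = suc N , λ n N<n → *-cancelʳ-≤ {r = fromℕ n}
        (ℚ.<-≤-trans (ℚ.+-mono-<-≤ 0<1 (0≤fromℕ N)) (fromℕ-mono-≤ N<n)) (begin
        ρ ^ℚ n * fromℕ n ≡⟨ ℚ.*-comm (ρ ^ℚ n) (fromℕ n) ⟩
        fromℕ n * ρ ^ℚ n ≤⟨ nρ^n≤κ n ⟩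
        κ                ≡⟨ ℚ.*-identityʳ κ ⟨
        κ * 1ℚ           ≡⟨ cong (κ *_) rε≡1 ⟨
        κ * (r * ε)      ≡⟨ lemma κ r ε ⟩
        ε * (κ * r)      ≤⟨ ℚ.*-monoˡ-≤-nonNeg ε {{ℚ.nonNegative (ℚ.<⇒≤ 0<ε)}}
                              (ℚ.≤-trans κr≤N (fromℕ-mono-≤ (ℕ.<⇒≤ N<n))) ⟩
        ε * fromℕ n      ∎)
        where
        open ℚ.≤-Reasoning
        lemma : ∀ a b c → a * (b * c) ≡ c * (a * b)
        lemma = solve-∀ ℚ-ring

    -- Weierstrass' inequality ∏(1 - xⱼ) ≥ 1 - ∑ xⱼ applied to the tail of the
    -- product, whose sum is at most 1/2 from some index on.
    ∏[1-ρ^] : ℕ → ℚ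
    ∏[1-ρ^] zero    = 1ℚ
    ∏[1-ρ^] (suc n) = ∏[1-ρ^] n * (1ℚ - ρ ^ℚ suc n)

    0≤1-ρ^ : ∀ n → 0ℚ ≤ 1ℚ - ρ ^ℚ n
    0≤1-ρ^ n = p≤q⇒0≤q-p (ρ^≤1 n)

    0<∏[1-ρ^] : ∀ n → 0ℚ < ∏[1-ρ^] n
    0<∏[1-ρ^] zero    = 0<1
    0<∏[1-ρ^] (suc n) = 0<p*q (0<∏[1-ρ^] n) (ℚ.<-≤-trans 0<1-ρ
      (ℚ.+-monoʳ-≤ 1ℚ (ℚ.neg-antimono-≤ (ℚ.≤-trans (ρ^-anti {1} {suc n} (ℕ.s≤s ℕ.z≤n)) (ℚ.≤-reflexive (ℚ.*-identityʳ ρ))))))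

    ∏[1-ρ^]-anti : ∀ n k → ∏[1-ρ^] (k ℕ.+ n) ≤ ∏[1-ρ^] n
    ∏[1-ρ^]-anti n zero    = ℚ.≤-refl
    ∏[1-ρ^]-anti n (suc k) = ℚ.≤-trans
      (subst (P * (1ℚ - ρ ^ℚ suc (k ℕ.+ n)) ≤_) (ℚ.*-identityʳ P)
        (ℚ.*-monoˡ-≤-nonNeg P {{ℚ.nonNegative (ℚ.<⇒≤ (0<∏[1-ρ^] (k ℕ.+ n)))}}
          (ℚ.+-monoʳ-≤ 1ℚ (ℚ.neg-antimono-≤ (0≤ρ^ (suc (k ℕ.+ n)))))))
      (∏[1-ρ^]-anti n k)
      where P = ∏[1-ρ^] (k ℕ.+ n)

    private
      -- The closed form of the geometric sum of ρ^j over n < j ≤ n + k.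
      tail : ℕ → ℕ → ℚ
      tail n k = κ * (ρ ^ℚ suc n - ρ ^ℚ suc (k ℕ.+ n))

      0≤tail : ∀ n k → 0ℚ ≤ tail n k
      0≤tail n k = 0≤p*q 0≤κ (p≤q⇒0≤q-p (ρ^-anti (ℕ.s≤s (ℕ.m≤n+m n k))))

      tail-suc : ∀ n k → tail n (suc k) ≡ tail n k + ρ ^ℚ suc (k ℕ.+ n)
      tail-suc n k = trans (split κ (ρ ^ℚ suc n) (ρ ^ℚ suc (k ℕ.+ n)) ρ)
        (cong (tail n k +_) (trans (cong (_* ρ ^ℚ suc (k ℕ.+ n)) κ[1-ρ]≡1) (ℚ.*-identityˡ _)))
        where
        split : ∀ k a b r → k * (a - r * b) ≡ k * (a - b) + k * (1ℚ - r) * b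
        split = solve-∀ ℚ-ring

      weierstrass : ∀ n k → ∏[1-ρ^] n * (1ℚ - tail n k) ≤ ∏[1-ρ^] (k ℕ.+ n)
      weierstrass n zero    = ℚ.≤-reflexive (base κ (∏[1-ρ^] n) (ρ ^ℚ suc n))
        where
        base : ∀ k p t → p * (1ℚ - k * (t - t)) ≡ p
        base = solve-∀ ℚ-ring
      weierstrass n (suc k) = begin
        P * (1ℚ - tail n (suc k))       ≡⟨ cong (λ t → P * (1ℚ - t)) (tail-suc n k) ⟩
        P * (1ℚ - (s + r))              ≤⟨ 0≤q-p⇒p≤q (subst (0ℚ ≤_) (sym (expand P s r))
                                             (0≤p*q (ℚ.<⇒≤ (0<∏[1-ρ^] n)) (0≤p*q (0≤tail n k) (0≤ρ^ (suc (k ℕ.+ n)))))) ⟩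
        P * (1ℚ - s) * (1ℚ - r)         ≤⟨ ℚ.*-monoʳ-≤-nonNeg (1ℚ - r) {{ℚ.nonNegative (0≤1-ρ^ (suc (k ℕ.+ n)))}}
                                             (weierstrass n k) ⟩
        ∏[1-ρ^] (k ℕ.+ n) * (1ℚ - r)    ∎
        where
        open ℚ.≤-Reasoning
        P = ∏[1-ρ^] n
        s = tail n k
        r = ρ ^ℚ suc (k ℕ.+ n)
        expand : ∀ p s r → p * (1ℚ - s) * (1ℚ - r) - p * (1ℚ - (s + r)) ≡ p * (s * r)
        expand = solve-∀ ℚ-ring

    abstract
      ∏[1-ρ^]-bounded-below : ∃[ c ] (0ℚ < c × ∀ n → c ≤ ∏[1-ρ^] n)
      ∏[1-ρ^]-bounded-below = ∏[1-ρ^] N * ½ , 0<p*q (0<∏[1-ρ^] N) 0<½ , λ n → begin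
        ∏[1-ρ^] N * ½               ≤⟨ ℚ.*-monoˡ-≤-nonNeg (∏[1-ρ^] N) {{ℚ.nonNegative (ℚ.<⇒≤ (0<∏[1-ρ^] N))}} (half≤ n) ⟩
        ∏[1-ρ^] N * (1ℚ - tail N n) ≤⟨ weierstrass N n ⟩
        ∏[1-ρ^] (n ℕ.+ N)           ≡⟨ cong ∏[1-ρ^] (ℕ.+-comm n N) ⟩
        -- Passing from N + n to n by monotonicity spares a separate case for n < N.
        ∏[1-ρ^] (N ℕ.+ n)           ≤⟨ ∏[1-ρ^]-anti n N ⟩
        ∏[1-ρ^] n                   ∎
        where
        open ℚ.≤-Reasoning
        small : Eventually (λ n → κ * ρ ^ℚ n ≤ ½)
        small = null-* κ 0≤κ null-ρ^ ½ 0<½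
        N : ℕ
        N = proj₁ small
        half≤ : ∀ n → ½ ≤ 1ℚ - tail N n
        half≤ n = ℚ.+-monoʳ-≤ 1ℚ (ℚ.neg-antimono-≤ (begin
          κ * (ρ ^ℚ suc N - ρ ^ℚ suc (n ℕ.+ N)) ≤⟨ ℚ.*-monoˡ-≤-nonNeg κ {{ℚ.nonNegative 0≤κ}}
            (subst (ρ ^ℚ suc N - ρ ^ℚ suc (n ℕ.+ N) ≤_) (ℚ.+-identityʳ _)
              (ℚ.+-monoʳ-≤ (ρ ^ℚ suc N) (ℚ.neg-antimono-≤ (0≤ρ^ (suc (n ℕ.+ N)))))) ⟩
          κ * ρ ^ℚ suc N                        ≤⟨ proj₂ small (suc N) (ℕ.n≤1+n N) ⟩
          ½ ∎))

  -- With σ = 1 - (1 - ρ)/3, Bernoulli's inequality gives ρ ≤ σ³, so that each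
  -- factor suc n is absorbed by one σⁿ.
  module _ (ρ : ℚ) (0≤ρ : 0ℚ ≤ ρ) (ρ<1 : ρ < 1ℚ) where
    private
      ⅓ δ σ : ℚ
      ⅓ = ℤ.1ℤ ℚ./ 3
      δ = ⅓ * (1ℚ - ρ)
      σ = 1ℚ - δ
      0<δ : 0ℚ < δ
      0<δ = 0<p*q (ℚ.positive⁻¹ ⅓) (p<q⇒0<q-p ρ<1)
      δ≤⅓ : δ ≤ ⅓
      δ≤⅓ = 0≤q-p⇒p≤q (subst (0ℚ ≤_) (sym (lemma ⅓ ρ)) (0≤p*q (ℚ.nonNegative⁻¹ ⅓) 0≤ρ))
        where
        lemma : ∀ t r → t - t * (1ℚ - r) ≡ t * r
        lemma = solve-∀ ℚ-ring
      0≤σ : 0ℚ ≤ σ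
      0≤σ = p≤q⇒0≤q-p (ℚ.≤-trans δ≤⅓ (ℚ.≤ᵇ⇒≤ {⅓} {1ℚ} _))
      σ<1 : σ < 1ℚ
      σ<1 = subst (σ <_) (ℚ.+-identityʳ 1ℚ) (ℚ.+-monoʳ-< 1ℚ (ℚ.neg-antimono-< 0<δ))
      ρ≤σ³ : ρ ≤ σ * (σ * σ)
      ρ≤σ³ = 0≤q-p⇒p≤q (subst (0ℚ ≤_) (sym (lemma ρ))
        (0≤p*q (0≤p*p δ) (0≤p+q (ℚ.nonNegative⁻¹ (1ℚ + 1ℚ)) 0≤σ)))
        where
        lemma : ∀ r → let d = ⅓ * (1ℚ - r) ; s = 1ℚ - d in
          s * (s * s) - r ≡ d * d * (1ℚ + 1ℚ + s)
        lemma = solve-∀ ℚ-ring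
      module σ = Geometric σ 0≤σ σ<1
      ρ^≤ : ∀ n → ρ ^ℚ n ≤ σ ^ℚ n * (σ ^ℚ n * σ ^ℚ n)
      ρ^≤ zero    = ℚ.≤-refl
      ρ^≤ (suc n) = ℚ.≤-trans (*-mono-≤ 0≤ρ ρ≤σ³ (Geometric.0≤ρ^ ρ 0≤ρ ρ<1 n) (ρ^≤ n))
        (ℚ.≤-reflexive (lemma σ (σ ^ℚ n)))
        where
        lemma : ∀ s t → s * (s * s) * (t * (t * t)) ≡ s * t * (s * t * (s * t))
        lemma = solve-∀ ℚ-ring
      absorb : ∀ n → fromℕ (suc n) * σ ^ℚ n ≤ 1ℚ + σ.κ
      absorb n = subst (_≤ 1ℚ + σ.κ) (lemma (fromℕ n) (σ ^ℚ n)) (ℚ.+-mono-≤ (σ.ρ^≤1 n) (σ.nρ^n≤κ n))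
        where
        lemma : ∀ x t → t + x * t ≡ (1ℚ + x) * t
        lemma = solve-∀ ℚ-ring

    abstract
      null-[1+n]²ρ^n : Null (λ n → fromℕ (suc n) * fromℕ (suc n) * ρ ^ℚ n)
      null-[1+n]²ρ^n = null-mono bound
        (null-* ((1ℚ + σ.κ) * (1ℚ + σ.κ)) (0≤p*p (1ℚ + σ.κ)) σ.null-ρ^)
        where
        open ℚ.≤-Reasoning
        bound : ∀ n → fromℕ (suc n) * fromℕ (suc n) * ρ ^ℚ n ≤ (1ℚ + σ.κ) * (1ℚ + σ.κ) * σ ^ℚ n
        bound n = begin
          N * N * ρ ^ℚ n              ≤⟨ ℚ.*-monoˡ-≤-nonNeg (N * N) {{ℚ.nonNegative (0≤p*p N)}} (ρ^≤ n) ⟩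
          N * N * (t * (t * t))       ≡⟨ lemma N t ⟩
          N * t * (N * t) * t         ≤⟨ ℚ.*-monoʳ-≤-nonNeg t {{ℚ.nonNegative (σ.0≤ρ^ n)}}
                                           (*-mono-≤ 0≤Nt (absorb n) 0≤Nt (absorb n)) ⟩
          (1ℚ + σ.κ) * (1ℚ + σ.κ) * t ∎
          where
          N : ℚ
          N = fromℕ (suc n)
          t : ℚ
          t = σ ^ℚ n
          0≤Nt : 0ℚ ≤ N * t
          0≤Nt = 0≤p*q (0≤fromℕ (suc n)) (σ.0≤ρ^ n)
          lemma : ∀ N t → N * N * (t * (t * t)) ≡ N * t * (N * t) * t
          lemma = solve-∀ ℚ-ring

  -- Bounds for the modulus of Gaussian rationals

  normSq : 𝔾 → ℚ
  normSq x = reᴳ x * reᴳ x + imᴳ x * imᴳ x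

  0≤normSq : ∀ x → 0ℚ ≤ normSq x
  0≤normSq x = 0≤p+q (0≤p*p (reᴳ x)) (0≤p*p (imᴳ x))

  normSq-* : ∀ x y → normSq (x *ᴳ y) ≡ normSq x * normSq y
  normSq-* (a +ⁱ b) (c +ⁱ d) = lemma a b c d
    where
    lemma : ∀ a b c d → (a * c - b * d) * (a * c - b * d) + (a * d + b * c) * (a * d + b * c)
      ≡ (a * a + b * b) * (c * c + d * d)
    lemma = solve-∀ ℚ-ring

  normSq-⊝ : ∀ x → normSq (⊝ x) ≡ normSq x
  normSq-⊝ (a +ⁱ b) = lemma a b
    where
    lemma : ∀ a b → (- a) * (- a) + (- b) * (- b) ≡ a * a + b * b
    lemma = solve-∀ ℚ-ring

  infix 4 _≼_ _≽_

  -- |x| ≤ c and |x| ≥ c, squared so that no square root is needed.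
  record _≼_ (x : 𝔾) (c : ℚ) : Set where
    constructor ≼-intro
    field
      0≤bound  : 0ℚ ≤ c
      normSq≤  : normSq x ≤ c * c
  open _≼_ public

  record _≽_ (x : 𝔾) (c : ℚ) : Set where
    constructor ≽-intro
    field
      0≤lower  : 0ℚ ≤ c
      ≤normSq  : c * c ≤ normSq x
  open _≽_ public

  ≼-mono : ∀ {x c d} → c ≤ d → x ≼ c → x ≼ d
  ≼-mono c≤d (≼-intro 0≤c h) = ≼-intro (ℚ.≤-trans 0≤c c≤d)
    (ℚ.≤-trans h (*-mono-≤ 0≤c c≤d 0≤c c≤d))

  ≽-mono : ∀ {x c d} → 0ℚ ≤ d → d ≤ c → x ≽ c → x ≽ d
  ≽-mono 0≤d d≤c (≽-intro _ h) = ≽-intro 0≤d (ℚ.≤-trans (*-mono-≤ 0≤d d≤c 0≤d d≤c) h)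

  0≼ : ∀ {c} → 0ℚ ≤ c → 0ᴳ ≼ c
  0≼ {c} 0≤c = ≼-intro 0≤c (0≤p*p c)

  1≼1 : 1ᴳ ≼ 1ℚ
  1≼1 = ≼-intro 0≤1 ℚ.≤-refl

  1≽1 : 1ᴳ ≽ 1ℚ
  1≽1 = ≽-intro 0≤1 ℚ.≤-refl

  ⊝-≼ : ∀ {x c} → x ≼ c → ⊝ x ≼ c
  ⊝-≼ {x} {c} (≼-intro 0≤c h) = ≼-intro 0≤c (subst (_≤ c * c) (sym (normSq-⊝ x)) h)

  *-≼ : ∀ {x y c d} → x ≼ c → y ≼ d → x *ᴳ y ≼ c * d
  *-≼ {x} {y} {c} {d} (≼-intro 0≤c hx) (≼-intro 0≤d hy) = ≼-intro (0≤p*q 0≤c 0≤d) (begin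
    normSq (x *ᴳ y)      ≡⟨ normSq-* x y ⟩
    normSq x * normSq y  ≤⟨ *-mono-≤ (0≤normSq x) hx (0≤normSq y) hy ⟩
    c * c * (d * d)      ≡⟨ lemma c d ⟩
    c * d * (c * d)      ∎)
    where
    open ℚ.≤-Reasoning
    lemma : ∀ c d → c * c * (d * d) ≡ c * d * (c * d)
    lemma = solve-∀ ℚ-ring

  *-≽ : ∀ {x y c d} → x ≽ c → y ≽ d → x *ᴳ y ≽ c * d
  *-≽ {x} {y} {c} {d} (≽-intro 0≤c hx) (≽-intro 0≤d hy) = ≽-intro (0≤p*q 0≤c 0≤d) (begin
    c * d * (c * d)      ≡⟨ lemma c d ⟩
    c * c * (d * d)      ≤⟨ *-mono-≤ (0≤p*p c) hx (0≤p*p d) hy ⟩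
    normSq x * normSq y  ≡⟨ normSq-* x y ⟨
    normSq (x *ᴳ y)      ∎)
    where
    open ℚ.≤-Reasoning
    lemma : ∀ c d → c * d * (c * d) ≡ c * c * (d * d)
    lemma = solve-∀ ℚ-ring

  -- The Cauchy–Schwarz inequality bounds Re (x ȳ) by c d.
  +-≼ : ∀ {x y c d} → x ≼ c → y ≼ d → x +ᴳ y ≼ c + d
  +-≼ {x@(a +ⁱ b)} {y@(a′ +ⁱ b′)} {c} {d} (≼-intro 0≤c hx) (≼-intro 0≤d hy) =
    ≼-intro (0≤p+q 0≤c 0≤d) (begin
      normSq (x +ᴳ y)                      ≡⟨ expand a b a′ b′ ⟩
      (normSq x + normSq y) + (t + t)      ≤⟨ ℚ.+-mono-≤ (ℚ.+-mono-≤ hx hy) (ℚ.+-mono-≤ t≤cd t≤cd) ⟩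
      (c * c + d * d) + (c * d + c * d)    ≡⟨ square c d ⟩
      (c + d) * (c + d)                    ∎)
    where
    open ℚ.≤-Reasoning
    t = a * a′ + b * b′
    u = a * b′ - b * a′
    expand : ∀ a b a′ b′ → (a + a′) * (a + a′) + (b + b′) * (b + b′)
      ≡ ((a * a + b * b) + (a′ * a′ + b′ * b′)) + ((a * a′ + b * b′) + (a * a′ + b * b′))
    expand = solve-∀ ℚ-ring
    square : ∀ c d → (c * c + d * d) + (c * d + c * d) ≡ (c + d) * (c + d)
    square = solve-∀ ℚ-ring
    lagrange : ∀ a b a′ b′ → (a * a + b * b) * (a′ * a′ + b′ * b′) - (a * a′ + b * b′) * (a * a′ + b * b′)
      ≡ (a * b′ - b * a′) * (a * b′ - b * a′)
    lagrange = solve-∀ ℚ-ring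
    regroup : ∀ c d → c * c * (d * d) ≡ c * d * (c * d)
    regroup = solve-∀ ℚ-ring
    t≤cd : t ≤ c * d
    t≤cd = p*p≤q*q⇒p≤q (0≤p*q 0≤c 0≤d) (begin
      t * t                ≤⟨ 0≤q-p⇒p≤q (subst (0ℚ ≤_) (sym (lagrange a b a′ b′)) (0≤p*p u)) ⟩
      normSq x * normSq y  ≤⟨ *-mono-≤ (0≤normSq x) hx (0≤normSq y) hy ⟩
      c * c * (d * d)      ≡⟨ regroup c d ⟩
      c * d * (c * d)      ∎)

  -ᴳ-≼ : ∀ {x y c d} → x ≼ c → y ≼ d → x -ᴳ y ≼ c + d
  -ᴳ-≼ hx hy = +-≼ hx (⊝-≼ hy)

  ^-≼ : ∀ {x c} → x ≼ c → ∀ n → x ^ᴳ n ≼ c ^ℚ n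
  ^-≼ h zero    = 1≼1
  ^-≼ h (suc n) = *-≼ h (^-≼ h n)

  private
    re²≤normSq : ∀ x → reᴳ x * reᴳ x ≤ normSq x
    re²≤normSq x = subst (_≤ normSq x) (ℚ.+-identityʳ (reᴳ x * reᴳ x))
      (ℚ.+-monoʳ-≤ (reᴳ x * reᴳ x) (0≤p*p (imᴳ x)))

    im²≤normSq : ∀ x → imᴳ x * imᴳ x ≤ normSq x
    im²≤normSq x = subst (_≤ normSq x) (ℚ.+-identityˡ (imᴳ x * imᴳ x))
      (ℚ.+-monoˡ-≤ (imᴳ x * imᴳ x) (0≤p*p (reᴳ x)))

  reᴳ≤ : ∀ {x c} → x ≼ c → reᴳ x ≤ c
  reᴳ≤ {x} (≼-intro 0≤c h) = p*p≤q*q⇒p≤q 0≤c (ℚ.≤-trans (re²≤normSq x) h)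

  imᴳ≤ : ∀ {x c} → x ≼ c → imᴳ x ≤ c
  imᴳ≤ {x} (≼-intro 0≤c h) = p*p≤q*q⇒p≤q 0≤c (ℚ.≤-trans (im²≤normSq x) h)

  private
    ∣p∣≤q : ∀ {p q} → p ≤ q → - p ≤ q → ℚ.∣ p ∣ ≤ q
    ∣p∣≤q {p} {q} p≤q -p≤q with ℚ.∣p∣≡p∨∣p∣≡-p p
    ... | inj₁ eq = subst (_≤ q) (sym eq) p≤q
    ... | inj₂ eq = subst (_≤ q) (sym eq) -p≤q

  ∣reᴳ∣≤ : ∀ {x c} → x ≼ c → ℚ.∣ reᴳ x ∣ ≤ c
  ∣reᴳ∣≤ h = ∣p∣≤q (reᴳ≤ h) (reᴳ≤ (⊝-≼ h))

  ∣imᴳ∣≤ : ∀ {x c} → x ≼ c → ℚ.∣ imᴳ x ∣ ≤ c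
  ∣imᴳ∣≤ h = ∣p∣≤q (imᴳ≤ h) (imᴳ≤ (⊝-≼ h))

  ∣p∣*∣p∣≡p*p : ∀ p → ℚ.∣ p ∣ * ℚ.∣ p ∣ ≡ p * p
  ∣p∣*∣p∣≡p*p p with ℚ.∣p∣≡p∨∣p∣≡-p p
  ... | inj₁ eq rewrite eq = refl
  ... | inj₂ eq rewrite eq = lemma p
    where
    lemma : ∀ p → (- p) * (- p) ≡ p * p
    lemma = solve-∀ ℚ-ring

  components-≼ : ∀ {x c d} → ℚ.∣ reᴳ x ∣ ≤ c → ℚ.∣ imᴳ x ∣ ≤ d → x ≼ c + d
  components-≼ {a +ⁱ b} {c} {d} a≤c b≤d = ≼-intro (0≤p+q 0≤c 0≤d) (begin
    a * a + b * b                     ≤⟨ ℚ.+-mono-≤ (square a≤c) (square b≤d) ⟩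
    c * c + d * d                     ≤⟨ 0≤q-p⇒p≤q (subst (0ℚ ≤_) (sym (lemma c d)) (0≤p+q (0≤p*q 0≤c 0≤d) (0≤p*q 0≤c 0≤d))) ⟩
    (c + d) * (c + d)                 ∎)
    where
    open ℚ.≤-Reasoning
    0≤c = ℚ.≤-trans (ℚ.0≤∣p∣ a) a≤c
    0≤d = ℚ.≤-trans (ℚ.0≤∣p∣ b) b≤d
    lemma : ∀ c d → (c + d) * (c + d) - (c * c + d * d) ≡ c * d + c * d
    lemma = solve-∀ ℚ-ring
    square : ∀ {p q} → ℚ.∣ p ∣ ≤ q → p * p ≤ q * q
    square {p} {q} h = subst (_≤ q * q) (∣p∣*∣p∣≡p*p p) (*-mono-≤ (ℚ.0≤∣p∣ p) h (ℚ.0≤∣p∣ p) h)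

  -- Real parts suffice: Re (1 - x) ≥ 1 - c ≥ 0, and the modulus dominates the real part.
  1-≽ : ∀ {x c} → x ≼ c → c ≤ 1ℚ → 1ᴳ -ᴳ x ≽ 1ℚ - c
  1-≽ {x} {c} h c≤1 = ≽-intro 0≤1-c (ℚ.≤-trans
    (*-mono-≤ 0≤1-c le 0≤1-c le) (re²≤normSq (1ᴳ -ᴳ x)))
    where
    0≤1-c = p≤q⇒0≤q-p c≤1
    le : 1ℚ - c ≤ 1ℚ - reᴳ x
    le = ℚ.+-monoʳ-≤ 1ℚ (ℚ.neg-antimono-≤ (reᴳ≤ h))

  -- Replaces division by y: an estimate with cleared denominators is proved first, and the lower
  -- bound of y then removes them.
  ≼-cancel : ∀ {x y c d} → 0ℚ < c → 0ℚ ≤ d → y ≽ c → x *ᴳ y ≼ d * c → x ≼ d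
  ≼-cancel {x} {y} {c} {d} 0<c 0≤d (≽-intro _ hy) (≼-intro _ hxy) =
    ≼-intro 0≤d (*-cancelʳ-≤ (0<p*q 0<c 0<c) (begin
      normSq x * (c * c)     ≤⟨ ℚ.*-monoˡ-≤-nonNeg (normSq x) {{ℚ.nonNegative (0≤normSq x)}} hy ⟩
      normSq x * normSq y    ≡⟨ normSq-* x y ⟨
      normSq (x *ᴳ y)        ≤⟨ hxy ⟩
      d * c * (d * c)        ≡⟨ lemma d c ⟩
      d * d * (c * c)        ∎))
    where
    open ℚ.≤-Reasoning
    lemma : ∀ d c → d * c * (d * c) ≡ d * d * (c * c)
    lemma = solve-∀ ℚ-ring

  -- Finite sums and products

  module 𝔾ᵣ = CommutativeRing 𝔾-commutativeRing

  Σᴳ Πᴳ : ℕ → (ℕ → 𝔾) → 𝔾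
  Σᴳ zero    f = 0ᴳ
  Σᴳ (suc n) f = f 0 +ᴳ Σᴳ n (f ∘ suc)
  Πᴳ zero    f = 1ᴳ
  Πᴳ (suc n) f = f 0 *ᴳ Πᴳ n (f ∘ suc)

  Σᴳ-cong : ∀ n {f g} → (∀ j → j ℕ.< n → f j ≡ g j) → Σᴳ n f ≡ Σᴳ n g
  Σᴳ-cong zero    f≡g = refl
  Σᴳ-cong (suc n) f≡g = cong₂ _+ᴳ_ (f≡g 0 (ℕ.s≤s ℕ.z≤n)) (Σᴳ-cong n λ j j<n → f≡g (suc j) (ℕ.s≤s j<n))

  Πᴳ-cong : ∀ n {f g} → (∀ j → f j ≡ g j) → Πᴳ n f ≡ Πᴳ n g
  Πᴳ-cong zero    f≡g = refl
  Πᴳ-cong (suc n) f≡g = cong₂ _*ᴳ_ (f≡g 0) (Πᴳ-cong n (f≡g ∘ suc))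

  Σᴳ-last : ∀ n f → Σᴳ (suc n) f ≡ Σᴳ n f +ᴳ f n
  Σᴳ-last zero    f = 𝔾ᵣ.+-comm (f 0) 0ᴳ
  Σᴳ-last (suc n) f = trans (cong (f 0 +ᴳ_) (Σᴳ-last n (f ∘ suc))) (sym (𝔾ᵣ.+-assoc (f 0) (Σᴳ n (f ∘ suc)) (f (suc n))))

  Πᴳ-last : ∀ n f → Πᴳ (suc n) f ≡ Πᴳ n f *ᴳ f n
  Πᴳ-last zero    f = 𝔾ᵣ.*-comm (f 0) 1ᴳ
  Πᴳ-last (suc n) f = trans (cong (f 0 *ᴳ_) (Πᴳ-last n (f ∘ suc))) (sym (𝔾ᵣ.*-assoc (f 0) (Πᴳ n (f ∘ suc)) (f (suc n))))

  Σᴳ-+ : ∀ n f g → Σᴳ n (λ j → f j +ᴳ g j) ≡ Σᴳ n f +ᴳ Σᴳ n g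
  Σᴳ-+ zero    f g = refl
  Σᴳ-+ (suc n) f g = trans (cong (f 0 +ᴳ g 0 +ᴳ_) (Σᴳ-+ n (f ∘ suc) (g ∘ suc)))
    (interchange (f 0) (g 0) (Σᴳ n (f ∘ suc)) (Σᴳ n (g ∘ suc)))
    where
    interchange : ∀ a b c d → a +ᴳ b +ᴳ (c +ᴳ d) ≡ a +ᴳ c +ᴳ (b +ᴳ d)
    interchange = solve-∀ 𝔾-ring

  *-Σᴳ : ∀ n x f → x *ᴳ Σᴳ n f ≡ Σᴳ n (λ j → x *ᴳ f j)
  *-Σᴳ zero    x f = 𝔾ᵣ.zeroʳ x
  *-Σᴳ (suc n) x f = trans (𝔾ᵣ.distribˡ x (f 0) (Σᴳ n (f ∘ suc))) (cong (x *ᴳ f 0 +ᴳ_) (*-Σᴳ n x (f ∘ suc)))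

  -- Gaussian binomial coefficients

  module _ (p : 𝔾) where

    -- A Pascal rule instead of a quotient of q-factorials, whose denominators may vanish. For j > n
    -- the truncated `n ∸ j` is harmless, since `gauss n j` is then 0.
    gauss : ℕ → ℕ → 𝔾
    gauss _       zero    = 1ᴳ
    gauss zero    (suc _) = 0ᴳ
    gauss (suc n) (suc j) = gauss n (suc j) +ᴳ p ^ᴳ (n ∸ j) *ᴳ gauss n j

    gauss-> : ∀ {n j} → n ℕ.< j → gauss n j ≡ 0ᴳ
    gauss-> {zero}  {suc j} _ = refl
    gauss-> {suc n} {suc j} (ℕ.s≤s n<j)
      rewrite gauss-> {n} {suc j} (ℕ.m≤n⇒m≤1+n n<j) | gauss-> {n} {j} n<j
      = lemma (p ^ᴳ (n ∸ j))
      where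
      lemma : ∀ x → 0ᴳ +ᴳ x *ᴳ 0ᴳ ≡ 0ᴳ
      lemma = solve-∀ 𝔾-ring

    private
      p^-split : ∀ {i n} → i ℕ.≤ n → p ^ᴳ (n ∸ i) *ᴳ p ^ᴳ i ≡ p ^ᴳ n
      p^-split {i} {n} i≤n = trans (sym (^-homo-* p (n ∸ i) i)) (cong (p ^ᴳ_) (ℕ.m∸n+n≡m i≤n))

    -- Ratios of neighbouring coefficients, cross-multiplied, by simultaneous induction on n with
    -- `gauss-top`. The definition provides only one Pascal rule; the other one and the factorial
    -- formula are derived from these two.
    gauss-ratio : ∀ n j → (1ᴳ -ᴳ p ^ᴳ suc j) *ᴳ gauss n (suc j) ≡ (1ᴳ -ᴳ p ^ᴳ (n ∸ j)) *ᴳ gauss n j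
    gauss-top   : ∀ {n j} → j ℕ.≤ n → (1ᴳ -ᴳ p ^ᴳ suc j) *ᴳ gauss (suc n) (suc j) ≡ (1ᴳ -ᴳ p ^ᴳ suc n) *ᴳ gauss n j

    gauss-top {n} {j} j≤n = begin
      (1ᴳ -ᴳ p *ᴳ u) *ᴳ (gauss n (suc j) +ᴳ v *ᴳ x)          ≡⟨ split p u v x (gauss n (suc j)) ⟩
      (1ᴳ -ᴳ p *ᴳ u) *ᴳ gauss n (suc j) +ᴳ (v -ᴳ p *ᴳ (v *ᴳ u)) *ᴳ x
                                                             ≡⟨ cong₂ (λ s t → s +ᴳ (v -ᴳ p *ᴳ t) *ᴳ x)
                                                                  (gauss-ratio n j) (p^-split j≤n) ⟩
      (1ᴳ -ᴳ v) *ᴳ x +ᴳ (v -ᴳ p *ᴳ p ^ᴳ n) *ᴳ x              ≡⟨ join v (p *ᴳ p ^ᴳ n) x ⟩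
      (1ᴳ -ᴳ p *ᴳ p ^ᴳ n) *ᴳ x ∎
      where
      open ≡-Reasoning
      u = p ^ᴳ j
      v = p ^ᴳ (n ∸ j)
      x = gauss n j
      split : ∀ p u v x y → (1ᴳ -ᴳ p *ᴳ u) *ᴳ (y +ᴳ v *ᴳ x)
        ≡ (1ᴳ -ᴳ p *ᴳ u) *ᴳ y +ᴳ (v -ᴳ p *ᴳ (v *ᴳ u)) *ᴳ x
      split = solve-∀ 𝔾-ring
      join : ∀ v w x → (1ᴳ -ᴳ v) *ᴳ x +ᴳ (v -ᴳ w) *ᴳ x ≡ (1ᴳ -ᴳ w) *ᴳ x
      join = solve-∀ 𝔾-ring

    gauss-ratio zero j = vanish (p ^ᴳ suc j) (gauss zero j) (ℕ.0∸n≡0 j)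
      where
      lemma : ∀ x y → (1ᴳ -ᴳ x) *ᴳ 0ᴳ ≡ (1ᴳ -ᴳ 1ᴳ) *ᴳ y
      lemma = solve-∀ 𝔾-ring
      vanish : ∀ x y {k} → k ≡ 0 → (1ᴳ -ᴳ x) *ᴳ 0ᴳ ≡ (1ᴳ -ᴳ p ^ᴳ k) *ᴳ y
      vanish x y refl = lemma x y
    gauss-ratio (suc n) zero = gauss-top {n} {0} ℕ.z≤n
    gauss-ratio (suc n) (suc j) with ℕ.≤-<-connex (suc j) n
    ... | inj₁ 1+j≤n = begin
      (1ᴳ -ᴳ p ^ᴳ suc (suc j)) *ᴳ gauss (suc n) (suc (suc j)) ≡⟨ gauss-top 1+j≤n ⟩
      (1ᴳ -ᴳ p *ᴳ p ^ᴳ n) *ᴳ y                                ≡⟨ cong (λ t → (1ᴳ -ᴳ p *ᴳ t) *ᴳ y) (p^-split (ℕ.<⇒≤ 1+j≤n)) ⟨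
      (1ᴳ -ᴳ p *ᴳ (v *ᴳ u)) *ᴳ y                              ≡⟨ split p u v y ⟩
      (1ᴳ -ᴳ v) *ᴳ y +ᴳ v *ᴳ ((1ᴳ -ᴳ p *ᴳ u) *ᴳ y)            ≡⟨ cong (λ t → (1ᴳ -ᴳ v) *ᴳ y +ᴳ v *ᴳ t) (gauss-ratio n j) ⟩
      (1ᴳ -ᴳ v) *ᴳ y +ᴳ v *ᴳ ((1ᴳ -ᴳ v) *ᴳ x)                 ≡⟨ join v x y ⟩
      (1ᴳ -ᴳ v) *ᴳ (y +ᴳ v *ᴳ x)                              ∎
      where
      open ≡-Reasoning
      u = p ^ᴳ j
      v = p ^ᴳ (n ∸ j)
      x = gauss n j
      y = gauss n (suc j)
      split : ∀ p u v y → (1ᴳ -ᴳ p *ᴳ (v *ᴳ u)) *ᴳ y ≡ (1ᴳ -ᴳ v) *ᴳ y +ᴳ v *ᴳ ((1ᴳ -ᴳ p *ᴳ u) *ᴳ y)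
      split = solve-∀ 𝔾-ring
      join : ∀ v x y → (1ᴳ -ᴳ v) *ᴳ y +ᴳ v *ᴳ ((1ᴳ -ᴳ v) *ᴳ x) ≡ (1ᴳ -ᴳ v) *ᴳ (y +ᴳ v *ᴳ x)
      join = solve-∀ 𝔾-ring
    -- Here n ≤ j: the coefficient on the left is 0, and on the right `n ∸ j` = 0 makes 1 - p^0
    -- vanish.
    ... | inj₂ n<1+j
      rewrite ℕ.m≤n⇒m∸n≡0 (ℕ.≤-pred n<1+j) | gauss-> {n} {suc (suc j)} (ℕ.m≤n⇒m≤1+n n<1+j) | gauss-> {n} {suc j} n<1+j
      = lemma (p ^ᴳ suc (suc j)) (p ^ᴳ (n ∸ suc j)) (gauss n j)
      where
      lemma : ∀ x y z → (1ᴳ -ᴳ x) *ᴳ (0ᴳ +ᴳ y *ᴳ 0ᴳ) ≡ (1ᴳ -ᴳ 1ᴳ) *ᴳ (0ᴳ +ᴳ 1ᴳ *ᴳ z)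
      lemma = solve-∀ 𝔾-ring

    -- The second Pascal rule: its right side and that of the defining rule differ by the difference
    -- of the two sides of `gauss-ratio`.
    gauss-suc′ : ∀ n j → gauss (suc n) (suc j) ≡ gauss n j +ᴳ p ^ᴳ suc j *ᴳ gauss n (suc j)
    gauss-suc′ n j = begin
      y +ᴳ v *ᴳ x                                      ≡⟨ split v x y w ⟩
      x +ᴳ w *ᴳ y +ᴳ ((1ᴳ -ᴳ w) *ᴳ y -ᴳ (1ᴳ -ᴳ v) *ᴳ x) ≡⟨ cong (λ t → x +ᴳ w *ᴳ y +ᴳ (t -ᴳ (1ᴳ -ᴳ v) *ᴳ x)) (gauss-ratio n j) ⟩
      x +ᴳ w *ᴳ y +ᴳ ((1ᴳ -ᴳ v) *ᴳ x -ᴳ (1ᴳ -ᴳ v) *ᴳ x) ≡⟨ join (x +ᴳ w *ᴳ y) ((1ᴳ -ᴳ v) *ᴳ x) ⟩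
      x +ᴳ w *ᴳ y ∎
      where
      open ≡-Reasoning
      v = p ^ᴳ (n ∸ j)
      w = p ^ᴳ suc j
      x = gauss n j
      y = gauss n (suc j)
      split : ∀ v x y w → y +ᴳ v *ᴳ x ≡ x +ᴳ w *ᴳ y +ᴳ ((1ᴳ -ᴳ w) *ᴳ y -ᴳ (1ᴳ -ᴳ v) *ᴳ x)
      split = solve-∀ 𝔾-ring
      join : ∀ s t → s +ᴳ (t -ᴳ t) ≡ s
      join = solve-∀ 𝔾-ring

    qfac : ℕ → 𝔾
    qfac n = Πᴳ n (λ j → 1ᴳ -ᴳ p ^ᴳ suc j)

    gauss-qfac : ∀ i j → gauss (i ℕ.+ j) i *ᴳ (qfac i *ᴳ qfac j) ≡ qfac (i ℕ.+ j)
    gauss-qfac zero    j = lemma (qfac j)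
      where
      lemma : ∀ x → 1ᴳ *ᴳ (1ᴳ *ᴳ x) ≡ x
      lemma = solve-∀ 𝔾-ring
    gauss-qfac (suc i) j = begin
      gauss (suc (i ℕ.+ j)) (suc i) *ᴳ (qfac (suc i) *ᴳ qfac j)
        ≡⟨ cong (λ t → gauss (suc (i ℕ.+ j)) (suc i) *ᴳ (t *ᴳ qfac j)) (Πᴳ-last i (λ j → 1ᴳ -ᴳ p ^ᴳ suc j)) ⟩
      gauss (suc (i ℕ.+ j)) (suc i) *ᴳ ((qfac i *ᴳ (1ᴳ -ᴳ p ^ᴳ suc i)) *ᴳ qfac j)
        ≡⟨ rearrange (gauss (suc (i ℕ.+ j)) (suc i)) (qfac i) (1ᴳ -ᴳ p ^ᴳ suc i) (qfac j) ⟩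
      (1ᴳ -ᴳ p ^ᴳ suc i) *ᴳ gauss (suc (i ℕ.+ j)) (suc i) *ᴳ (qfac i *ᴳ qfac j)
        ≡⟨ cong (_*ᴳ (qfac i *ᴳ qfac j)) (gauss-top (ℕ.m≤m+n i j)) ⟩
      (1ᴳ -ᴳ p ^ᴳ suc (i ℕ.+ j)) *ᴳ gauss (i ℕ.+ j) i *ᴳ (qfac i *ᴳ qfac j)
        ≡⟨ 𝔾ᵣ.*-assoc (1ᴳ -ᴳ p ^ᴳ suc (i ℕ.+ j)) (gauss (i ℕ.+ j) i) (qfac i *ᴳ qfac j) ⟩
      (1ᴳ -ᴳ p ^ᴳ suc (i ℕ.+ j)) *ᴳ (gauss (i ℕ.+ j) i *ᴳ (qfac i *ᴳ qfac j))
        ≡⟨ cong ((1ᴳ -ᴳ p ^ᴳ suc (i ℕ.+ j)) *ᴳ_) (gauss-qfac i j) ⟩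
      (1ᴳ -ᴳ p ^ᴳ suc (i ℕ.+ j)) *ᴳ qfac (i ℕ.+ j)
        ≡⟨ 𝔾ᵣ.*-comm (1ᴳ -ᴳ p ^ᴳ suc (i ℕ.+ j)) (qfac (i ℕ.+ j)) ⟩
      qfac (i ℕ.+ j) *ᴳ (1ᴳ -ᴳ p ^ᴳ suc (i ℕ.+ j))
        ≡⟨ Πᴳ-last (i ℕ.+ j) (λ j → 1ᴳ -ᴳ p ^ᴳ suc j) ⟨
      qfac (suc (i ℕ.+ j)) ∎
      where
      open ≡-Reasoning
      rearrange : ∀ g a b c → g *ᴳ ((a *ᴳ b) *ᴳ c) ≡ b *ᴳ g *ᴳ (a *ᴳ c)
      rearrange = solve-∀ 𝔾-ring

    private
      Σ-gauss-shift : ∀ n (h : ℕ → 𝔾) →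
        Σᴳ (suc n) (λ j → gauss n j *ᴳ h j) ≡ h 0 +ᴳ Σᴳ (suc n) (λ j → gauss n (suc j) *ᴳ h (suc j))
      Σ-gauss-shift n h = sym (begin
        h 0 +ᴳ Σᴳ (suc n) (λ j → gauss n (suc j) *ᴳ h (suc j))
          ≡⟨ cong (_+ᴳ Σᴳ (suc n) (λ j → gauss n (suc j) *ᴳ h (suc j))) (sym (𝔾ᵣ.*-identityˡ (h 0))) ⟩
        Σᴳ (suc (suc n)) (λ j → gauss n j *ᴳ h j)
          ≡⟨ Σᴳ-last (suc n) (λ j → gauss n j *ᴳ h j) ⟩
        Σᴳ (suc n) (λ j → gauss n j *ᴳ h j) +ᴳ gauss n (suc n) *ᴳ h (suc n)
          ≡⟨ cong (λ t → Σᴳ (suc n) (λ j → gauss n j *ᴳ h j) +ᴳ t *ᴳ h (suc n)) (gauss-> {n} {suc n} ℕ.≤-refl) ⟩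
        Σᴳ (suc n) (λ j → gauss n j *ᴳ h j) +ᴳ 0ᴳ *ᴳ h (suc n)
          ≡⟨ drop (Σᴳ (suc n) (λ j → gauss n j *ᴳ h j)) (h (suc n)) ⟩
        Σᴳ (suc n) (λ j → gauss n j *ᴳ h j) ∎)
        where
        open ≡-Reasoning
        drop : ∀ x y → x +ᴳ 0ᴳ *ᴳ y ≡ x
        drop = solve-∀ 𝔾-ring

    -- The defining Pascal rule summed against `h`: this is what one more factor 1 - a p^m does to
    -- the finite triple product. `Σ-gauss-down` uses the second rule, for one more factor 1 - b
    -- p^n.
    Σ-gauss-up : ∀ n (h : ℕ → 𝔾) →
      Σᴳ (suc n) (λ j → gauss n j *ᴳ (h j +ᴳ p ^ᴳ (n ∸ j) *ᴳ h (suc j))) ≡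
      Σᴳ (suc (suc n)) (λ j → gauss (suc n) j *ᴳ h j)
    Σ-gauss-up n h = begin
      Σᴳ (suc n) (λ j → gauss n j *ᴳ (h j +ᴳ p ^ᴳ (n ∸ j) *ᴳ h (suc j)))
        ≡⟨ Σᴳ-cong (suc n) (λ j _ → split (gauss n j) (h j) (p ^ᴳ (n ∸ j)) (h (suc j))) ⟩
      Σᴳ (suc n) (λ j → gauss n j *ᴳ h j +ᴳ p ^ᴳ (n ∸ j) *ᴳ gauss n j *ᴳ h (suc j))
        ≡⟨ Σᴳ-+ (suc n) (λ j → gauss n j *ᴳ h j) (λ j → p ^ᴳ (n ∸ j) *ᴳ gauss n j *ᴳ h (suc j)) ⟩
      Σᴳ (suc n) (λ j → gauss n j *ᴳ h j) +ᴳ B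
        ≡⟨ cong (_+ᴳ B) (Σ-gauss-shift n h) ⟩
      h 0 +ᴳ A +ᴳ B
        ≡⟨ join (h 0) A B ⟩
      1ᴳ *ᴳ h 0 +ᴳ (A +ᴳ B)
        ≡⟨ cong (1ᴳ *ᴳ h 0 +ᴳ_) (Σᴳ-+ (suc n) (λ j → gauss n (suc j) *ᴳ h (suc j)) (λ j → p ^ᴳ (n ∸ j) *ᴳ gauss n j *ᴳ h (suc j))) ⟨
      1ᴳ *ᴳ h 0 +ᴳ Σᴳ (suc n) (λ j → gauss n (suc j) *ᴳ h (suc j) +ᴳ p ^ᴳ (n ∸ j) *ᴳ gauss n j *ᴳ h (suc j))
        ≡⟨ cong (1ᴳ *ᴳ h 0 +ᴳ_) (Σᴳ-cong (suc n) (λ j _ → sym (𝔾ᵣ.distribʳ (h (suc j)) (gauss n (suc j)) (p ^ᴳ (n ∸ j) *ᴳ gauss n j)))) ⟩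
      Σᴳ (suc (suc n)) (λ j → gauss (suc n) j *ᴳ h j) ∎
      where
      open ≡-Reasoning
      A = Σᴳ (suc n) (λ j → gauss n (suc j) *ᴳ h (suc j))
      B = Σᴳ (suc n) (λ j → p ^ᴳ (n ∸ j) *ᴳ gauss n j *ᴳ h (suc j))
      split : ∀ g h u h′ → g *ᴳ (h +ᴳ u *ᴳ h′) ≡ g *ᴳ h +ᴳ u *ᴳ g *ᴳ h′
      split = solve-∀ 𝔾-ring
      join : ∀ h A B → h +ᴳ A +ᴳ B ≡ 1ᴳ *ᴳ h +ᴳ (A +ᴳ B)
      join = solve-∀ 𝔾-ring

    Σ-gauss-down : ∀ n (h : ℕ → 𝔾) →
      Σᴳ (suc n) (λ j → gauss n j *ᴳ (h (suc j) +ᴳ p ^ᴳ j *ᴳ h j)) ≡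
      Σᴳ (suc (suc n)) (λ j → gauss (suc n) j *ᴳ h j)
    Σ-gauss-down n h = begin
      Σᴳ (suc n) (λ j → gauss n j *ᴳ (h (suc j) +ᴳ p ^ᴳ j *ᴳ h j))
        ≡⟨ Σᴳ-cong (suc n) (λ j _ → split (gauss n j) (h j) (p ^ᴳ j) (h (suc j))) ⟩
      Σᴳ (suc n) (λ j → gauss n j *ᴳ h (suc j) +ᴳ gauss n j *ᴳ (p ^ᴳ j *ᴳ h j))
        ≡⟨ Σᴳ-+ (suc n) (λ j → gauss n j *ᴳ h (suc j)) (λ j → gauss n j *ᴳ (p ^ᴳ j *ᴳ h j)) ⟩
      A +ᴳ Σᴳ (suc n) (λ j → gauss n j *ᴳ (p ^ᴳ j *ᴳ h j))
        ≡⟨ cong (A +ᴳ_) (Σ-gauss-shift n (λ j → p ^ᴳ j *ᴳ h j)) ⟩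
      A +ᴳ (1ᴳ *ᴳ h 0 +ᴳ B)
        ≡⟨ join (1ᴳ *ᴳ h 0) A B ⟩
      1ᴳ *ᴳ h 0 +ᴳ (A +ᴳ B)
        ≡⟨ cong (1ᴳ *ᴳ h 0 +ᴳ_) (Σᴳ-+ (suc n) (λ j → gauss n j *ᴳ h (suc j)) (λ j → gauss n (suc j) *ᴳ (p ^ᴳ suc j *ᴳ h (suc j)))) ⟨
      1ᴳ *ᴳ h 0 +ᴳ Σᴳ (suc n) (λ j → gauss n j *ᴳ h (suc j) +ᴳ gauss n (suc j) *ᴳ (p ^ᴳ suc j *ᴳ h (suc j)))
        ≡⟨ cong (1ᴳ *ᴳ h 0 +ᴳ_) (Σᴳ-cong (suc n) (λ j _ → trans
             (collect (gauss n j) (h (suc j)) (gauss n (suc j)) (p ^ᴳ suc j)) (cong (_*ᴳ h (suc j)) (sym (gauss-suc′ n j))))) ⟩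
      Σᴳ (suc (suc n)) (λ j → gauss (suc n) j *ᴳ h j) ∎
      where
      open ≡-Reasoning
      A = Σᴳ (suc n) (λ j → gauss n j *ᴳ h (suc j))
      B = Σᴳ (suc n) (λ j → gauss n (suc j) *ᴳ (p ^ᴳ suc j *ᴳ h (suc j)))
      split : ∀ g h u h′ → g *ᴳ (h′ +ᴳ u *ᴳ h) ≡ g *ᴳ h′ +ᴳ g *ᴳ (u *ᴳ h)
      split = solve-∀ 𝔾-ring
      join : ∀ h A B → A +ᴳ (h +ᴳ B) ≡ h +ᴳ (A +ᴳ B)
      join = solve-∀ 𝔾-ring
      collect : ∀ g h g′ u → g *ᴳ h +ᴳ g′ *ᴳ (u *ᴳ h) ≡ (g +ᴳ u *ᴳ g′) *ᴳ h
      collect = solve-∀ 𝔾-ring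

  -- The finite form of Jacobi's triple product. T⁺ k and T⁻ k are the terms of
  -- the theta series of index k and -k, and bilateral j n is the term of index
  -- j - n.
  bilateral : (T⁺ T⁻ : ℕ → 𝔾) → ℕ → ℕ → 𝔾
  bilateral T⁺ T⁻ j       zero    = T⁺ j
  bilateral T⁺ T⁻ zero    (suc n) = T⁻ (suc n)
  bilateral T⁺ T⁻ (suc j) (suc n) = bilateral T⁺ T⁻ j n

  Σ-bilateral : ∀ T⁺ T⁻ n m →
    Σᴳ (n ℕ.+ m) (λ j → bilateral T⁺ T⁻ j n) ≡ Σᴳ m T⁺ +ᴳ Σᴳ n (T⁻ ∘ suc)
  Σ-bilateral T⁺ T⁻ zero    m = sym (𝔾ᵣ.+-identityʳ (Σᴳ m T⁺))
  Σ-bilateral T⁺ T⁻ (suc n) m = begin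
    T⁻ (suc n) +ᴳ Σᴳ (n ℕ.+ m) (λ j → bilateral T⁺ T⁻ j n)  ≡⟨ cong (T⁻ (suc n) +ᴳ_) (Σ-bilateral T⁺ T⁻ n m) ⟩
    T⁻ (suc n) +ᴳ (Σᴳ m T⁺ +ᴳ Σᴳ n (T⁻ ∘ suc))              ≡⟨ lemma (T⁻ (suc n)) (Σᴳ m T⁺) (Σᴳ n (T⁻ ∘ suc)) ⟩
    Σᴳ m T⁺ +ᴳ (Σᴳ n (T⁻ ∘ suc) +ᴳ T⁻ (suc n))              ≡⟨ cong (Σᴳ m T⁺ +ᴳ_) (Σᴳ-last n (T⁻ ∘ suc)) ⟨
    Σᴳ m T⁺ +ᴳ Σᴳ (suc n) (T⁻ ∘ suc)                        ∎
    where
    open ≡-Reasoning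
    lemma : ∀ x y z → x +ᴳ (y +ᴳ z) ≡ y +ᴳ (z +ᴳ x)
    lemma = solve-∀ 𝔾-ring

  module _ (a b p : 𝔾) (ab≡p : a *ᴳ b ≡ p) (T⁺ T⁻ : ℕ → 𝔾) (T⁺0 : T⁺ 0 ≡ 1ᴳ) (T⁻0 : T⁻ 0 ≡ 1ᴳ)
    (T⁺-suc : ∀ k → T⁺ (suc k) ≡ ⊝ (a *ᴳ p ^ᴳ k *ᴳ T⁺ k))
    (T⁻-suc : ∀ k → T⁻ (suc k) ≡ ⊝ (b *ᴳ p ^ᴳ k *ᴳ T⁻ k)) where

    private
      T : ℕ → ℕ → 𝔾
      T = bilateral T⁺ T⁻

      T-0 : ∀ n → T 0 n ≡ T⁻ n
      T-0 zero    = trans T⁺0 (sym T⁻0)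
      T-0 (suc n) = refl

      -- With k = j - n, this is the ratio -a p^k of the terms of index k + 1 and k, with p^(m-k)
      -- moved across to keep exponents nonnegative. For k < 0 the recursion of `T⁻` is inverted by
      -- means of ab = p.
      up : ∀ m j n → j ℕ.≤ n ℕ.+ m → ⊝ (a *ᴳ p ^ᴳ m *ᴳ T j n) ≡ p ^ᴳ (n ℕ.+ m ∸ j) *ᴳ T (suc j) n
      up m j zero j≤m = begin
        ⊝ (a *ᴳ p ^ᴳ m *ᴳ T⁺ j)                     ≡⟨ cong (λ t → ⊝ (a *ᴳ t *ᴳ T⁺ j)) (trans (sym (cong (p ^ᴳ_) (ℕ.m∸n+n≡m j≤m))) (^-homo-* p (m ∸ j) j)) ⟩
        ⊝ (a *ᴳ (p ^ᴳ (m ∸ j) *ᴳ p ^ᴳ j) *ᴳ T⁺ j)   ≡⟨ lemma a (p ^ᴳ (m ∸ j)) (p ^ᴳ j) (T⁺ j) ⟩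
        p ^ᴳ (m ∸ j) *ᴳ ⊝ (a *ᴳ p ^ᴳ j *ᴳ T⁺ j)     ≡⟨ cong (p ^ᴳ (m ∸ j) *ᴳ_) (T⁺-suc j) ⟨
        p ^ᴳ (m ∸ j) *ᴳ T⁺ (suc j)                  ∎
        where
        open ≡-Reasoning
        lemma : ∀ a u v t → ⊝ (a *ᴳ (u *ᴳ v) *ᴳ t) ≡ u *ᴳ ⊝ (a *ᴳ v *ᴳ t)
        lemma = solve-∀ 𝔾-ring
      up m zero (suc n) _ = begin
        ⊝ (a *ᴳ p ^ᴳ m *ᴳ T⁻ (suc n))                        ≡⟨ cong (λ t → ⊝ (a *ᴳ p ^ᴳ m *ᴳ t)) (T⁻-suc n) ⟩
        ⊝ (a *ᴳ p ^ᴳ m *ᴳ ⊝ (b *ᴳ p ^ᴳ n *ᴳ T⁻ n))           ≡⟨ lemma a (p ^ᴳ m) b (p ^ᴳ n) (T⁻ n) ⟩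
        a *ᴳ b *ᴳ (p ^ᴳ n *ᴳ p ^ᴳ m) *ᴳ T⁻ n                 ≡⟨ cong₂ (λ s t → s *ᴳ t *ᴳ T⁻ n) ab≡p (sym (^-homo-* p n m)) ⟩
        p ^ᴳ suc (n ℕ.+ m) *ᴳ T⁻ n                           ≡⟨ cong (p ^ᴳ suc (n ℕ.+ m) *ᴳ_) (T-0 n) ⟨
        p ^ᴳ suc (n ℕ.+ m) *ᴳ T 0 n                          ∎
        where
        open ≡-Reasoning
        lemma : ∀ a u b v t → ⊝ (a *ᴳ u *ᴳ ⊝ (b *ᴳ v *ᴳ t)) ≡ a *ᴳ b *ᴳ (v *ᴳ u) *ᴳ t
        lemma = solve-∀ 𝔾-ring
      up m (suc j) (suc n) (ℕ.s≤s j≤n+m) = up m j n j≤n+m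

      down : ∀ j n → ⊝ (b *ᴳ p ^ᴳ n *ᴳ T j n) ≡ p ^ᴳ j *ᴳ T j (suc n)
      down zero    n = trans (cong (λ t → ⊝ (b *ᴳ p ^ᴳ n *ᴳ t)) (T-0 n))
        (trans (sym (T⁻-suc n)) (sym (𝔾ᵣ.*-identityˡ (T⁻ (suc n)))))
      down (suc j) zero = begin
        ⊝ (b *ᴳ 1ᴳ *ᴳ T⁺ (suc j))                    ≡⟨ cong (λ t → ⊝ (b *ᴳ 1ᴳ *ᴳ t)) (T⁺-suc j) ⟩
        ⊝ (b *ᴳ 1ᴳ *ᴳ ⊝ (a *ᴳ p ^ᴳ j *ᴳ T⁺ j))       ≡⟨ lemma a b (p ^ᴳ j) (T⁺ j) ⟩
        a *ᴳ b *ᴳ p ^ᴳ j *ᴳ T⁺ j                     ≡⟨ cong (λ t → t *ᴳ p ^ᴳ j *ᴳ T⁺ j) ab≡p ⟩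
        p *ᴳ p ^ᴳ j *ᴳ T⁺ j                          ∎
        where
        open ≡-Reasoning
        lemma : ∀ a b u t → ⊝ (b *ᴳ 1ᴳ *ᴳ ⊝ (a *ᴳ u *ᴳ t)) ≡ a *ᴳ b *ᴳ u *ᴳ t
        lemma = solve-∀ 𝔾-ring
      down (suc j) (suc n) = begin
        ⊝ (b *ᴳ (p *ᴳ p ^ᴳ n) *ᴳ T j n)   ≡⟨ pull b p (p ^ᴳ n) (T j n) ⟩
        p *ᴳ ⊝ (b *ᴳ p ^ᴳ n *ᴳ T j n)     ≡⟨ cong (p *ᴳ_) (down j n) ⟩
        p *ᴳ (p ^ᴳ j *ᴳ T j (suc n))      ≡⟨ 𝔾ᵣ.*-assoc p (p ^ᴳ j) (T j (suc n)) ⟨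
        p *ᴳ p ^ᴳ j *ᴳ T j (suc n)        ∎
        where
        open ≡-Reasoning
        pull : ∀ b p u t → ⊝ (b *ᴳ (p *ᴳ u) *ᴳ t) ≡ p *ᴳ ⊝ (b *ᴳ u *ᴳ t)
        pull = solve-∀ 𝔾-ring

      expand : ∀ x u g t → (1ᴳ -ᴳ x *ᴳ u) *ᴳ (g *ᴳ t) ≡ g *ᴳ (t +ᴳ ⊝ (x *ᴳ u *ᴳ t))
      expand = solve-∀ 𝔾-ring

      S : ℕ → ℕ → 𝔾
      S n m = Σᴳ (suc (n ℕ.+ m)) (λ j → gauss p (n ℕ.+ m) j *ᴳ T j n)

      S-up : ∀ n m → (1ᴳ -ᴳ a *ᴳ p ^ᴳ m) *ᴳ S n m ≡ S n (suc m)
      S-up n m = begin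
        (1ᴳ -ᴳ a *ᴳ p ^ᴳ m) *ᴳ S n m
          ≡⟨ *-Σᴳ (suc N) (1ᴳ -ᴳ a *ᴳ p ^ᴳ m) (λ j → gauss p N j *ᴳ T j n) ⟩
        Σᴳ (suc N) (λ j → (1ᴳ -ᴳ a *ᴳ p ^ᴳ m) *ᴳ (gauss p N j *ᴳ T j n))
          ≡⟨ Σᴳ-cong (suc N) (λ j j≤N → trans (expand a (p ^ᴳ m) (gauss p N j) (T j n))
               (cong (λ t → gauss p N j *ᴳ (T j n +ᴳ t)) (up m j n (ℕ.≤-pred j≤N)))) ⟩
        Σᴳ (suc N) (λ j → gauss p N j *ᴳ (T j n +ᴳ p ^ᴳ (N ∸ j) *ᴳ T (suc j) n))
          ≡⟨ Σ-gauss-up p N (λ j → T j n) ⟩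
        Σᴳ (suc (suc N)) (λ j → gauss p (suc N) j *ᴳ T j n)
          ≡⟨ cong (λ k → Σᴳ (suc k) (λ j → gauss p k j *ᴳ T j n)) (ℕ.+-suc n m) ⟨
        S n (suc m) ∎
        where
        open ≡-Reasoning
        N = n ℕ.+ m

      S-down : ∀ n → (1ᴳ -ᴳ b *ᴳ p ^ᴳ n) *ᴳ S n 0 ≡ S (suc n) 0
      S-down n = begin
        (1ᴳ -ᴳ b *ᴳ p ^ᴳ n) *ᴳ S n 0
          ≡⟨ *-Σᴳ (suc N) (1ᴳ -ᴳ b *ᴳ p ^ᴳ n) (λ j → gauss p N j *ᴳ T j n) ⟩
        Σᴳ (suc N) (λ j → (1ᴳ -ᴳ b *ᴳ p ^ᴳ n) *ᴳ (gauss p N j *ᴳ T j n))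
          ≡⟨ Σᴳ-cong (suc N) (λ j _ → trans (expand b (p ^ᴳ n) (gauss p N j) (T j n))
               (cong (λ t → gauss p N j *ᴳ (T j n +ᴳ t)) (down j n))) ⟩
        Σᴳ (suc N) (λ j → gauss p N j *ᴳ (T j n +ᴳ p ^ᴳ j *ᴳ T j (suc n)))
          ≡⟨ Σ-gauss-down p N (λ j → T j (suc n)) ⟩
        S (suc n) 0 ∎
        where
        open ≡-Reasoning
        N = n ℕ.+ 0

    finite-triple-product : ∀ n m →
      Πᴳ m (λ j → 1ᴳ -ᴳ a *ᴳ p ^ᴳ j) *ᴳ Πᴳ n (λ j → 1ᴳ -ᴳ b *ᴳ p ^ᴳ j) ≡
      Σᴳ (suc (n ℕ.+ m)) (λ j → gauss p (n ℕ.+ m) j *ᴳ bilateral T⁺ T⁻ j n)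
    finite-triple-product zero    zero    = cong (λ t → 1ᴳ *ᴳ t +ᴳ 0ᴳ) (sym T⁺0)
    finite-triple-product (suc n) zero    = begin
      1ᴳ *ᴳ Πᴳ (suc n) (λ j → 1ᴳ -ᴳ b *ᴳ p ^ᴳ j)                          ≡⟨ cong (1ᴳ *ᴳ_) (Πᴳ-last n (λ j → 1ᴳ -ᴳ b *ᴳ p ^ᴳ j)) ⟩
      1ᴳ *ᴳ (Πᴳ n (λ j → 1ᴳ -ᴳ b *ᴳ p ^ᴳ j) *ᴳ (1ᴳ -ᴳ b *ᴳ p ^ᴳ n))       ≡⟨ swap (Πᴳ n (λ j → 1ᴳ -ᴳ b *ᴳ p ^ᴳ j)) (1ᴳ -ᴳ b *ᴳ p ^ᴳ n) ⟩
      (1ᴳ -ᴳ b *ᴳ p ^ᴳ n) *ᴳ (1ᴳ *ᴳ Πᴳ n (λ j → 1ᴳ -ᴳ b *ᴳ p ^ᴳ j))       ≡⟨ cong ((1ᴳ -ᴳ b *ᴳ p ^ᴳ n) *ᴳ_) (finite-triple-product n zero) ⟩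
      (1ᴳ -ᴳ b *ᴳ p ^ᴳ n) *ᴳ S n 0                                        ≡⟨ S-down n ⟩
      S (suc n) 0 ∎
      where
      open ≡-Reasoning
      swap : ∀ x y → 1ᴳ *ᴳ (x *ᴳ y) ≡ y *ᴳ (1ᴳ *ᴳ x)
      swap = solve-∀ 𝔾-ring
    finite-triple-product n (suc m) = begin
      Πᴳ (suc m) (λ j → 1ᴳ -ᴳ a *ᴳ p ^ᴳ j) *ᴳ B                ≡⟨ cong (_*ᴳ B) (Πᴳ-last m (λ j → 1ᴳ -ᴳ a *ᴳ p ^ᴳ j)) ⟩
      A *ᴳ (1ᴳ -ᴳ a *ᴳ p ^ᴳ m) *ᴳ B                            ≡⟨ swap A (1ᴳ -ᴳ a *ᴳ p ^ᴳ m) B ⟩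
      (1ᴳ -ᴳ a *ᴳ p ^ᴳ m) *ᴳ (A *ᴳ B)                          ≡⟨ cong ((1ᴳ -ᴳ a *ᴳ p ^ᴳ m) *ᴳ_) (finite-triple-product n m) ⟩
      (1ᴳ -ᴳ a *ᴳ p ^ᴳ m) *ᴳ S n m                             ≡⟨ S-up n m ⟩
      S n (suc m)                                              ∎
      where
      open ≡-Reasoning
      A = Πᴳ m (λ j → 1ᴳ -ᴳ a *ᴳ p ^ᴳ j)
      B = Πᴳ n (λ j → 1ᴳ -ᴳ b *ᴳ p ^ᴳ j)
      swap : ∀ x y z → x *ᴳ y *ᴳ z ≡ y *ᴳ (x *ᴳ z)
      swap = solve-∀ 𝔾-ring

  -- Uniform estimates for products and for the triple product

  Σᴳ-≼ : ∀ n {f c} → 0ℚ ≤ c → (∀ j → j ℕ.< n → f j ≼ c) → Σᴳ n f ≼ fromℕ n * c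
  Σᴳ-≼ zero    {f} {c} 0≤c f≼c = subst (0ᴳ ≼_) (sym (ℚ.*-zeroˡ c)) (0≼ ℚ.≤-refl)
  Σᴳ-≼ (suc n) {f} {c} 0≤c f≼c = subst (Σᴳ (suc n) f ≼_) (lemma c (fromℕ n))
    (+-≼ (f≼c 0 (ℕ.s≤s ℕ.z≤n)) (Σᴳ-≼ n {λ j → f (suc j)} 0≤c λ j j<n → f≼c (suc j) (ℕ.s≤s j<n)))
    where
    lemma : ∀ c x → c + x * c ≡ (1ℚ + x) * c
    lemma = solve-∀ ℚ-ring

  1≤fromℕ : ∀ n → 1ℚ ≤ fromℕ (suc n)
  1≤fromℕ n = fromℕ-mono-≤ {1} {suc n} (ℕ.s≤s ℕ.z≤n)

  module Estimates (ρ : ℚ) (0≤ρ : 0ℚ ≤ ρ) (ρ<1 : ρ < 1ℚ) where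
    open Geometric ρ 0≤ρ ρ<1 public

    -- The induction on k carries the sharper bound with ρ^n - ρ^(k+n), a partial geometric sum; the
    -- subtracted term is dropped only at the end.
    telescope : ∀ (z : ℕ → 𝔾) B → 0ℚ ≤ B → (∀ j → z (suc j) -ᴳ z j ≼ B * ρ ^ℚ j) →
      ∀ n k → z (k ℕ.+ n) -ᴳ z n ≼ B * κ * ρ ^ℚ n
    telescope z B 0≤B step n k = ≼-mono
      (ℚ.*-monoˡ-≤-nonNeg (B * κ) {{ℚ.nonNegative (0≤p*q 0≤B 0≤κ)}}
        (subst (ρ ^ℚ n - ρ ^ℚ (k ℕ.+ n) ≤_) (ℚ.+-identityʳ (ρ ^ℚ n))
          (ℚ.+-monoʳ-≤ (ρ ^ℚ n) (ℚ.neg-antimono-≤ (0≤ρ^ (k ℕ.+ n))))))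
      (go k)
      where
      same : ∀ x → x -ᴳ x ≡ 0ᴳ
      same = solve-∀ 𝔾-ring
      chain : ∀ x y z → (x -ᴳ y) +ᴳ (y -ᴳ z) ≡ x -ᴳ z
      chain = solve-∀ 𝔾-ring
      none : ∀ b t → b * (t - t) ≡ 0ℚ
      none = solve-∀ ℚ-ring
      add : ∀ b k r s t → b * (k * (1ℚ - r)) * t + b * k * (s - t) ≡ b * k * (s - r * t)
      add = solve-∀ ℚ-ring
      one : ∀ b t → b * 1ℚ * t ≡ b * t
      one = solve-∀ ℚ-ring
      go : ∀ k → z (k ℕ.+ n) -ᴳ z n ≼ B * κ * (ρ ^ℚ n - ρ ^ℚ (k ℕ.+ n))
      go zero    = subst₂ _≼_ (sym (same (z n))) (sym (none (B * κ) (ρ ^ℚ n))) (0≼ ℚ.≤-refl)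
      go (suc k) = subst₂ _≼_ (chain (z (suc k ℕ.+ n)) (z (k ℕ.+ n)) (z n))
        (begin
          B * r + B * κ * (s - r)                    ≡⟨ cong (_+ B * κ * (s - r)) (one B r) ⟨
          B * 1ℚ * r + B * κ * (s - r)               ≡⟨ cong (λ t → B * t * r + B * κ * (s - r)) κ[1-ρ]≡1 ⟨
          B * (κ * (1ℚ - ρ)) * r + B * κ * (s - r)   ≡⟨ add B κ ρ s r ⟩
          B * κ * (s - ρ * r)                        ∎)
        (+-≼ (step (k ℕ.+ n)) (go k))
        where
        open ≡-Reasoning
        r = ρ ^ℚ (k ℕ.+ n)
        s = ρ ^ℚ n

    -- One constant serves both directions: since (1 + x)(1 - x) ≤ 1, the reciprocal `B` of a lower
    -- bound `c` of ∏(1 - ρ^j) is an upper bound of ∏(1 + ρ^j).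
    c B : ℚ
    c = proj₁ ∏[1-ρ^]-bounded-below

    0<c : 0ℚ < c
    0<c = proj₁ (proj₂ ∏[1-ρ^]-bounded-below)

    B = proj₁ (reciprocal 0<c)

    0≤B : 0ℚ ≤ B
    0≤B = ℚ.<⇒≤ (proj₁ (proj₂ (reciprocal 0<c)))

    B*c≡1 : B * c ≡ 1ℚ
    B*c≡1 = proj₂ (proj₂ (reciprocal 0<c))

    private
      ∏[1+ρ^] : ℕ → ℚ
      ∏[1+ρ^] zero    = 1ℚ
      ∏[1+ρ^] (suc n) = ∏[1+ρ^] n * (1ℚ + ρ ^ℚ suc n)

      0≤∏[1+ρ^] : ∀ n → 0ℚ ≤ ∏[1+ρ^] n
      0≤∏[1+ρ^] zero    = 0≤1
      0≤∏[1+ρ^] (suc n) = 0≤p*q (0≤∏[1+ρ^] n) (0≤p+q 0≤1 (0≤ρ^ (suc n)))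

      ∏[1+ρ^]*∏[1-ρ^]≤1 : ∀ n → ∏[1+ρ^] n * ∏[1-ρ^] n ≤ 1ℚ
      ∏[1+ρ^]*∏[1-ρ^]≤1 zero    = ℚ.≤-refl
      ∏[1+ρ^]*∏[1-ρ^]≤1 (suc n) = begin
        x * (1ℚ + r) * (y * (1ℚ - r))  ≡⟨ lemma x y r ⟩
        x * y * (1ℚ - r * r)           ≤⟨ *-mono-≤ {s = 1ℚ} (0≤p*q (0≤∏[1+ρ^] n) (ℚ.<⇒≤ (0<∏[1-ρ^] n)))
                                            (∏[1+ρ^]*∏[1-ρ^]≤1 n)
                                            (p≤q⇒0≤q-p (*-mono-≤ {s = 1ℚ} (0≤ρ^ (suc n)) (ρ^≤1 (suc n)) (0≤ρ^ (suc n)) (ρ^≤1 (suc n))))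
                                            (ℚ.+-monoʳ-≤ 1ℚ (ℚ.neg-antimono-≤ (0≤p*p r))) ⟩
        1ℚ                             ∎
        where
        open ℚ.≤-Reasoning
        x = ∏[1+ρ^] n
        y = ∏[1-ρ^] n
        r = ρ ^ℚ suc n
        lemma : ∀ x y r → x * (1ℚ + r) * (y * (1ℚ - r)) ≡ x * y * (1ℚ - r * r)
        lemma = solve-∀ ℚ-ring

      ∏[1+ρ^]≤B : ∀ n → ∏[1+ρ^] n ≤ B
      ∏[1+ρ^]≤B n = *-cancelʳ-≤ 0<c (begin
        ∏[1+ρ^] n * c          ≤⟨ ℚ.*-monoˡ-≤-nonNeg (∏[1+ρ^] n) {{ℚ.nonNegative (0≤∏[1+ρ^] n)}}
                                    (proj₂ (proj₂ ∏[1-ρ^]-bounded-below) n) ⟩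
        ∏[1+ρ^] n * ∏[1-ρ^] n  ≤⟨ ∏[1+ρ^]*∏[1-ρ^]≤1 n ⟩
        1ℚ                     ≡⟨ B*c≡1 ⟨
        B * c                  ∎)
        where open ℚ.≤-Reasoning

    module _ {w : ℕ → 𝔾} (w≼ : ∀ j → w j ≼ ρ ^ℚ suc j) where
      private
        P : ℕ → 𝔾
        P n = Πᴳ n (λ j → 1ᴳ -ᴳ w j)

      Π[1-w]≼B : ∀ n → P n ≼ B
      Π[1-w]≼B n = ≼-mono (∏[1+ρ^]≤B n) (go n)
        where
        go : ∀ n → P n ≼ ∏[1+ρ^] n
        go zero    = 1≼1
        go (suc n) = subst (_≼ ∏[1+ρ^] (suc n)) (sym (Πᴳ-last n (λ j → 1ᴳ -ᴳ w j)))
          (*-≼ (go n) (-ᴳ-≼ 1≼1 (w≼ n)))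

      Π[1-w]≽c : ∀ n → P n ≽ c
      Π[1-w]≽c n = ≽-mono (ℚ.<⇒≤ 0<c) (proj₂ (proj₂ ∏[1-ρ^]-bounded-below) n) (go n)
        where
        go : ∀ n → P n ≽ ∏[1-ρ^] n
        go zero    = 1≽1
        go (suc n) = subst (_≽ ∏[1-ρ^] (suc n)) (sym (Πᴳ-last n (λ j → 1ᴳ -ᴳ w j)))
          (*-≽ (go n) (1-≽ (w≼ n) (ρ^≤1 (suc n))))

      Π[1-w]-cauchy : ∀ n k → P (k ℕ.+ n) -ᴳ P n ≼ B * κ * ρ ^ℚ n
      Π[1-w]-cauchy = telescope P B 0≤B λ j → ≼-mono
        (ℚ.*-monoˡ-≤-nonNeg B {{ℚ.nonNegative 0≤B}} (ρ^-anti (ℕ.n≤1+n j)))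
        (subst (_≼ B * ρ ^ℚ suc j)
          (sym (trans (cong (_-ᴳ P j) (Πᴳ-last j (λ j → 1ᴳ -ᴳ w j))) (lemma (P j) (w j))))
          (⊝-≼ (*-≼ (Π[1-w]≼B j) (w≼ j))))
        where
        lemma : ∀ x w → x *ᴳ (1ᴳ -ᴳ w) -ᴳ x ≡ ⊝ (x *ᴳ w)
        lemma = solve-∀ 𝔾-ring

      Π[1-w]-close : ∀ {μ m n} → μ ℕ.≤ m → μ ℕ.≤ n → P m -ᴳ P n ≼ (B * κ + B * κ) * ρ ^ℚ μ
      Π[1-w]-close {μ} {m} {n} μ≤m μ≤n = subst₂ _≼_ (chain (P m) (P μ) (P n)) (sym (ℚ.*-distribʳ-+ (ρ ^ℚ μ) (B * κ) (B * κ)))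
        (-ᴳ-≼ (from {m} μ≤m) (from {n} μ≤n))
        where
        from : ∀ {m} → μ ℕ.≤ m → P m -ᴳ P μ ≼ B * κ * ρ ^ℚ μ
        from {m} μ≤m = subst (λ m → P m -ᴳ P μ ≼ B * κ * ρ ^ℚ μ) (ℕ.m∸n+n≡m μ≤m) (Π[1-w]-cauchy μ (m ∸ μ))
        chain : ∀ x y z → (x -ᴳ y) -ᴳ (z -ᴳ y) ≡ x -ᴳ z
        chain = solve-∀ 𝔾-ring

    private
      -- `D` is the constant of `Π[1-w]-close`. In `K`, the sum 2BD bounds a difference of two
      -- products of two q-factorials, and B² = 1 / c² pays for dividing by two more.
      D K : ℚ
      D = B * κ + B * κ
      K = (B * D + B * D) * (B * B)
      0≤D : 0ℚ ≤ D
      0≤D = 0≤p+q (0≤p*q 0≤B 0≤κ) (0≤p*q 0≤B 0≤κ)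
      0≤K : 0ℚ ≤ K
      0≤K = 0≤p*q (0≤p+q (0≤p*q 0≤B 0≤D) (0≤p*q 0≤B 0≤D)) (0≤p*q 0≤B 0≤B)

    module _ {p : 𝔾} (p≼ : p ≼ ρ) where
      private
        p^≼ : ∀ j → p ^ᴳ suc j ≼ ρ ^ℚ suc j
        p^≼ j = ^-≼ p≼ (suc j)

      -- The first product is (p;p)_n (p;p)_2n / ((p;p)_i (p;p)_j), and all four indices are at
      -- least μ, so numerator and denominator nearly agree: (p;p)_2n is compared with (p;p)_j and
      -- (p;p)_n with (p;p)_i.
      qfac-gauss-close : ∀ {μ n} i j → i ℕ.+ j ≡ n ℕ.+ n → μ ℕ.≤ i → μ ℕ.≤ j → μ ℕ.≤ n →
        qfac p n *ᴳ gauss p (n ℕ.+ n) i -ᴳ 1ᴳ ≼ K * ρ ^ℚ μ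
      qfac-gauss-close {μ} {n} i j eq μ≤i μ≤j μ≤n =
        ≼-cancel (0<p*q 0<c 0<c) (0≤p*q 0≤K (0≤ρ^ μ)) (*-≽ (Π[1-w]≽c p^≼ i) (Π[1-w]≽c p^≼ j))
          (subst₂ _≼_ (sym lhs) (sym rhs)
            (+-≼ (*-≼ (Π[1-w]≼B p^≼ n) (Π[1-w]-close p^≼ {μ} {n ℕ.+ n} {j} (ℕ.≤-trans μ≤n (ℕ.m≤m+n n n)) μ≤j))
                 (*-≼ (Π[1-w]≼B p^≼ j) (Π[1-w]-close p^≼ {μ} {n} {i} μ≤n μ≤i))))
        where
        open ≡-Reasoning
        x = qfac p n
        g = gauss p (n ℕ.+ n) i
        u = qfac p i
        v = qfac p j
        split : ∀ x g u v → (x *ᴳ g -ᴳ 1ᴳ) *ᴳ (u *ᴳ v) ≡ x *ᴳ (g *ᴳ (u *ᴳ v)) -ᴳ u *ᴳ v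
        split = solve-∀ 𝔾-ring
        join : ∀ x y u v → x *ᴳ y -ᴳ u *ᴳ v ≡ x *ᴳ (y -ᴳ v) +ᴳ v *ᴳ (x -ᴳ u)
        join = solve-∀ 𝔾-ring
        lhs : (x *ᴳ g -ᴳ 1ᴳ) *ᴳ (u *ᴳ v) ≡ x *ᴳ (qfac p (n ℕ.+ n) -ᴳ v) +ᴳ v *ᴳ (x -ᴳ u)
        lhs = begin
          (x *ᴳ g -ᴳ 1ᴳ) *ᴳ (u *ᴳ v)            ≡⟨ split x g u v ⟩
          x *ᴳ (g *ᴳ (u *ᴳ v)) -ᴳ u *ᴳ v        ≡⟨ cong (λ N → x *ᴳ (gauss p N i *ᴳ (u *ᴳ v)) -ᴳ u *ᴳ v) eq ⟨
          x *ᴳ (gauss p (i ℕ.+ j) i *ᴳ (u *ᴳ v)) -ᴳ u *ᴳ v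
                                                ≡⟨ cong (λ t → x *ᴳ t -ᴳ u *ᴳ v) (gauss-qfac p i j) ⟩
          x *ᴳ qfac p (i ℕ.+ j) -ᴳ u *ᴳ v       ≡⟨ cong (λ N → x *ᴳ qfac p N -ᴳ u *ᴳ v) eq ⟩
          x *ᴳ qfac p (n ℕ.+ n) -ᴳ u *ᴳ v       ≡⟨ join x (qfac p (n ℕ.+ n)) u v ⟩
          x *ᴳ (qfac p (n ℕ.+ n) -ᴳ v) +ᴳ v *ᴳ (x -ᴳ u) ∎
        collect : ∀ b d c r → (b * d + b * d) * (b * b) * r * (c * c) ≡ (b * c) * (b * c) * (b * (d * r) + b * (d * r))
        collect = solve-∀ ℚ-ring
        rhs : K * ρ ^ℚ μ * (c * c) ≡ B * (D * ρ ^ℚ μ) + B * (D * ρ ^ℚ μ)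
        rhs = begin
          K * ρ ^ℚ μ * (c * c)                                           ≡⟨ collect B D c (ρ ^ℚ μ) ⟩
          B * c * (B * c) * (B * (D * ρ ^ℚ μ) + B * (D * ρ ^ℚ μ))        ≡⟨ cong (λ t → t * t * (B * (D * ρ ^ℚ μ) + B * (D * ρ ^ℚ μ))) B*c≡1 ⟩
          1ℚ * (B * (D * ρ ^ℚ μ) + B * (D * ρ ^ℚ μ))                     ≡⟨ ℚ.*-identityˡ (B * (D * ρ ^ℚ μ) + B * (D * ρ ^ℚ μ)) ⟩
          B * (D * ρ ^ℚ μ) + B * (D * ρ ^ℚ μ)                            ∎

    -- The common error scale. The square counts pairs of indices in the double series; the triple
    -- product needs only one factor n + 1.
    ε : ℕ → ℚ
    ε n = fromℕ (suc n) * fromℕ (suc n) * ρ ^ℚ n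

    null-ε : Null ε
    null-ε = null-[1+n]²ρ^n ρ 0≤ρ ρ<1

    ρ^≤ε : ∀ n → fromℕ (suc n) * ρ ^ℚ n ≤ ε n
    ρ^≤ε n = ℚ.*-monoʳ-≤-nonNeg (ρ ^ℚ n) {{ℚ.nonNegative (0≤ρ^ n)}}
      (subst (_≤ fromℕ (suc n) * fromℕ (suc n)) (ℚ.*-identityˡ (fromℕ (suc n)))
        (ℚ.*-monoʳ-≤-nonNeg (fromℕ (suc n)) {{ℚ.nonNegative (0≤fromℕ (suc n))}} (1≤fromℕ n)))

    -- `K` + `K` because the 2n + 1 weights number at most 2 (n + 1), and 1 for the surplus term
    -- `T⁺ n`.
    K₃ : ℚ
    K₃ = K + K + 1ℚ

    0≤K₃ : 0ℚ ≤ K₃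
    0≤K₃ = 0≤p+q (0≤p+q 0≤K 0≤K) 0≤1

    module _ {a b p : 𝔾} (ab≡p : a *ᴳ b ≡ p) {T⁺ T⁻ : ℕ → 𝔾} (T⁺0 : T⁺ 0 ≡ 1ᴳ) (T⁻0 : T⁻ 0 ≡ 1ᴳ)
      (T⁺-suc : ∀ k → T⁺ (suc k) ≡ ⊝ (a *ᴳ p ^ᴳ k *ᴳ T⁺ k))
      (T⁻-suc : ∀ k → T⁻ (suc k) ≡ ⊝ (b *ᴳ p ^ᴳ k *ᴳ T⁻ k))
      (p≼ρ : p ≼ ρ) (T⁺≼ : ∀ k → T⁺ k ≼ ρ ^ℚ k) (T⁻≼ : ∀ k → T⁻ k ≼ ρ ^ℚ k) where
      private
        T : ℕ → ℕ → 𝔾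
        T = bilateral T⁺ T⁻

        T≼-left : ∀ j k → T j (j ℕ.+ k) ≼ ρ ^ℚ k
        T≼-left zero    zero    = T⁺≼ 0
        T≼-left zero    (suc k) = T⁻≼ (suc k)
        T≼-left (suc j) k       = T≼-left j k

        T≼-right : ∀ n k → T (n ℕ.+ k) n ≼ ρ ^ℚ k
        T≼-right zero    k = T⁺≼ k
        T≼-right (suc n) k = T≼-right n k

        weight : ℕ → ℕ → 𝔾
        weight n j = qfac p n *ᴳ gauss p (n ℕ.+ n) j -ᴳ 1ᴳ

        combine : ∀ k u v → u ℕ.+ v ≡ k → K * ρ ^ℚ u * ρ ^ℚ v ≡ K * ρ ^ℚ k
        combine k u v refl = trans (ℚ.*-assoc K (ρ ^ℚ u) (ρ ^ℚ v)) (cong (K *_) (sym (ρ^-+ u v)))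
          where
          ρ^-+ : ∀ u v → ρ ^ℚ (u ℕ.+ v) ≡ ρ ^ℚ u * ρ ^ℚ v
          ρ^-+ zero    v = sym (ℚ.*-identityˡ (ρ ^ℚ v))
          ρ^-+ (suc u) v = trans (cong (ρ *_) (ρ^-+ u v)) (sym (ℚ.*-assoc ρ (ρ ^ℚ u) (ρ ^ℚ v)))

        -- Far from the centre the weight is a poor approximation of 0, but there the term is small.
        -- The weight is at most K ρ^μ with μ = min(j, 2n - j), the term at most ρ^|j-n|, and μ + |j
        -- - n| = n.
        weight*T≼ : ∀ n j → j ℕ.< suc (n ℕ.+ n) → weight n j *ᴳ T j n ≼ K * ρ ^ℚ n
        weight*T≼ n j j≤2n with ℕ.≤-total j n
        ... | inj₁ j≤n = subst (weight n j *ᴳ T j n ≼_) (combine n j (n ∸ j) (ℕ.m+[n∸m]≡n j≤n))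
          (*-≼ (qfac-gauss-close p≼ρ {n = n} j (n ℕ.+ n ∸ j) (ℕ.m+[n∸m]≡n (ℕ.≤-pred j≤2n)) ℕ.≤-refl
                 (ℕ.m+n≤o⇒m≤o∸n j (ℕ.+-mono-≤ j≤n j≤n)) j≤n)
               (subst (λ n′ → T j n′ ≼ ρ ^ℚ (n ∸ j)) (ℕ.m+[n∸m]≡n j≤n) (T≼-left j (n ∸ j))))
        ... | inj₂ n≤j = subst (weight n j *ᴳ T j n ≼_) (combine n (n ℕ.+ n ∸ j) (j ∸ n) sum≡n)
          (*-≼ (qfac-gauss-close p≼ρ {n = n} j (n ℕ.+ n ∸ j) (ℕ.m+[n∸m]≡n (ℕ.≤-pred j≤2n)) (ℕ.≤-trans μ≤n n≤j)
                 ℕ.≤-refl μ≤n)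
               (subst (λ j′ → T j′ n ≼ ρ ^ℚ (j ∸ n)) (ℕ.m+[n∸m]≡n n≤j) (T≼-right n (j ∸ n))))
          where
          μ≤n : n ℕ.+ n ∸ j ℕ.≤ n
          μ≤n = ℕ.m≤n+o⇒m∸n≤o (n ℕ.+ n) j (ℕ.+-monoˡ-≤ n n≤j)
          sum≡n : n ℕ.+ n ∸ j ℕ.+ (j ∸ n) ≡ n
          sum≡n = ℕ.+-cancelˡ-≡ n _ n (begin
            n ℕ.+ (n ℕ.+ n ∸ j ℕ.+ (j ∸ n))   ≡⟨ cong (n ℕ.+_) (ℕ.+-comm (n ℕ.+ n ∸ j) (j ∸ n)) ⟩
            n ℕ.+ (j ∸ n ℕ.+ (n ℕ.+ n ∸ j))   ≡⟨ ℕ.+-assoc n (j ∸ n) (n ℕ.+ n ∸ j) ⟨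
            n ℕ.+ (j ∸ n) ℕ.+ (n ℕ.+ n ∸ j)   ≡⟨ cong (ℕ._+ (n ℕ.+ n ∸ j)) (ℕ.m+[n∸m]≡n n≤j) ⟩
            j ℕ.+ (n ℕ.+ n ∸ j)               ≡⟨ ℕ.m+[n∸m]≡n (ℕ.≤-pred j≤2n) ⟩
            n ℕ.+ n                           ∎)
            where open ≡-Reasoning

      triple-product-close : ∀ n →
        qfac p n *ᴳ (Πᴳ n (λ j → 1ᴳ -ᴳ a *ᴳ p ^ᴳ j) *ᴳ Πᴳ n (λ j → 1ᴳ -ᴳ b *ᴳ p ^ᴳ j))
          -ᴳ (Σᴳ n T⁺ +ᴳ Σᴳ n (T⁻ ∘ suc)) ≼ K₃ * ε n
      triple-product-close n = subst (_≼ K₃ * ε n) (sym identity) (≼-mono bound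
        (+-≼ (Σᴳ-≼ (suc (n ℕ.+ n)) {λ j → weight n j *ᴳ T j n} (0≤p*q 0≤K (0≤ρ^ n)) (weight*T≼ n)) (T⁺≼ n)))
        where
        N = suc (n ℕ.+ n)
        A = Πᴳ n (λ j → 1ᴳ -ᴳ a *ᴳ p ^ᴳ j) *ᴳ Πᴳ n (λ j → 1ᴳ -ᴳ b *ᴳ p ^ᴳ j)
        W = Σᴳ N (λ j → weight n j *ᴳ T j n)
        split : ∀ x g t → x *ᴳ (g *ᴳ t) ≡ (x *ᴳ g -ᴳ 1ᴳ) *ᴳ t +ᴳ t
        split = solve-∀ 𝔾-ring
        cancel : ∀ w s t u → w +ᴳ (s +ᴳ t +ᴳ u) -ᴳ (s +ᴳ u) ≡ w +ᴳ t
        cancel = solve-∀ 𝔾-ring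
        -- The finite form runs over the indices -n to n, the partial sum only up to n - 1; hence
        -- the surplus term `T⁺ n`.
        identity : qfac p n *ᴳ A -ᴳ (Σᴳ n T⁺ +ᴳ Σᴳ n (T⁻ ∘ suc)) ≡ W +ᴳ T⁺ n
        identity = trans (cong (_-ᴳ (Σᴳ n T⁺ +ᴳ Σᴳ n (T⁻ ∘ suc))) (begin
          qfac p n *ᴳ A
            ≡⟨ cong (qfac p n *ᴳ_) (finite-triple-product a b p ab≡p T⁺ T⁻ T⁺0 T⁻0 T⁺-suc T⁻-suc n n) ⟩
          qfac p n *ᴳ Σᴳ N (λ j → gauss p (n ℕ.+ n) j *ᴳ T j n)
            ≡⟨ *-Σᴳ N (qfac p n) (λ j → gauss p (n ℕ.+ n) j *ᴳ T j n) ⟩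
          Σᴳ N (λ j → qfac p n *ᴳ (gauss p (n ℕ.+ n) j *ᴳ T j n))
            ≡⟨ Σᴳ-cong N (λ j _ → split (qfac p n) (gauss p (n ℕ.+ n) j) (T j n)) ⟩
          Σᴳ N (λ j → weight n j *ᴳ T j n +ᴳ T j n)
            ≡⟨ Σᴳ-+ N (λ j → weight n j *ᴳ T j n) (λ j → T j n) ⟩
          W +ᴳ Σᴳ N (λ j → T j n)
            ≡⟨ cong (λ m → W +ᴳ Σᴳ m (λ j → T j n)) (ℕ.+-suc n n) ⟨
          W +ᴳ Σᴳ (n ℕ.+ suc n) (λ j → T j n)
            ≡⟨ cong (W +ᴳ_) (Σ-bilateral T⁺ T⁻ n (suc n)) ⟩
          W +ᴳ (Σᴳ (suc n) T⁺ +ᴳ Σᴳ n (T⁻ ∘ suc))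
            ≡⟨ cong (λ t → W +ᴳ (t +ᴳ Σᴳ n (T⁻ ∘ suc))) (Σᴳ-last n T⁺) ⟩
          W +ᴳ (Σᴳ n T⁺ +ᴳ T⁺ n +ᴳ Σᴳ n (T⁻ ∘ suc)) ∎))
          (cancel W (Σᴳ n T⁺) (T⁺ n) (Σᴳ n (T⁻ ∘ suc)))
          where open ≡-Reasoning
        bound : fromℕ N * (K * ρ ^ℚ n) + ρ ^ℚ n ≤ K₃ * ε n
        bound = begin
          fromℕ N * (K * r) + r                    ≤⟨ ℚ.+-mono-≤ (ℚ.*-monoʳ-≤-nonNeg (K * r) {{ℚ.nonNegative (0≤p*q 0≤K (0≤ρ^ n))}} N≤2s)
                                                        (subst (_≤ s * r) (ℚ.*-identityˡ r) (ℚ.*-monoʳ-≤-nonNeg r {{ℚ.nonNegative (0≤ρ^ n)}} (1≤fromℕ n))) ⟩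
          (s + s) * (K * r) + s * r                ≡⟨ lemma s K r ⟩
          K₃ * (s * r)                             ≤⟨ ℚ.*-monoˡ-≤-nonNeg K₃ {{ℚ.nonNegative 0≤K₃}} (ρ^≤ε n) ⟩
          K₃ * ε n                                 ∎
          where
          open ℚ.≤-Reasoning
          r = ρ ^ℚ n
          s = fromℕ (suc n)
          N≤2s : fromℕ N ≤ s + s
          N≤2s = ℚ.≤-trans (fromℕ-mono-≤ (ℕ.s≤s (ℕ.+-monoʳ-≤ n (ℕ.n≤1+n n)))) (ℚ.≤-reflexive (fromℕ-+ (suc n) (suc n)))
          lemma : ∀ s k r → (s + s) * (k * r) + s * r ≡ (k + k + 1ℚ) * (s * r)
          lemma = solve-∀ ℚ-ring

  -- Sums over lists and reindexing of double series

  sumᴸ : (𝕏 → 𝔾) → List 𝕏 → 𝔾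
  sumᴸ f []       = 0ᴳ
  sumᴸ f (x ∷ xs) = f x +ᴳ sumᴸ f xs

  sumᴸ-cong : ∀ {f g : 𝕏 → 𝔾} → (∀ x → f x ≡ g x) → ∀ xs → sumᴸ f xs ≡ sumᴸ g xs
  sumᴸ-cong f≡g []       = refl
  sumᴸ-cong f≡g (x ∷ xs) = cong₂ _+ᴳ_ (f≡g x) (sumᴸ-cong f≡g xs)

  sumᴸ-++ : ∀ (f : 𝕏 → 𝔾) xs ys → sumᴸ f (xs ++ ys) ≡ sumᴸ f xs +ᴳ sumᴸ f ys
  sumᴸ-++ f []       ys = sym (𝔾ᵣ.+-identityˡ (sumᴸ f ys))
  sumᴸ-++ f (x ∷ xs) ys = trans (cong (f x +ᴳ_) (sumᴸ-++ f xs ys))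
    (sym (𝔾ᵣ.+-assoc (f x) (sumᴸ f xs) (sumᴸ f ys)))

  sumᴸ-map : ∀ (f : 𝕏 → 𝔾) (h : I → 𝕏) xs → sumᴸ f (map h xs) ≡ sumᴸ (f ∘ h) xs
  sumᴸ-map f h []       = refl
  sumᴸ-map f h (x ∷ xs) = cong (f (h x) +ᴳ_) (sumᴸ-map f h xs)

  sumᴸ-*ˡ : ∀ z (f : 𝕏 → 𝔾) xs → sumᴸ (λ x → z *ᴳ f x) xs ≡ z *ᴳ sumᴸ f xs
  sumᴸ-*ˡ z f []       = sym (𝔾ᵣ.zeroʳ z)
  sumᴸ-*ˡ z f (x ∷ xs) = trans (cong (z *ᴳ f x +ᴳ_) (sumᴸ-*ˡ z f xs)) (sym (𝔾ᵣ.distribˡ z (f x) (sumᴸ f xs)))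

  sumᴸ-cartesianProduct : ∀ (f : I → 𝔾) (g : J → 𝔾) xs ys →
    sumᴸ (λ (x , y) → f x *ᴳ g y) (cartesianProduct xs ys) ≡ sumᴸ f xs *ᴳ sumᴸ g ys
  sumᴸ-cartesianProduct f g []       ys = sym (𝔾ᵣ.zeroˡ (sumᴸ g ys))
  sumᴸ-cartesianProduct {I} {J} f g (x ∷ xs) ys = begin
    sumᴸ h (map (x ,_) ys ++ cartesianProduct xs ys)             ≡⟨ sumᴸ-++ h (map (x ,_) ys) (cartesianProduct xs ys) ⟩
    sumᴸ h (map (x ,_) ys) +ᴳ sumᴸ h (cartesianProduct xs ys)    ≡⟨ cong₂ _+ᴳ_ (trans (sumᴸ-map h (x ,_) ys) (sumᴸ-*ˡ (f x) g ys))
                                                                      (sumᴸ-cartesianProduct f g xs ys) ⟩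
    f x *ᴳ sumᴸ g ys +ᴳ sumᴸ f xs *ᴳ sumᴸ g ys                   ≡⟨ 𝔾ᵣ.distribʳ (sumᴸ g ys) (f x) (sumᴸ f xs) ⟨
    (f x +ᴳ sumᴸ f xs) *ᴳ sumᴸ g ys                              ∎
    where
    open ≡-Reasoning
    h : I × J → 𝔾
    h (x , y) = f x *ᴳ g y

  sumᴸ-applyUpTo : ∀ (f : 𝕏 → 𝔾) h n → sumᴸ f (applyUpTo h n) ≡ Σᴳ n (f ∘ h)
  sumᴸ-applyUpTo f h zero    = refl
  sumᴸ-applyUpTo f h (suc n) = cong (f (h 0) +ᴳ_) (sumᴸ-applyUpTo f (h ∘ suc) n)

  sumᴸ-↭ : ∀ (f : 𝕏 → 𝔾) {xs ys} → xs ↭ ys → sumᴸ f xs ≡ sumᴸ f ys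
  sumᴸ-↭ f ↭.refl              = refl
  sumᴸ-↭ f (↭.prep x xs↭ys)    = cong (f x +ᴳ_) (sumᴸ-↭ f xs↭ys)
  sumᴸ-↭ f (↭.swap {xs} {ys} x y xs↭ys) = trans (lemma (f x) (f y) (sumᴸ f xs))
    (cong (λ t → f y +ᴳ (f x +ᴳ t)) (sumᴸ-↭ f xs↭ys))
    where
    lemma : ∀ a b c → a +ᴳ (b +ᴳ c) ≡ b +ᴳ (a +ᴳ c)
    lemma = solve-∀ 𝔾-ring
  sumᴸ-↭ f (↭.trans p q)       = trans (sumᴸ-↭ f p) (sumᴸ-↭ f q)

  monomial : 𝔾 → (I → 𝔾) → (I → ℕ) → I → 𝔾
  monomial g σ e i = σ i *ᴳ g ^ᴳ e i

  module Reindexing (ρ : ℚ) (0≤ρ : 0ℚ ≤ ρ) (ρ<1 : ρ < 1ℚ) {g : 𝔾} (g≼ρ : g ≼ ρ) where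
    open Geometric ρ 0≤ρ ρ<1

    monomial-≼ : ∀ (σ : I → 𝔾) e → (∀ i → σ i ≼ 1ℚ) → ∀ {M} i → M ℕ.≤ e i → monomial g σ e i ≼ ρ ^ℚ M
    monomial-≼ σ e σ≼1 {M} i M≤e = ≼-mono (ρ^-anti M≤e)
      (subst (monomial g σ e i ≼_) (ℚ.*-identityˡ (ρ ^ℚ e i)) (*-≼ (σ≼1 i) (^-≼ g≼ρ (e i))))

    below : (I → ℕ) → ℕ → List I → List I
    below e M = filter (λ i → e i ℕ.<? M)

    truncation-close : ∀ (σ : I → 𝔾) e → (∀ i → σ i ≼ 1ℚ) → ∀ M xs →
      sumᴸ (monomial g σ e) xs -ᴳ sumᴸ (monomial g σ e) (below e M xs) ≼ fromℕ (length xs) * ρ ^ℚ M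
    truncation-close σ e σ≼1 M [] = subst (0ᴳ ≼_) (sym (ℚ.*-zeroˡ (ρ ^ℚ M))) (0≼ ℚ.≤-refl)
    truncation-close σ e σ≼1 M (x ∷ xs) with e x ℕ.<? M
    ... | yes e<M rewrite List.filter-accept (λ i → e i ℕ.<? M) {x} {xs} e<M = subst (_≼ (1ℚ + fromℕ (length xs)) * ρ ^ℚ M) (sym (keep t S S′))
      (≼-mono (ℚ.*-monoʳ-≤-nonNeg (ρ ^ℚ M) {{ℚ.nonNegative (0≤ρ^ M)}}
        (subst (_≤ 1ℚ + fromℕ (length xs)) (ℚ.+-identityˡ (fromℕ (length xs))) (ℚ.+-monoˡ-≤ (fromℕ (length xs)) 0≤1)))
        (truncation-close σ e σ≼1 M xs))
      where
      t = monomial g σ e x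
      S = sumᴸ (monomial g σ e) xs
      S′ = sumᴸ (monomial g σ e) (below e M xs)
      keep : ∀ t S S′ → t +ᴳ S -ᴳ (t +ᴳ S′) ≡ S -ᴳ S′
      keep = solve-∀ 𝔾-ring
    ... | no e≮M rewrite List.filter-reject (λ i → e i ℕ.<? M) {x} {xs} e≮M = subst₂ _≼_ (sym (𝔾ᵣ.+-assoc t S (⊝ S′))) (collect (ρ ^ℚ M) (fromℕ (length xs)))
      (+-≼ (monomial-≼ σ e σ≼1 x (ℕ.≮⇒≥ e≮M)) (truncation-close σ e σ≼1 M xs))
      where
      t = monomial g σ e x
      S = sumᴸ (monomial g σ e) xs
      S′ = sumᴸ (monomial g σ e) (below e M xs)
      collect : ∀ r n → r + n * r ≡ (1ℚ + n) * r
      collect = solve-∀ ℚ-ring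

    -- Both sums contain exactly the monomials of degree less than M, up to the
    -- bijection β, and all other monomials are small.
    reindexing-close : ∀ (σ : I → 𝔾) (e : I → ℕ) (σ′ : J → 𝔾) (e′ : J → ℕ) (β : J → I) →
      (∀ {x y} → β x ≡ β y → x ≡ y) → (∀ i → ∃[ j ] β j ≡ i) →
      (∀ j → σ′ j ≡ σ (β j)) → (∀ j → e′ j ≡ e (β j)) → (∀ i → σ i ≼ 1ℚ) →
      ∀ {M xs ys} → Unique xs → Unique ys → (∀ i → e i ℕ.< M → i ∈ xs) → (∀ j → e′ j ℕ.< M → j ∈ ys) →
      sumᴸ (monomial g σ e) xs -ᴳ sumᴸ (monomial g σ′ e′) ys ≼ fromℕ (length xs ℕ.+ length ys) * ρ ^ℚ M
    reindexing-close {I} {J} σ e σ′ e′ β β-inj β-surj σ′≡σ e′≡e σ≼1 {M} {xs} {ys} xs! ys! xs-all ys-all =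
      subst₂ _≼_ identity (sym (trans (cong (_* ρ ^ℚ M) (fromℕ-+ (length xs) (length ys)))
          (ℚ.*-distribʳ-+ (ρ ^ℚ M) (fromℕ (length xs)) (fromℕ (length ys)))))
        (-ᴳ-≼ (truncation-close σ e σ≼1 M xs) (truncation-close σ′ e′ σ′≼1 M ys))
      where
      σ′≼1 : ∀ j → σ′ j ≼ 1ℚ
      σ′≼1 j = subst (_≼ 1ℚ) (sym (σ′≡σ j)) (σ≼1 (β j))

      to : ∀ {i} → i ∈ below e M xs → i ∈ map β (below e′ M ys)
      to {i} i∈ with β-surj i
      ... | j , refl = ∈.∈-map⁺ β (∈.∈-filter⁺ (λ j → e′ j ℕ.<? M) (ys-all j e′<M) e′<M)
        where
        e′<M : e′ j ℕ.< M
        e′<M = subst (ℕ._< M) (sym (e′≡e j)) (proj₂ (∈.∈-filter⁻ (λ i → e i ℕ.<? M) {xs = xs} i∈))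

      from : ∀ {i} → i ∈ map β (below e′ M ys) → i ∈ below e M xs
      from i∈ with ∈.∈-map⁻ β i∈
      ... | j , j∈ , refl = ∈.∈-filter⁺ (λ i → e i ℕ.<? M) (xs-all (β j) e<M) e<M
        where
        e<M : e (β j) ℕ.< M
        e<M = subst (ℕ._< M) (e′≡e j) (proj₂ (∈.∈-filter⁻ (λ j → e′ j ℕ.<? M) {xs = ys} j∈))

      -- Neither list has duplicates, so having the same members makes them permutations of each
      -- other.
      permutation : below e M xs ↭ map β (below e′ M ys)
      permutation = ∼bag⇒↭ (unique∧set⇒bag
        (Unique.filter⁺ (λ i → e i ℕ.<? M) xs!)
        (Unique.map⁺ β-inj (Unique.filter⁺ (λ j → e′ j ℕ.<? M) ys!))
        (mk⇔ to from))

      truncations-equal : sumᴸ (monomial g σ e) (below e M xs) ≡ sumᴸ (monomial g σ′ e′) (below e′ M ys)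
      truncations-equal = begin
        sumᴸ (monomial g σ e) (below e M xs)            ≡⟨ sumᴸ-↭ (monomial g σ e) permutation ⟩
        sumᴸ (monomial g σ e) (map β (below e′ M ys))   ≡⟨ sumᴸ-map (monomial g σ e) β (below e′ M ys) ⟩
        sumᴸ (monomial g σ e ∘ β) (below e′ M ys)       ≡⟨ sumᴸ-cong (λ j → cong₂ (λ s n → s *ᴳ g ^ᴳ n) (sym (σ′≡σ j)) (sym (e′≡e j))) (below e′ M ys) ⟩
        sumᴸ (monomial g σ′ e′) (below e′ M ys)         ∎
        where open ≡-Reasoning

      cancel : ∀ x t y → (x -ᴳ t) -ᴳ (y -ᴳ t) ≡ x -ᴳ y
      cancel = solve-∀ 𝔾-ring

      identity : (sumᴸ (monomial g σ e) xs -ᴳ sumᴸ (monomial g σ e) (below e M xs))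
        -ᴳ (sumᴸ (monomial g σ′ e′) ys -ᴳ sumᴸ (monomial g σ′ e′) (below e′ M ys))
        ≡ sumᴸ (monomial g σ e) xs -ᴳ sumᴸ (monomial g σ′ e′) ys
      identity = trans (cong (λ t → (sumᴸ (monomial g σ e) xs -ᴳ t) -ᴳ (sumᴸ (monomial g σ′ e′) ys -ᴳ sumᴸ (monomial g σ′ e′) (below e′ M ys))) truncations-equal)
        (cancel (sumᴸ (monomial g σ e) xs) (sumᴸ (monomial g σ′ e′) (below e′ M ys)) (sumᴸ (monomial g σ′ e′) ys))

  -- Index sets and exponents of the theta series

  window : ℕ → List ℤ
  window n = applyUpTo ℤ.+_ n ++ applyUpTo -[1+_] n

  window! : ∀ n → Unique (window n)
  window! n = Unique.++⁺
    (Unique.applyUpTo⁺₁ ℤ.+_ n (λ i<j _ eq → ℕ.<⇒≢ i<j (ℤ.+-injective eq)))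
    (Unique.applyUpTo⁺₁ -[1+_] n (λ i<j _ eq → ℕ.<⇒≢ i<j (ℤ.-[1+-injective eq)))
    λ (p , q) → disjoint p q
    where
    disjoint : ∀ {i} → i ∈ applyUpTo ℤ.+_ n → i ∈ applyUpTo -[1+_] n → ⊥
    disjoint p q with ∈.∈-applyUpTo⁻ ℤ.+_ p | ∈.∈-applyUpTo⁻ -[1+_] q
    ... | _ , _ , refl | _ , _ , ()

  ∈-window : ∀ {n} k → ℤ.∣ k ∣ ℕ.< n → k ∈ window n
  ∈-window (ℤ.+ k)    k<n = ∈.∈-++⁺ˡ (∈.∈-applyUpTo⁺ ℤ.+_ k<n)
  ∈-window {n} -[1+ k ] k<n = ∈.∈-++⁺ʳ (applyUpTo ℤ.+_ n) (∈.∈-applyUpTo⁺ -[1+_] (ℕ.<-trans ℕ.≤-refl k<n))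

  length-window : ∀ n → length (window n) ≡ n ℕ.+ n
  length-window n = trans (List.length-++ (applyUpTo ℤ.+_ n))
    (cong₂ ℕ._+_ (List.length-applyUpTo ℤ.+_ n) (List.length-applyUpTo -[1+_] n))

  -- The right side has the shape of the partial sums in `∑ℤ`, with both ends at n.
  sumᴸ-window : ∀ t n → sumᴸ t (window n) ≡ Σᴳ n (λ k → t (ℤ.+ k)) +ᴳ Σᴳ n (λ k → t -[1+ k ])
  sumᴸ-window t n = trans (sumᴸ-++ t (applyUpTo ℤ.+_ n) (applyUpTo -[1+_] n))
    (cong₂ _+ᴳ_ (sumᴸ-applyUpTo t ℤ.+_ n) (sumᴸ-applyUpTo t -[1+_] n))

  square : ℕ → List (ℤ × ℤ)
  square n = cartesianProduct (window n) (window n)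

  square! : ∀ n → Unique (square n)
  square! n = Unique.cartesianProduct⁺ (window! n) (window! n)

  ∈-square : ∀ {n} k l → ℤ.∣ k ∣ ℕ.< n × ℤ.∣ l ∣ ℕ.< n → (k , l) ∈ square n
  ∈-square k l (k<n , l<n) = ∈.∈-cartesianProduct⁺ (∈-window k k<n) (∈-window l l<n)

  two-squares : ℕ → List (ℤ × ℤ ⊎ ℤ × ℤ)
  two-squares n = map inj₁ (square n) ++ map inj₂ (square n)

  two-squares! : ∀ n → Unique (two-squares n)
  two-squares! n = Unique.++⁺ (Unique.map⁺ (λ { refl → refl }) (square! n)) (Unique.map⁺ (λ { refl → refl }) (square! n))
    λ (p , q) → disjoint p q
    where
    disjoint : ∀ {j} → j ∈ map inj₁ (square n) → j ∈ map inj₂ (square n) → ⊥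
    disjoint p q with ∈.∈-map⁻ inj₁ p | ∈.∈-map⁻ inj₂ q
    ... | _ , _ , refl | _ , _ , ()

  length-cartesianProduct : ∀ (xs : List I) (ys : List J) →
    length (cartesianProduct xs ys) ≡ length xs ℕ.* length ys
  length-cartesianProduct []       ys = refl
  length-cartesianProduct (x ∷ xs) ys = trans (List.length-++ (map (x ,_) ys))
    (cong₂ ℕ._+_ (List.length-map (x ,_) ys) (length-cartesianProduct xs ys))

  length-square : ∀ n → length (square n) ≡ (n ℕ.+ n) ℕ.* (n ℕ.+ n)
  length-square n = trans (length-cartesianProduct (window n) (window n))
    (cong₂ ℕ._*_ (length-window n) (length-window n))

  length-two-squares : ∀ n → length (two-squares n) ≡ length (square n) ℕ.+ length (square n)
  length-two-squares n = trans (List.length-++ (map inj₁ (square n)))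
    (cong₂ ℕ._+_ (List.length-map inj₁ (square n)) (List.length-map inj₂ (square n)))

  -- tri⁺ and tri⁻ are the exponents j(j+1)/2 and j(j-1)/2 of the theta series.
  tri pre : ℕ → ℕ
  tri zero    = 0
  tri (suc n) = suc n ℕ.+ tri n
  pre zero    = 0
  pre (suc n) = tri n

  tri⁺ tri⁻ : ℤ → ℕ
  tri⁺ (ℤ.+ n)  = tri n
  tri⁺ -[1+ n ] = tri n
  tri⁻ (ℤ.+ n)  = pre n
  tri⁻ -[1+ n ] = tri (suc n)

  tri≡n+pre : ∀ n → tri n ≡ n ℕ.+ pre n
  tri≡n+pre zero    = refl
  tri≡n+pre (suc n) = refl

  2tri : ∀ n → tri n ℕ.* 2 ≡ n ℕ.* suc n
  2tri zero    = refl
  2tri (suc n) = begin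
    (suc n ℕ.+ tri n) ℕ.* 2       ≡⟨ ℕ.*-distribʳ-+ 2 (suc n) (tri n) ⟩
    suc n ℕ.* 2 ℕ.+ tri n ℕ.* 2   ≡⟨ cong (suc n ℕ.* 2 ℕ.+_) (2tri n) ⟩
    suc n ℕ.* 2 ℕ.+ n ℕ.* suc n   ≡⟨ lemma n ⟩
    suc n ℕ.* suc (suc n)         ∎
    where
    open ≡-Reasoning
    lemma : ∀ n → (1 ℕ.+ n) ℕ.* 2 ℕ.+ n ℕ.* (1 ℕ.+ n) ≡ (1 ℕ.+ n) ℕ.* (1 ℕ.+ (1 ℕ.+ n))
    lemma = ℕSolver.solve-∀

  private
    +2tri : ∀ n → ℤ.+ (tri n ℕ.* 2) ≡ ℤ.+ n ℤ.* (ℤ.+ n ℤ.+ ℤ.1ℤ)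
    +2tri n = trans (cong ℤ.+_ (trans (2tri n) (cong (n ℕ.*_) (ℕ.+-comm 1 n)))) (ℤ.pos-* n (n ℕ.+ 1))

  2tri⁺ : ∀ j → ℤ.+ (tri⁺ j ℕ.* 2) ≡ j ℤ.* (j ℤ.+ ℤ.1ℤ)
  2tri⁺ (ℤ.+ n)  = +2tri n
  2tri⁺ -[1+ n ] = trans (+2tri n) (lemma (ℤ.+ n))
    where
    lemma : ∀ x → x ℤ.* (x ℤ.+ ℤ.1ℤ) ≡ (ℤ.- (ℤ.1ℤ ℤ.+ x)) ℤ.* (ℤ.- (ℤ.1ℤ ℤ.+ x) ℤ.+ ℤ.1ℤ)
    lemma = ℤSolver.solve-∀

  2tri⁻ : ∀ j → ℤ.+ (tri⁻ j ℕ.* 2) ≡ j ℤ.* (j ℤ.- ℤ.1ℤ)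
  2tri⁻ (ℤ.+ zero)    = refl
  2tri⁻ (ℤ.+ suc n)   = trans (+2tri n) (lemma (ℤ.+ n))
    where
    lemma : ∀ x → x ℤ.* (x ℤ.+ ℤ.1ℤ) ≡ (ℤ.1ℤ ℤ.+ x) ℤ.* ((ℤ.1ℤ ℤ.+ x) ℤ.- ℤ.1ℤ)
    lemma = ℤSolver.solve-∀
  2tri⁻ -[1+ n ] = trans (+2tri (suc n)) (lemma (ℤ.+ n))
    where
    lemma : ∀ x → (ℤ.1ℤ ℤ.+ x) ℤ.* ((ℤ.1ℤ ℤ.+ x) ℤ.+ ℤ.1ℤ) ≡ (ℤ.- (ℤ.1ℤ ℤ.+ x)) ℤ.* (ℤ.- (ℤ.1ℤ ℤ.+ x) ℤ.- ℤ.1ℤ)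
    lemma = ℤSolver.solve-∀

  tri⁺-correct : ∀ j → ℤ.∣ j ℤ.* (j ℤ.+ ℤ.1ℤ) ∣ ℕ./ 2 ≡ tri⁺ j
  tri⁺-correct j = trans (cong (λ i → ℤ.∣ i ∣ ℕ./ 2) (sym (2tri⁺ j))) (ℕ.m*n/n≡m (tri⁺ j) 2)

  tri⁻-correct : ∀ j → ℤ.∣ j ℤ.* (j ℤ.- ℤ.1ℤ) ∣ ℕ./ 2 ≡ tri⁻ j
  tri⁻-correct j = trans (cong (λ i → ℤ.∣ i ∣ ℕ./ 2) (sym (2tri⁻ j))) (ℕ.m*n/n≡m (tri⁻ j) 2)

  ∣j∣≤tri⁺+tri⁻ : ∀ j → ℤ.∣ j ∣ ℕ.≤ tri⁺ j ℕ.+ tri⁻ j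
  ∣j∣≤tri⁺+tri⁻ (ℤ.+ n)  = ℕ.≤-trans (ℕ.m≤m+n n (pre n)) (ℕ.≤-trans (ℕ.≤-reflexive (sym (tri≡n+pre n))) (ℕ.m≤m+n (tri n) (pre n)))
  ∣j∣≤tri⁺+tri⁻ -[1+ n ] = ℕ.≤-trans (ℕ.m≤m+n (suc n) (tri n)) (ℕ.m≤n+m (suc n ℕ.+ tri n) (tri n))

  -- The exponent of q in the term of index j of f (±q^α) (±q^γ).
  degree : ℕ → ℕ → ℤ → ℕ
  degree α γ j = α ℕ.* tri⁺ j ℕ.+ γ ℕ.* tri⁻ j

  -- Since `tri⁺ j` + `tri⁻ j` = j². It follows that the window of radius M contains the index of
  -- every term of degree less than M.
  ∣j∣≤degree : ∀ {α γ} → 1 ℕ.≤ α → 1 ℕ.≤ γ → ∀ j → ℤ.∣ j ∣ ℕ.≤ degree α γ j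
  ∣j∣≤degree {α} {γ} 1≤α 1≤γ j = ℕ.≤-trans (∣j∣≤tri⁺+tri⁻ j)
    (ℕ.+-mono-≤ (ℕ.≤-trans (ℕ.≤-reflexive (sym (ℕ.*-identityˡ (tri⁺ j)))) (ℕ.*-monoˡ-≤ (tri⁺ j) 1≤α))
                (ℕ.≤-trans (ℕ.≤-reflexive (sym (ℕ.*-identityˡ (tri⁻ j)))) (ℕ.*-monoˡ-≤ (tri⁻ j) 1≤γ)))

  -- Doubling turns the exponents into polynomials over ℤ, so that identities between them are ring
  -- identities.
  2degree : ∀ α γ j → ℤ.+ (degree α γ j ℕ.* 2) ≡
    ℤ.+ α ℤ.* (j ℤ.* (j ℤ.+ ℤ.1ℤ)) ℤ.+ ℤ.+ γ ℤ.* (j ℤ.* (j ℤ.- ℤ.1ℤ))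
  2degree α γ j = begin
    ℤ.+ ((α ℕ.* x ℕ.+ γ ℕ.* y) ℕ.* 2)                       ≡⟨ cong ℤ.+_ (lemma α γ x y) ⟩
    ℤ.+ (α ℕ.* (x ℕ.* 2) ℕ.+ γ ℕ.* (y ℕ.* 2))               ≡⟨ cong₂ ℤ._+_ (ℤ.pos-* α (x ℕ.* 2)) (ℤ.pos-* γ (y ℕ.* 2)) ⟩
    ℤ.+ α ℤ.* ℤ.+ (x ℕ.* 2) ℤ.+ ℤ.+ γ ℤ.* ℤ.+ (y ℕ.* 2)     ≡⟨ cong₂ (λ s t → ℤ.+ α ℤ.* s ℤ.+ ℤ.+ γ ℤ.* t) (2tri⁺ j) (2tri⁻ j) ⟩
    ℤ.+ α ℤ.* (j ℤ.* (j ℤ.+ ℤ.1ℤ)) ℤ.+ ℤ.+ γ ℤ.* (j ℤ.* (j ℤ.- ℤ.1ℤ)) ∎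
    where
    open ≡-Reasoning
    x = tri⁺ j
    y = tri⁻ j
    lemma : ∀ a c x y → (a ℕ.* x ℕ.+ c ℕ.* y) ℕ.* 2 ≡ a ℕ.* (x ℕ.* 2) ℕ.+ c ℕ.* (y ℕ.* 2)
    lemma = ℕSolver.solve-∀

  halve-≡ : ∀ {m n} → ℤ.+ (m ℕ.* 2) ≡ ℤ.+ (n ℕ.* 2) → m ≡ n
  halve-≡ {m} {n} eq = ℕ.*-cancelʳ-≡ m n 2 (ℤ.+-injective eq)

  -- The sign (-1)^j

  χ : ℤ → 𝔾
  χ j = (⊝ 1ᴳ) ^ᴳ ℤ.∣ j ∣

  private
    ⊝1*⊝1* : ∀ x → ⊝ (⊝ 1ᴳ *ᴳ x) ≡ x
    ⊝1*⊝1* = solve-∀ 𝔾-ring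
    ⊝1* : ∀ x → ⊝ 1ᴳ *ᴳ x ≡ ⊝ x
    ⊝1* = solve-∀ 𝔾-ring
    ⊝-⊝ : ∀ x → ⊝ (⊝ x) ≡ x
    ⊝-⊝ = solve-∀ 𝔾-ring
    *-⊝ : ∀ x y → x *ᴳ ⊝ y ≡ ⊝ (x *ᴳ y)
    *-⊝ = solve-∀ 𝔾-ring

  χ-suc : ∀ j → χ (ℤ.1ℤ ℤ.+ j) ≡ ⊝ χ j
  χ-suc (ℤ.+ n)        = ⊝1* (χ (ℤ.+ n))
  χ-suc -[1+ zero ]    = refl
  χ-suc -[1+ suc n ]   = sym (⊝1*⊝1* (χ -[1+ n ]))

  χ-pred : ∀ j → χ (ℤ.-1ℤ ℤ.+ j) ≡ ⊝ χ j
  χ-pred j = trans (sym (⊝-⊝ (χ (ℤ.-1ℤ ℤ.+ j)))) (cong ⊝_ (trans (sym (χ-suc (ℤ.-1ℤ ℤ.+ j))) (cong χ (lemma j))))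
    where
    lemma : ∀ j → ℤ.1ℤ ℤ.+ (ℤ.-1ℤ ℤ.+ j) ≡ j
    lemma = ℤSolver.solve-∀

  χ-+ : ∀ i j → χ (i ℤ.+ j) ≡ χ i *ᴳ χ j
  χ-+ i (ℤ.+ zero)  = trans (cong χ (ℤ.+-identityʳ i)) (sym (𝔾ᵣ.*-identityʳ (χ i)))
  χ-+ i (ℤ.+ suc n) = begin
    χ (i ℤ.+ (ℤ.1ℤ ℤ.+ ℤ.+ n))       ≡⟨ cong χ (lemma i (ℤ.+ n)) ⟩
    χ (ℤ.1ℤ ℤ.+ (i ℤ.+ ℤ.+ n))       ≡⟨ χ-suc (i ℤ.+ ℤ.+ n) ⟩
    ⊝ χ (i ℤ.+ ℤ.+ n)                ≡⟨ cong ⊝_ (χ-+ i (ℤ.+ n)) ⟩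
    ⊝ (χ i *ᴳ χ (ℤ.+ n))             ≡⟨ *-⊝ (χ i) (χ (ℤ.+ n)) ⟨
    χ i *ᴳ ⊝ χ (ℤ.+ n)               ≡⟨ cong (χ i *ᴳ_) (χ-suc (ℤ.+ n)) ⟨
    χ i *ᴳ χ (ℤ.+ suc n)             ∎
    where
    open ≡-Reasoning
    lemma : ∀ i n → i ℤ.+ (ℤ.1ℤ ℤ.+ n) ≡ ℤ.1ℤ ℤ.+ (i ℤ.+ n)
    lemma = ℤSolver.solve-∀
  χ-+ i -[1+ zero ] = begin
    χ (i ℤ.+ ℤ.-1ℤ)      ≡⟨ cong χ (ℤ.+-comm i ℤ.-1ℤ) ⟩
    χ (ℤ.-1ℤ ℤ.+ i)      ≡⟨ χ-pred i ⟩
    ⊝ χ i                ≡⟨ lemma (χ i) ⟩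
    χ i *ᴳ χ ℤ.-1ℤ       ∎
    where
    open ≡-Reasoning
    lemma : ∀ x → ⊝ x ≡ x *ᴳ (⊝ 1ᴳ *ᴳ 1ᴳ)
    lemma = solve-∀ 𝔾-ring
  χ-+ i -[1+ suc n ] = begin
    χ (i ℤ.+ (ℤ.-1ℤ ℤ.+ -[1+ n ]))   ≡⟨ cong χ (lemma i -[1+ n ]) ⟩
    χ (ℤ.-1ℤ ℤ.+ (i ℤ.+ -[1+ n ]))   ≡⟨ χ-pred (i ℤ.+ -[1+ n ]) ⟩
    ⊝ χ (i ℤ.+ -[1+ n ])             ≡⟨ cong ⊝_ (χ-+ i -[1+ n ]) ⟩
    ⊝ (χ i *ᴳ χ -[1+ n ])            ≡⟨ *-⊝ (χ i) (χ -[1+ n ]) ⟨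
    χ i *ᴳ ⊝ χ -[1+ n ]              ≡⟨ cong (χ i *ᴳ_) (χ-pred -[1+ n ]) ⟨
    χ i *ᴳ χ -[1+ suc n ]            ∎
    where
    open ≡-Reasoning
    lemma : ∀ i n → i ℤ.+ (ℤ.-1ℤ ℤ.+ n) ≡ ℤ.-1ℤ ℤ.+ (i ℤ.+ n)
    lemma = ℤSolver.solve-∀

  χ-neg : ∀ j → χ (ℤ.- j) ≡ χ j
  χ-neg j = cong ((⊝ 1ᴳ) ^ᴳ_) (ℤ.∣-i∣≡∣i∣ j)

  χ² : ∀ j → χ j *ᴳ χ j ≡ 1ᴳ
  χ² j = go ℤ.∣ j ∣
    where
    lemma : ∀ x → ⊝ 1ᴳ *ᴳ x *ᴳ (⊝ 1ᴳ *ᴳ x) ≡ x *ᴳ x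
    lemma = solve-∀ 𝔾-ring
    go : ∀ n → (⊝ 1ᴳ) ^ᴳ n *ᴳ (⊝ 1ᴳ) ^ᴳ n ≡ 1ᴳ
    go zero    = refl
    go (suc n) = trans (lemma ((⊝ 1ᴳ) ^ᴳ n)) (go n)

  χ-- : ∀ i j → χ (i ℤ.- j) ≡ χ i *ᴳ χ j
  χ-- i j = trans (χ-+ i (ℤ.- j)) (cong (χ i *ᴳ_) (χ-neg j))

  χ≼1 : ∀ j → χ j ≼ 1ℚ
  χ≼1 j = subst (χ j ≼_) (one ℤ.∣ j ∣) (^-≼ (⊝-≼ 1≼1) ℤ.∣ j ∣)
    where
    one : ∀ n → 1ℚ ^ℚ n ≡ 1ℚ
    one zero    = refl
    one (suc n) = trans (ℚ.*-identityˡ (1ℚ ^ℚ n)) (one n)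

  -- The exponent is j², of the same parity as j; `split` writes it as |j| + 2t. This is the sign of
  -- the term of index j of f(-x, -y).
  χ-tri : ∀ j → (⊝ 1ᴳ) ^ᴳ (tri⁺ j ℕ.+ tri⁻ j) ≡ χ j
  χ-tri j = trans (cong ((⊝ 1ᴳ) ^ᴳ_) (proj₂ (split j))) (trans (^-homo-* (⊝ 1ᴳ) ℤ.∣ j ∣ (proj₁ (split j) ℕ.+ proj₁ (split j)))
    (trans (cong (χ j *ᴳ_) (trans (^-homo-* (⊝ 1ᴳ) (proj₁ (split j)) (proj₁ (split j))) (χ² (ℤ.+ proj₁ (split j))))) (𝔾ᵣ.*-identityʳ (χ j))))
    where
    split : ∀ j → ∃[ t ] (tri⁺ j ℕ.+ tri⁻ j ≡ ℤ.∣ j ∣ ℕ.+ (t ℕ.+ t))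
    split (ℤ.+ n)  = pre n , trans (cong (ℕ._+ pre n) (tri≡n+pre n)) (ℕ.+-assoc n (pre n) (pre n))
    split -[1+ n ] = tri n , lemma n (tri n)
      where
      lemma : ∀ n t → t ℕ.+ ((1 ℕ.+ n) ℕ.+ t) ≡ (1 ℕ.+ n) ℕ.+ (t ℕ.+ t)
      lemma = ℕSolver.solve-∀

  -- Odd numbers appear as 1 - 2t, the form that the second halves of `rotate` and `skew` need.
  halve : ∀ j → (∃[ t ] j ≡ t ℤ.+ t) ⊎ (∃[ t ] j ≡ ℤ.1ℤ ℤ.- (t ℤ.+ t))
  halve (ℤ.+ zero)    = inj₁ (ℤ.0ℤ , refl)
  halve (ℤ.+ suc n) with halve (ℤ.+ n)
  ... | inj₁ (t , eq) = inj₂ (ℤ.- t , trans (cong (λ s → ℤ.1ℤ ℤ.+ s) eq) (lemma t))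
    where
    lemma : ∀ t → ℤ.1ℤ ℤ.+ (t ℤ.+ t) ≡ ℤ.1ℤ ℤ.- (ℤ.- t ℤ.+ ℤ.- t)
    lemma = ℤSolver.solve-∀
  ... | inj₂ (t , eq) = inj₁ (ℤ.1ℤ ℤ.- t , trans (cong (λ s → ℤ.1ℤ ℤ.+ s) eq) (lemma t))
    where
    lemma : ∀ t → ℤ.1ℤ ℤ.+ (ℤ.1ℤ ℤ.- (t ℤ.+ t)) ≡ (ℤ.1ℤ ℤ.- t) ℤ.+ (ℤ.1ℤ ℤ.- t)
    lemma = ℤSolver.solve-∀
  halve -[1+ zero ]   = inj₂ (ℤ.1ℤ , refl)
  halve -[1+ suc n ] with halve -[1+ n ]
  ... | inj₁ (t , eq) = inj₂ (ℤ.1ℤ ℤ.- t , trans (cong (λ s → ℤ.-1ℤ ℤ.+ s) eq) (lemma t))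
    where
    lemma : ∀ t → ℤ.-1ℤ ℤ.+ (t ℤ.+ t) ≡ ℤ.1ℤ ℤ.- ((ℤ.1ℤ ℤ.- t) ℤ.+ (ℤ.1ℤ ℤ.- t))
    lemma = ℤSolver.solve-∀
  ... | inj₂ (t , eq) = inj₁ (ℤ.- t , trans (cong (λ s → ℤ.-1ℤ ℤ.+ s) eq) (lemma t))
    where
    lemma : ∀ t → ℤ.-1ℤ ℤ.+ (ℤ.1ℤ ℤ.- (t ℤ.+ t)) ≡ ℤ.- t ℤ.+ ℤ.- t
    lemma = ℤSolver.solve-∀

  double-injective : ∀ {i j} → i ℤ.+ i ≡ j ℤ.+ j → i ≡ j
  double-injective {i} {j} eq = ℤ.*-cancelˡ-≡ (ℤ.+ 2) i j (trans (lemma i) (trans eq (sym (lemma j))))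
    where
    lemma : ∀ i → ℤ.+ 2 ℤ.* i ≡ i ℤ.+ i
    lemma = ℤSolver.solve-∀

  -- Parity is read off the sign: `χ (j + j)` is 1, whereas `χ 1` is -1.
  double≢1 : ∀ j → j ℤ.+ j ≢ ℤ.1ℤ
  double≢1 j eq = not (trans (sym (trans (χ-+ j j) (χ² j))) (cong χ eq))
    where
    not : 1ᴳ ≢ χ ℤ.1ℤ
    not ()

  -- The two enumerations of ℤ × ℤ

  𝕁 : Set
  𝕁 = ℤ × ℤ ⊎ ℤ × ℤ

  -- rotate enumerates ℤ × ℤ by the parity of i + j, skew by the parity of j.
  rotate skew : 𝕁 → ℤ × ℤ
  rotate (inj₁ (k , l)) = k ℤ.+ l , k ℤ.- l
  rotate (inj₂ (k , l)) = ℤ.1ℤ ℤ.- (k ℤ.+ l) , l ℤ.- k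
  skew (inj₁ (k , l)) = k , l ℤ.+ l
  skew (inj₂ (k , l)) = k , ℤ.1ℤ ℤ.- (l ℤ.+ l)

  rotate-surjective : ∀ x → ∃[ y ] rotate y ≡ x
  rotate-surjective (i , j) with halve (i ℤ.+ j)
  ... | inj₁ (k , eq) = inj₁ (k , i ℤ.- k) , cong₂ _,_ (first k i) (trans (second k i) (trans (cong (λ s → s ℤ.- i) (sym eq)) (third i j)))
    where
    first : ∀ k i → k ℤ.+ (i ℤ.- k) ≡ i
    first = ℤSolver.solve-∀
    second : ∀ k i → k ℤ.- (i ℤ.- k) ≡ (k ℤ.+ k) ℤ.- i
    second = ℤSolver.solve-∀
    third : ∀ i j → (i ℤ.+ j) ℤ.- i ≡ j
    third = ℤSolver.solve-∀
  ... | inj₂ (k , eq) = inj₂ (k , ℤ.1ℤ ℤ.- k ℤ.- i) , cong₂ _,_ (first k i) (trans (second k i) (trans (cong (λ s → s ℤ.- i) (sym eq)) (third i j)))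
    where
    first : ∀ k i → ℤ.1ℤ ℤ.- (k ℤ.+ (ℤ.1ℤ ℤ.- k ℤ.- i)) ≡ i
    first = ℤSolver.solve-∀
    second : ∀ k i → (ℤ.1ℤ ℤ.- k ℤ.- i) ℤ.- k ≡ (ℤ.1ℤ ℤ.- (k ℤ.+ k)) ℤ.- i
    second = ℤSolver.solve-∀
    third : ∀ i j → (i ℤ.+ j) ℤ.- i ≡ j
    third = ℤSolver.solve-∀

  skew-surjective : ∀ x → ∃[ y ] skew y ≡ x
  skew-surjective (i , j) with halve j
  ... | inj₁ (k , eq) = inj₁ (i , k) , cong (i ,_) (sym eq)
  ... | inj₂ (k , eq) = inj₂ (i , k) , cong (i ,_) (sym eq)

  private
    pair-≡ : ∀ {i j i′ j′ : ℤ} → (i , j) ≡ (i′ , j′) → i ≡ i′ × j ≡ j′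
    pair-≡ refl = refl , refl

  -- The sum of the two components is 2k or 1 - 2k, so it determines both the half and k; a mixed
  -- pair would give 2 (k + k′) = 1.
  rotate-injective : ∀ {x y} → rotate x ≡ rotate y → x ≡ y
  rotate-injective {inj₁ (k , l)} {inj₁ (k′ , l′)} eq with pair-≡ eq
  ... | p , q with double-injective {k} {k′} (trans (sym (lemma k l)) (trans (cong₂ ℤ._+_ p q) (lemma k′ l′)))
    where
    lemma : ∀ k l → (k ℤ.+ l) ℤ.+ (k ℤ.- l) ≡ k ℤ.+ k
    lemma = ℤSolver.solve-∀
  ... | refl with ∙-cancelˡ k l l′ p
  ... | refl = refl
  rotate-injective {inj₁ (k , l)} {inj₂ (k′ , l′)} eq with pair-≡ eq
  ... | p , q = ⊥-elim (double≢1 (k ℤ.+ k′) (trans (sum k l k′) (trans (cong₂ (λ s t → s ℤ.+ t ℤ.+ (k′ ℤ.+ k′)) p q) (one k′ l′))))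
    where
    sum : ∀ k l k′ → (k ℤ.+ k′) ℤ.+ (k ℤ.+ k′) ≡ (k ℤ.+ l) ℤ.+ (k ℤ.- l) ℤ.+ (k′ ℤ.+ k′)
    sum = ℤSolver.solve-∀
    one : ∀ k l → (ℤ.1ℤ ℤ.- (k ℤ.+ l)) ℤ.+ (l ℤ.- k) ℤ.+ (k ℤ.+ k) ≡ ℤ.1ℤ
    one = ℤSolver.solve-∀
  rotate-injective {inj₂ x} {inj₁ y} eq with rotate-injective {inj₁ y} {inj₂ x} (sym eq)
  ... | ()
  rotate-injective {inj₂ (k , l)} {inj₂ (k′ , l′)} eq with pair-≡ eq
  ... | p , q with double-injective {k} {k′} (trans (sym (lemma k l)) (trans (cong₂ (λ s t → ℤ.1ℤ ℤ.- (s ℤ.+ t)) p q) (lemma k′ l′)))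
    where
    lemma : ∀ k l → ℤ.1ℤ ℤ.- ((ℤ.1ℤ ℤ.- (k ℤ.+ l)) ℤ.+ (l ℤ.- k)) ≡ k ℤ.+ k
    lemma = ℤSolver.solve-∀
  ... | refl with ∙-cancelʳ (ℤ.- k) l l′ q
  ... | refl = refl

  skew-injective : ∀ {x y} → skew x ≡ skew y → x ≡ y
  skew-injective {inj₁ (k , l)} {inj₁ (k′ , l′)} eq with pair-≡ eq
  ... | refl , q with double-injective {l} {l′} q
  ... | refl = refl
  skew-injective {inj₁ (k , l)} {inj₂ (k′ , l′)} eq with pair-≡ eq
  ... | refl , q = ⊥-elim (double≢1 (l ℤ.+ l′) (trans (sum l l′) (trans (cong (λ s → s ℤ.+ (l′ ℤ.+ l′)) q) (one l′))))
    where
    sum : ∀ l l′ → (l ℤ.+ l′) ℤ.+ (l ℤ.+ l′) ≡ (l ℤ.+ l) ℤ.+ (l′ ℤ.+ l′)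
    sum = ℤSolver.solve-∀
    one : ∀ l → (ℤ.1ℤ ℤ.- (l ℤ.+ l)) ℤ.+ (l ℤ.+ l) ≡ ℤ.1ℤ
    one = ℤSolver.solve-∀
  skew-injective {inj₂ x} {inj₁ y} eq with skew-injective {inj₁ y} {inj₂ x} (sym eq)
  ... | ()
  skew-injective {inj₂ (k , l)} {inj₂ (k′ , l′)} eq with pair-≡ eq
  ... | refl , q with double-injective {l} {l′} (trans (sym (lemma l)) (trans (cong (λ s → ℤ.1ℤ ℤ.- s) q) (lemma l′)))
    where
    lemma : ∀ l → ℤ.1ℤ ℤ.- (ℤ.1ℤ ℤ.- (l ℤ.+ l)) ≡ l ℤ.+ l
    lemma = ℤSolver.solve-∀
  ... | refl = refl

  -- Products of theta series and their exponents

  infixr 7 _⊠_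
  infixr 6 _⊞_

  _⊠_ : (I → 𝔾) → (J → 𝔾) → I × J → 𝔾
  (σ ⊠ σ′) (i , j) = σ i *ᴳ σ′ j

  _⊞_ : (I → ℕ) → (J → ℕ) → I × J → ℕ
  (e ⊞ e′) (i , j) = e i ℕ.+ e′ j

  ⊠-≼1 : ∀ {σ : I → 𝔾} {σ′ : J → 𝔾} → (∀ i → σ i ≼ 1ℚ) → (∀ j → σ′ j ≼ 1ℚ) → ∀ x → (σ ⊠ σ′) x ≼ 1ℚ
  ⊠-≼1 σ≼1 σ′≼1 (i , j) = *-≼ (σ≼1 i) (σ′≼1 j)

  θ : 𝔾 → (ℤ → 𝔾) → (ℤ → ℕ) → ℕ → 𝔾
  θ g σ e n = sumᴸ (monomial g σ e) (window n)

  θ-* : ∀ g σ e σ′ e′ n → sumᴸ (monomial g (σ ⊠ σ′) (e ⊞ e′)) (square n) ≡ θ g σ e n *ᴳ θ g σ′ e′ n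
  θ-* g σ e σ′ e′ n = trans
    (sumᴸ-cong (λ (i , j) → trans (cong (σ i *ᴳ σ′ j *ᴳ_) (^-homo-* g (e i) (e′ j))) (lemma (σ i) (σ′ j) (g ^ᴳ e i) (g ^ᴳ e′ j))) (square n))
    (sumᴸ-cartesianProduct (monomial g σ e) (monomial g σ′ e′) (window n) (window n))
    where
    lemma : ∀ a b c d → a *ᴳ b *ᴳ (c *ᴳ d) ≡ a *ᴳ c *ᴳ (b *ᴳ d)
    lemma = solve-∀ 𝔾-ring

  𝟏 : ℤ → 𝔾
  𝟏 _ = 1ᴳ

  χ-1- : ∀ j → χ (ℤ.1ℤ ℤ.- j) ≡ ⊝ χ j
  χ-1- j = trans (χ-suc (ℤ.- j)) (cong ⊝_ (χ-neg j))

  ∣l∣≤∣2l∣ : ∀ l → ℤ.∣ l ∣ ℕ.≤ ℤ.∣ l ℤ.+ l ∣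
  ∣l∣≤∣2l∣ (ℤ.+ n)  = ℕ.m≤m+n n n
  ∣l∣≤∣2l∣ -[1+ n ] = ℕ.s≤s (ℕ.m≤n⇒m≤1+n (ℕ.m≤m+n n n))

  -- The triangle inequality gives 2|l| ≤ 1 + |1 - 2l|, and the 1 is absorbed when |l| ≥ 1. The
  -- second index of `skew` is 2l or 1 - 2l, while membership in a square concerns l.
  ∣l∣≤∣1-2l∣ : ∀ l → ℤ.∣ l ∣ ℕ.≤ ℤ.∣ ℤ.1ℤ ℤ.- (l ℤ.+ l) ∣
  ∣l∣≤∣1-2l∣ l with ℤ.∣ l ∣ in eq
  ... | zero  = ℕ.z≤n
  ... | suc n = ℕ.≤-trans (ℕ.m≤n+m (suc n) n) (ℕ.≤-pred (subst (ℕ._≤ suc ℤ.∣ ℤ.1ℤ ℤ.- (l ℤ.+ l) ∣)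
      (trans (∣2l∣ l) (cong₂ ℕ._+_ eq eq)) triangle))
    where
    ∣2l∣ : ∀ l → ℤ.∣ l ℤ.+ l ∣ ≡ ℤ.∣ l ∣ ℕ.+ ℤ.∣ l ∣
    ∣2l∣ (ℤ.+ n)  = refl
    ∣2l∣ -[1+ n ] = cong suc (sym (ℕ.+-suc n n))
    rewr : ∀ l → ℤ.1ℤ ℤ.- (ℤ.1ℤ ℤ.- (l ℤ.+ l)) ≡ l ℤ.+ l
    rewr = ℤSolver.solve-∀
    triangle : ℤ.∣ l ℤ.+ l ∣ ℕ.≤ suc ℤ.∣ ℤ.1ℤ ℤ.- (l ℤ.+ l) ∣
    triangle = subst (λ i → ℤ.∣ i ∣ ℕ.≤ suc ℤ.∣ ℤ.1ℤ ℤ.- (l ℤ.+ l) ∣) (rewr l) (ℤ.∣i-j∣≤∣i∣+∣j∣ ℤ.1ℤ (ℤ.1ℤ ℤ.- (l ℤ.+ l)))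

  -- In the theorem α = 19 - 2n, m = 2n and s = 19. The exponents of the theta
  -- functions: deg₁ and deg₂ for those that the triple product makes of the
  -- denominator and the numerator of Y, and degᶠ, degᵠ, degᵡ, degᵍ for f and φ in
  -- the numerator and ψ and f in the denominator of the right-hand sides.
  module Exponents (α m : ℕ) where
    s : ℕ
    s = α ℕ.+ m

    deg₁ deg₂ degᶠ degᵠ degᵡ degᵍ : ℤ → ℕ
    deg₁ = degree (s ℕ.+ m) (s ℕ.+ s ℕ.+ α)
    deg₂ = degree α (s ℕ.+ s ℕ.+ s ℕ.+ m)
    degᶠ = degree m (s ℕ.+ α)
    degᵠ = degree s s
    degᵡ = degree (s ℕ.+ s) (3 ℕ.* (s ℕ.+ s))
    degᵍ = degree α (s ℕ.+ m)

    private
      double-+ : ∀ x y {X Y} → ℤ.+ (x ℕ.* 2) ≡ X → ℤ.+ (y ℕ.* 2) ≡ Y → ℤ.+ ((x ℕ.+ y) ℕ.* 2) ≡ X ℤ.+ Y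
      double-+ x y refl refl = cong ℤ.+_ (ℕ.*-distribʳ-+ 2 x y)

      2deg² : ∀ a b i c d j → ℤ.+ ((degree a b i ℕ.+ degree c d j) ℕ.* 2) ≡ _
      2deg² a b i c d j = double-+ (degree a b i) (degree c d j) (2degree a b i) (2degree c d j)

      φf-even : ∀ A M k l →
        (((A ℤ.+ M) ℤ.+ M) ℤ.* (k ℤ.* (k ℤ.+ ℤ.1ℤ)) ℤ.+ ((A ℤ.+ M) ℤ.+ (A ℤ.+ M) ℤ.+ A) ℤ.* (k ℤ.* (k ℤ.- ℤ.1ℤ)))
          ℤ.+ (((A ℤ.+ M) ℤ.+ M) ℤ.* (l ℤ.* (l ℤ.+ ℤ.1ℤ)) ℤ.+ ((A ℤ.+ M) ℤ.+ (A ℤ.+ M) ℤ.+ A) ℤ.* (l ℤ.* (l ℤ.- ℤ.1ℤ))) ≡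
        (M ℤ.* ((k ℤ.+ l) ℤ.* ((k ℤ.+ l) ℤ.+ ℤ.1ℤ)) ℤ.+ ((A ℤ.+ M) ℤ.+ A) ℤ.* ((k ℤ.+ l) ℤ.* ((k ℤ.+ l) ℤ.- ℤ.1ℤ)))
          ℤ.+ ((A ℤ.+ M) ℤ.* ((k ℤ.- l) ℤ.* ((k ℤ.- l) ℤ.+ ℤ.1ℤ)) ℤ.+ (A ℤ.+ M) ℤ.* ((k ℤ.- l) ℤ.* ((k ℤ.- l) ℤ.- ℤ.1ℤ)))
      φf-even = ℤSolver.solve-∀

      φf-odd : ∀ A M k l →
        (M ℤ.* ℤ.+ 2) ℤ.+ ((A ℤ.* (k ℤ.* (k ℤ.+ ℤ.1ℤ)) ℤ.+ ((A ℤ.+ M) ℤ.+ (A ℤ.+ M) ℤ.+ (A ℤ.+ M) ℤ.+ M) ℤ.* (k ℤ.* (k ℤ.- ℤ.1ℤ)))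
          ℤ.+ (A ℤ.* (l ℤ.* (l ℤ.+ ℤ.1ℤ)) ℤ.+ ((A ℤ.+ M) ℤ.+ (A ℤ.+ M) ℤ.+ (A ℤ.+ M) ℤ.+ M) ℤ.* (l ℤ.* (l ℤ.- ℤ.1ℤ)))) ≡
        (M ℤ.* ((ℤ.1ℤ ℤ.- (k ℤ.+ l)) ℤ.* ((ℤ.1ℤ ℤ.- (k ℤ.+ l)) ℤ.+ ℤ.1ℤ)) ℤ.+ ((A ℤ.+ M) ℤ.+ A) ℤ.* ((ℤ.1ℤ ℤ.- (k ℤ.+ l)) ℤ.* ((ℤ.1ℤ ℤ.- (k ℤ.+ l)) ℤ.- ℤ.1ℤ)))
          ℤ.+ ((A ℤ.+ M) ℤ.* ((l ℤ.- k) ℤ.* ((l ℤ.- k) ℤ.+ ℤ.1ℤ)) ℤ.+ (A ℤ.+ M) ℤ.* ((l ℤ.- k) ℤ.* ((l ℤ.- k) ℤ.- ℤ.1ℤ)))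
      φf-odd = ℤSolver.solve-∀

      -- The summand `ℤ.+ 0` is there because `3 ℕ.* t` unfolds to t + (t + (t + 0)).
      ψg-even : ∀ A M k l →
        (A ℤ.* ((k ℤ.+ l) ℤ.* ((k ℤ.+ l) ℤ.+ ℤ.1ℤ)) ℤ.+ ((A ℤ.+ M) ℤ.+ (A ℤ.+ M) ℤ.+ (A ℤ.+ M) ℤ.+ M) ℤ.* ((k ℤ.+ l) ℤ.* ((k ℤ.+ l) ℤ.- ℤ.1ℤ)))
          ℤ.+ (((A ℤ.+ M) ℤ.+ M) ℤ.* ((k ℤ.- l) ℤ.* ((k ℤ.- l) ℤ.+ ℤ.1ℤ)) ℤ.+ ((A ℤ.+ M) ℤ.+ (A ℤ.+ M) ℤ.+ A) ℤ.* ((k ℤ.- l) ℤ.* ((k ℤ.- l) ℤ.- ℤ.1ℤ))) ≡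
        ((((A ℤ.+ M) ℤ.+ (A ℤ.+ M))) ℤ.* (k ℤ.* (k ℤ.+ ℤ.1ℤ)) ℤ.+ (((A ℤ.+ M) ℤ.+ (A ℤ.+ M)) ℤ.+ (((A ℤ.+ M) ℤ.+ (A ℤ.+ M)) ℤ.+ (((A ℤ.+ M) ℤ.+ (A ℤ.+ M)) ℤ.+ ℤ.+ 0))) ℤ.* (k ℤ.* (k ℤ.- ℤ.1ℤ)))
          ℤ.+ (A ℤ.* ((l ℤ.+ l) ℤ.* ((l ℤ.+ l) ℤ.+ ℤ.1ℤ)) ℤ.+ ((A ℤ.+ M) ℤ.+ M) ℤ.* ((l ℤ.+ l) ℤ.* ((l ℤ.+ l) ℤ.- ℤ.1ℤ)))
      ψg-even = ℤSolver.solve-∀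

      ψg-odd : ∀ A M k l →
        (A ℤ.* ((ℤ.1ℤ ℤ.- (k ℤ.+ l)) ℤ.* ((ℤ.1ℤ ℤ.- (k ℤ.+ l)) ℤ.+ ℤ.1ℤ)) ℤ.+ ((A ℤ.+ M) ℤ.+ (A ℤ.+ M) ℤ.+ (A ℤ.+ M) ℤ.+ M) ℤ.* ((ℤ.1ℤ ℤ.- (k ℤ.+ l)) ℤ.* ((ℤ.1ℤ ℤ.- (k ℤ.+ l)) ℤ.- ℤ.1ℤ)))
          ℤ.+ (((A ℤ.+ M) ℤ.+ M) ℤ.* ((l ℤ.- k) ℤ.* ((l ℤ.- k) ℤ.+ ℤ.1ℤ)) ℤ.+ ((A ℤ.+ M) ℤ.+ (A ℤ.+ M) ℤ.+ A) ℤ.* ((l ℤ.- k) ℤ.* ((l ℤ.- k) ℤ.- ℤ.1ℤ))) ≡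
        ((((A ℤ.+ M) ℤ.+ (A ℤ.+ M))) ℤ.* (k ℤ.* (k ℤ.+ ℤ.1ℤ)) ℤ.+ (((A ℤ.+ M) ℤ.+ (A ℤ.+ M)) ℤ.+ (((A ℤ.+ M) ℤ.+ (A ℤ.+ M)) ℤ.+ (((A ℤ.+ M) ℤ.+ (A ℤ.+ M)) ℤ.+ ℤ.+ 0))) ℤ.* (k ℤ.* (k ℤ.- ℤ.1ℤ)))
          ℤ.+ (A ℤ.* ((ℤ.1ℤ ℤ.- (l ℤ.+ l)) ℤ.* ((ℤ.1ℤ ℤ.- (l ℤ.+ l)) ℤ.+ ℤ.1ℤ)) ℤ.+ ((A ℤ.+ M) ℤ.+ M) ℤ.* ((ℤ.1ℤ ℤ.- (l ℤ.+ l)) ℤ.* ((ℤ.1ℤ ℤ.- (l ℤ.+ l)) ℤ.- ℤ.1ℤ)))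
      ψg-odd = ℤSolver.solve-∀

    φf-exponents : 𝕁 → ℕ
    φf-exponents (inj₁ x) = (deg₁ ⊞ deg₁) x
    φf-exponents (inj₂ x) = m ℕ.+ (deg₂ ⊞ deg₂) x

    -- In closed form `deg₁ k` = 2s k² - α k, `deg₂ k` = 2s k² - (α + 2m) k, `degᶠ i` = s i² - α i
    -- and `degᵠ j` = s j². In the odd class, s - α = m is the constant term.
    φf-exponents-rotate : ∀ x → φf-exponents x ≡ (degᶠ ⊞ degᵠ) (rotate x)
    φf-exponents-rotate (inj₁ (k , l)) = halve-≡ (trans (2deg² (s ℕ.+ m) (s ℕ.+ s ℕ.+ α) k (s ℕ.+ m) (s ℕ.+ s ℕ.+ α) l)
      (trans (φf-even (ℤ.+ α) (ℤ.+ m) k l) (sym (2deg² m (s ℕ.+ α) (k ℤ.+ l) s s (k ℤ.- l)))))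
    φf-exponents-rotate (inj₂ (k , l)) = halve-≡ (trans
      (double-+ m (deg₂ k ℕ.+ deg₂ l) (ℤ.pos-* m 2) (2deg² α (s ℕ.+ s ℕ.+ s ℕ.+ m) k α (s ℕ.+ s ℕ.+ s ℕ.+ m) l))
      (trans (φf-odd (ℤ.+ α) (ℤ.+ m) k l) (sym (2deg² m (s ℕ.+ α) (ℤ.1ℤ ℤ.- (k ℤ.+ l)) s s (l ℤ.- k)))))

    -- In closed form `degᵡ k` = 4s k² - 2s k and `degᵍ j` = s j² - m j. The cross terms k l cancel
    -- on the left, which separates k from l.
    ψg-exponents : ∀ x → (deg₂ ⊞ deg₁) (rotate x) ≡ (degᵡ ⊞ degᵍ) (skew x)
    ψg-exponents (inj₁ (k , l)) = halve-≡ (trans (2deg² α (s ℕ.+ s ℕ.+ s ℕ.+ m) (k ℤ.+ l) (s ℕ.+ m) (s ℕ.+ s ℕ.+ α) (k ℤ.- l))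
      (trans (ψg-even (ℤ.+ α) (ℤ.+ m) k l) (sym (2deg² (s ℕ.+ s) (3 ℕ.* (s ℕ.+ s)) k α (s ℕ.+ m) (l ℤ.+ l)))))
    ψg-exponents (inj₂ (k , l)) = halve-≡ (trans (2deg² α (s ℕ.+ s ℕ.+ s ℕ.+ m) (ℤ.1ℤ ℤ.- (k ℤ.+ l)) (s ℕ.+ m) (s ℕ.+ s ℕ.+ α) (l ℤ.- k))
      (trans (ψg-odd (ℤ.+ α) (ℤ.+ m) k l) (sym (2deg² (s ℕ.+ s) (3 ℕ.* (s ℕ.+ s)) k α (s ℕ.+ m) (ℤ.1ℤ ℤ.- (l ℤ.+ l))))))

  ∈-two-squares₁ : ∀ {n} k l → ℤ.∣ k ∣ ℕ.< n × ℤ.∣ l ∣ ℕ.< n → inj₁ (k , l) ∈ two-squares n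
  ∈-two-squares₁ k l bounds = ∈.∈-++⁺ˡ (∈.∈-map⁺ inj₁ (∈-square k l bounds))

  ∈-two-squares₂ : ∀ {n} k l → ℤ.∣ k ∣ ℕ.< n × ℤ.∣ l ∣ ℕ.< n → inj₂ (k , l) ∈ two-squares n
  ∈-two-squares₂ {n} k l bounds = ∈.∈-++⁺ʳ (map inj₁ (square n)) (∈.∈-map⁺ inj₂ (∈-square k l bounds))

  1≤+ : ∀ {m} n → 1 ℕ.≤ m → 1 ℕ.≤ m ℕ.+ n
  1≤+ {m} n 1≤m = ℕ.≤-trans 1≤m (ℕ.m≤m+n m n)

  -- The theta function identities up to the error `ε`

  module Identities (ρ : ℚ) (0≤ρ : 0ℚ ≤ ρ) (ρ<1 : ρ < 1ℚ) {g : 𝔾} (g≼ρ : g ≼ ρ)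
    (α m : ℕ) (1≤α : 1 ℕ.≤ α) (1≤m : 1 ℕ.≤ m) where
    open Estimates ρ 0≤ρ ρ<1
    open Reindexing ρ 0≤ρ ρ<1 g≼ρ
    open Exponents α m

    private
      1≤s : 1 ℕ.≤ s
      1≤s = 1≤+ m 1≤α

      ≤deg₁ : ∀ j → ℤ.∣ j ∣ ℕ.≤ deg₁ j
      ≤deg₁ = ∣j∣≤degree (1≤+ m 1≤s) (1≤+ α (1≤+ s 1≤s))
      ≤deg₂ : ∀ j → ℤ.∣ j ∣ ℕ.≤ deg₂ j
      ≤deg₂ = ∣j∣≤degree 1≤α (1≤+ m (1≤+ s (1≤+ s 1≤s)))
      ≤degᶠ : ∀ j → ℤ.∣ j ∣ ℕ.≤ degᶠ j
      ≤degᶠ = ∣j∣≤degree 1≤m (1≤+ α 1≤s)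
      ≤degᵠ : ∀ j → ℤ.∣ j ∣ ℕ.≤ degᵠ j
      ≤degᵠ = ∣j∣≤degree 1≤s 1≤s
      ≤degᵡ : ∀ j → ℤ.∣ j ∣ ℕ.≤ degᵡ j
      ≤degᵡ = ∣j∣≤degree (1≤+ s 1≤s) (1≤+ (2 ℕ.* (s ℕ.+ s)) (1≤+ s 1≤s))
      ≤degᵍ : ∀ j → ℤ.∣ j ∣ ℕ.≤ degᵍ j
      ≤degᵍ = ∣j∣≤degree 1≤α (1≤+ m 1≤s)

      summands< : ∀ {a b c d M} → a ℕ.≤ c → c ℕ.+ d ℕ.< M → b ℕ.≤ d → a ℕ.< M × b ℕ.< M
      summands< {c = c} {d} a≤c c+d<M b≤d = ℕ.≤-<-trans (ℕ.≤-trans a≤c (ℕ.m≤m+n c d)) c+d<M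
                                    , ℕ.≤-<-trans (ℕ.≤-trans b≤d (ℕ.m≤n+m d c)) c+d<M

      -- One square of side 2M against two of them: 4M² + 8M² = 12M² terms.
      error≤ : ∀ M → fromℕ (length (square M) ℕ.+ length (two-squares M)) * ρ ^ℚ M ≤ fromℕ 12 * ε M
      error≤ M = subst (fromℕ (length (square M) ℕ.+ length (two-squares M)) * ρ ^ℚ M ≤_) (ℚ.*-assoc (fromℕ 12) (fromℕ (suc M) * fromℕ (suc M)) (ρ ^ℚ M))
        (ℚ.*-monoʳ-≤-nonNeg (ρ ^ℚ M) {{ℚ.nonNegative (0≤ρ^ M)}} (begin
          fromℕ (length (square M) ℕ.+ length (two-squares M))
            ≤⟨ fromℕ-mono-≤ (ℕ.≤-trans (ℕ.≤-reflexive lengths) (ℕ.*-monoʳ-≤ 12 (ℕ.*-mono-≤ (ℕ.n≤1+n M) (ℕ.n≤1+n M)))) ⟩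
          fromℕ (12 ℕ.* (suc M ℕ.* suc M))
            ≡⟨ trans (fromℕ-* 12 (suc M ℕ.* suc M)) (cong (fromℕ 12 *_) (fromℕ-* (suc M) (suc M))) ⟩
          fromℕ 12 * (fromℕ (suc M) * fromℕ (suc M)) ∎))
        where
        open ℚ.≤-Reasoning
        count : ∀ M → (M ℕ.+ M) ℕ.* (M ℕ.+ M) ℕ.+ ((M ℕ.+ M) ℕ.* (M ℕ.+ M) ℕ.+ (M ℕ.+ M) ℕ.* (M ℕ.+ M)) ≡ 12 ℕ.* (M ℕ.* M)
        count = ℕSolver.solve-∀
        lengths : length (square M) ℕ.+ length (two-squares M) ≡ 12 ℕ.* (M ℕ.* M)
        lengths = trans (cong (length (square M) ℕ.+_) (length-two-squares M))
          (trans (cong (λ t → t ℕ.+ (t ℕ.+ t)) (length-square M)) (count M))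

    module _ (σᶠ σᵠ : ℤ → 𝔾) (ς : 𝔾) (σᶠ≼1 : ∀ j → σᶠ j ≼ 1ℚ) (σᵠ≼1 : ∀ j → σᵠ j ≼ 1ℚ)
      (even : ∀ k l → χ k *ᴳ χ l ≡ σᶠ (k ℤ.+ l) *ᴳ σᵠ (k ℤ.- l))
      (odd : ∀ k l → ς *ᴳ (χ k *ᴳ χ l) ≡ σᶠ (ℤ.1ℤ ℤ.- (k ℤ.+ l)) *ᴳ σᵠ (l ℤ.- k)) where

      -- One statement for both identities of the theorem: ς is the sign of the second square, and
      -- the hypotheses `even` and `odd` match the signs on the two halves of `rotate`.
      φf-close : ∀ M → θ g σᶠ degᶠ M *ᴳ θ g σᵠ degᵠ M
        -ᴳ (θ g χ deg₁ M *ᴳ θ g χ deg₁ M +ᴳ ς *ᴳ g ^ᴳ m *ᴳ (θ g χ deg₂ M *ᴳ θ g χ deg₂ M)) ≼ fromℕ 12 * ε M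
      φf-close M = ≼-mono (error≤ M) (subst (_≼ fromℕ (length (square M) ℕ.+ length (two-squares M)) * ρ ^ℚ M)
        (cong₂ _-ᴳ_ (θ-* g σᶠ degᶠ σᵠ degᵠ M) sum-two-squares)
        (reindexing-close (σᶠ ⊠ σᵠ) (degᶠ ⊞ degᵠ) signs φf-exponents rotate rotate-injective rotate-surjective
          signs-rotate φf-exponents-rotate (⊠-≼1 σᶠ≼1 σᵠ≼1) (square! M) (two-squares! M) square-all two-squares-all))
        where
        signs : 𝕁 → 𝔾
        signs (inj₁ x) = (χ ⊠ χ) x
        signs (inj₂ x) = ς *ᴳ (χ ⊠ χ) x

        signs-rotate : ∀ x → signs x ≡ (σᶠ ⊠ σᵠ) (rotate x)
        signs-rotate (inj₁ (k , l)) = even k l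
        signs-rotate (inj₂ (k , l)) = odd k l

        square-all : ∀ x → (degᶠ ⊞ degᵠ) x ℕ.< M → x ∈ square M
        square-all (i , j) e<M = ∈-square i j (summands< (≤degᶠ i) e<M (≤degᵠ j))

        two-squares-all : ∀ x → φf-exponents x ℕ.< M → x ∈ two-squares M
        two-squares-all (inj₁ (k , l)) e<M = ∈-two-squares₁ k l (summands< (≤deg₁ k) e<M (≤deg₁ l))
        two-squares-all (inj₂ (k , l)) e<M = ∈-two-squares₂ k l (summands< (≤deg₂ k) (ℕ.≤-<-trans (ℕ.m≤n+m (deg₂ k ℕ.+ deg₂ l) m) e<M) (≤deg₂ l))

        factor : ∀ ς x u v → ς *ᴳ x *ᴳ (u *ᴳ v) ≡ ς *ᴳ u *ᴳ (x *ᴳ v)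
        factor = solve-∀ 𝔾-ring

        sum-two-squares : sumᴸ (monomial g signs φf-exponents) (two-squares M) ≡
          θ g χ deg₁ M *ᴳ θ g χ deg₁ M +ᴳ ς *ᴳ g ^ᴳ m *ᴳ (θ g χ deg₂ M *ᴳ θ g χ deg₂ M)
        sum-two-squares = begin
          sumᴸ T (two-squares M)
            ≡⟨ sumᴸ-++ T (map inj₁ (square M)) (map inj₂ (square M)) ⟩
          sumᴸ T (map inj₁ (square M)) +ᴳ sumᴸ T (map inj₂ (square M))
            ≡⟨ cong₂ _+ᴳ_ (sumᴸ-map T inj₁ (square M)) (sumᴸ-map T inj₂ (square M)) ⟩
          sumᴸ (monomial g (χ ⊠ χ) (deg₁ ⊞ deg₁)) (square M) +ᴳ sumᴸ (T ∘ inj₂) (square M)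
            ≡⟨ cong₂ _+ᴳ_ (θ-* g χ deg₁ χ deg₁ M)
                 (sumᴸ-cong (λ x → trans (cong (ς *ᴳ (χ ⊠ χ) x *ᴳ_) (^-homo-* g m ((deg₂ ⊞ deg₂) x)))
                    (factor ς ((χ ⊠ χ) x) (g ^ᴳ m) (g ^ᴳ (deg₂ ⊞ deg₂) x))) (square M)) ⟩
          θ g χ deg₁ M *ᴳ θ g χ deg₁ M +ᴳ sumᴸ (λ x → ς *ᴳ g ^ᴳ m *ᴳ monomial g (χ ⊠ χ) (deg₂ ⊞ deg₂) x) (square M)
            ≡⟨ cong (θ g χ deg₁ M *ᴳ θ g χ deg₁ M +ᴳ_) (trans (sumᴸ-*ˡ (ς *ᴳ g ^ᴳ m) (monomial g (χ ⊠ χ) (deg₂ ⊞ deg₂)) (square M))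
                 (cong (ς *ᴳ g ^ᴳ m *ᴳ_) (θ-* g χ deg₂ χ deg₂ M))) ⟩
          θ g χ deg₁ M *ᴳ θ g χ deg₁ M +ᴳ ς *ᴳ g ^ᴳ m *ᴳ (θ g χ deg₂ M *ᴳ θ g χ deg₂ M) ∎
          where
          open ≡-Reasoning
          T = monomial g signs φf-exponents

    φf-close⁺ : ∀ M → θ g 𝟏 degᶠ M *ᴳ θ g χ degᵠ M
      -ᴳ (θ g χ deg₁ M *ᴳ θ g χ deg₁ M +ᴳ 1ᴳ *ᴳ g ^ᴳ m *ᴳ (θ g χ deg₂ M *ᴳ θ g χ deg₂ M)) ≼ fromℕ 12 * ε M
    φf-close⁺ = φf-close 𝟏 χ 1ᴳ (λ _ → 1≼1) χ≼1
      (λ k l → trans (sym (χ-- k l)) (sym (𝔾ᵣ.*-identityˡ (χ (k ℤ.- l)))))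
      (λ k l → cong (1ᴳ *ᴳ_) (trans (𝔾ᵣ.*-comm (χ k) (χ l)) (sym (χ-- l k))))

    -- With the sign on f instead of φ, the odd class carries χ(1 - (k + l)) = -χ(k + l); this is
    -- where the minus sign comes from.
    φf-close⁻ : ∀ M → θ g χ degᶠ M *ᴳ θ g 𝟏 degᵠ M
      -ᴳ (θ g χ deg₁ M *ᴳ θ g χ deg₁ M +ᴳ ⊝ 1ᴳ *ᴳ g ^ᴳ m *ᴳ (θ g χ deg₂ M *ᴳ θ g χ deg₂ M)) ≼ fromℕ 12 * ε M
    φf-close⁻ = φf-close χ 𝟏 (⊝ 1ᴳ) χ≼1 (λ _ → 1≼1)
      (λ k l → trans (sym (χ-+ k l)) (sym (𝔾ᵣ.*-identityʳ (χ (k ℤ.+ l)))))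
      (λ k l → trans (cong (⊝ 1ᴳ *ᴳ_) (sym (χ-+ k l)))
        (trans (negate (χ (k ℤ.+ l))) (cong (_*ᴳ 1ᴳ) (sym (χ-1- (k ℤ.+ l))))))
      where
      negate : ∀ x → ⊝ 1ᴳ *ᴳ x ≡ ⊝ x *ᴳ 1ᴳ
      negate = solve-∀ 𝔾-ring

    -- Both products are compared with one sum over `𝕁`, through `skew` for ψ f and through `rotate`
    -- for θ₂ θ₁; hence twice the error.
    ψg-close : ∀ M → θ g 𝟏 degᵡ M *ᴳ θ g χ degᵍ M -ᴳ θ g χ deg₂ M *ᴳ θ g χ deg₁ M
      ≼ fromℕ 12 * ε M + fromℕ 12 * ε M
    ψg-close M = subst (_≼ fromℕ 12 * ε M + fromℕ 12 * ε M)
      (trans (cancel (sumᴸ (monomial g (𝟏 ⊠ χ) (degᵡ ⊞ degᵍ)) (square M)) (sumᴸ (monomial g signs exponents) (two-squares M))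
          (sumᴸ (monomial g (χ ⊠ χ) (deg₂ ⊞ deg₁)) (square M)))
        (cong₂ _-ᴳ_ (θ-* g 𝟏 degᵡ χ degᵍ M) (θ-* g χ deg₂ χ deg₁ M)))
      (-ᴳ-≼
        (≼-mono (error≤ M) (reindexing-close (𝟏 ⊠ χ) (degᵡ ⊞ degᵍ) signs exponents skew skew-injective skew-surjective
          signs-skew ψg-exponents (⊠-≼1 (λ _ → 1≼1) χ≼1) (square! M) (two-squares! M) skew-all two-squares-all))
        (≼-mono (error≤ M) (reindexing-close (χ ⊠ χ) (deg₂ ⊞ deg₁) signs exponents rotate rotate-injective rotate-surjective
          (λ _ → refl) (λ _ → refl) (⊠-≼1 χ≼1 χ≼1) (square! M) (two-squares! M) rotate-all two-squares-all)))
      where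
      signs : 𝕁 → 𝔾
      signs x = (χ ⊠ χ) (rotate x)

      exponents : 𝕁 → ℕ
      exponents x = (deg₂ ⊞ deg₁) (rotate x)

      cancel : ∀ x t y → (x -ᴳ t) -ᴳ (y -ᴳ t) ≡ x -ᴳ y
      cancel = solve-∀ 𝔾-ring

      signs-skew : ∀ x → signs x ≡ (𝟏 ⊠ χ) (skew x)
      signs-skew (inj₁ (k , l)) = begin
        χ (k ℤ.+ l) *ᴳ χ (k ℤ.- l)           ≡⟨ χ-+ (k ℤ.+ l) (k ℤ.- l) ⟨
        χ ((k ℤ.+ l) ℤ.+ (k ℤ.- l))          ≡⟨ cong χ (lemma k l) ⟩
        χ (k ℤ.+ k)                          ≡⟨ χ-double k ⟩
        1ᴳ                                   ≡⟨ χ-double l ⟨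
        χ (l ℤ.+ l)                          ≡⟨ 𝔾ᵣ.*-identityˡ (χ (l ℤ.+ l)) ⟨
        1ᴳ *ᴳ χ (l ℤ.+ l)                    ∎
        where
        open ≡-Reasoning
        lemma : ∀ k l → (k ℤ.+ l) ℤ.+ (k ℤ.- l) ≡ k ℤ.+ k
        lemma = ℤSolver.solve-∀
        χ-double : ∀ j → χ (j ℤ.+ j) ≡ 1ᴳ
        χ-double j = trans (χ-+ j j) (χ² j)
      signs-skew (inj₂ (k , l)) = begin
        χ (ℤ.1ℤ ℤ.- (k ℤ.+ l)) *ᴳ χ (l ℤ.- k)      ≡⟨ χ-+ (ℤ.1ℤ ℤ.- (k ℤ.+ l)) (l ℤ.- k) ⟨
        χ ((ℤ.1ℤ ℤ.- (k ℤ.+ l)) ℤ.+ (l ℤ.- k))     ≡⟨ cong χ (lemma k l) ⟩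
        χ (ℤ.1ℤ ℤ.- (k ℤ.+ k))                     ≡⟨ χ-odd k ⟩
        ⊝ 1ᴳ                                       ≡⟨ χ-odd l ⟨
        χ (ℤ.1ℤ ℤ.- (l ℤ.+ l))                     ≡⟨ 𝔾ᵣ.*-identityˡ (χ (ℤ.1ℤ ℤ.- (l ℤ.+ l))) ⟨
        1ᴳ *ᴳ χ (ℤ.1ℤ ℤ.- (l ℤ.+ l))               ∎
        where
        open ≡-Reasoning
        lemma : ∀ k l → (ℤ.1ℤ ℤ.- (k ℤ.+ l)) ℤ.+ (l ℤ.- k) ≡ ℤ.1ℤ ℤ.- (k ℤ.+ k)
        lemma = ℤSolver.solve-∀
        χ-odd : ∀ j → χ (ℤ.1ℤ ℤ.- (j ℤ.+ j)) ≡ ⊝ 1ᴳ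
        χ-odd j = trans (χ-1- (j ℤ.+ j)) (cong ⊝_ (trans (χ-+ j j) (χ² j)))

      skew-all : ∀ x → (degᵡ ⊞ degᵍ) x ℕ.< M → x ∈ square M
      skew-all (i , j) e<M = ∈-square i j (summands< (≤degᵡ i) e<M (≤degᵍ j))

      rotate-all : ∀ x → (deg₂ ⊞ deg₁) x ℕ.< M → x ∈ square M
      rotate-all (i , j) e<M = ∈-square i j (summands< (≤deg₂ i) e<M (≤deg₁ j))

      two-squares-all : ∀ x → exponents x ℕ.< M → x ∈ two-squares M
      -- The degree is rewritten in its `skew` form, where k itself is an index and l enters through
      -- 2l alone.
      two-squares-all x@(inj₁ (k , l)) e<M = ∈-two-squares₁ k l
        (summands< (≤degᵡ k) (subst (ℕ._< M) (ψg-exponents x) e<M) (ℕ.≤-trans (∣l∣≤∣2l∣ l) (≤degᵍ (l ℤ.+ l))))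
      two-squares-all x@(inj₂ (k , l)) e<M = ∈-two-squares₂ k l
        (summands< (≤degᵡ k) (subst (ℕ._< M) (ψg-exponents x) e<M) (ℕ.≤-trans (∣l∣≤∣1-2l∣ l) (≤degᵍ (ℤ.1ℤ ℤ.- (l ℤ.+ l)))))

  -- Jacobi's triple product for f (-g^a) (-g^c), with base g^(a+c).
  module JacobiTripleProduct (ρ : ℚ) (0≤ρ : 0ℚ ≤ ρ) (ρ<1 : ρ < 1ℚ) {g : 𝔾} (g≼ρ : g ≼ ρ)
    (a c : ℕ) (1≤a : 1 ℕ.≤ a) (1≤c : 1 ℕ.≤ c) where
    open Estimates ρ 0≤ρ ρ<1 hiding (c)

    private
      p : 𝔾
      p = g ^ᴳ (a ℕ.+ c)

      -- Exchanging a and c reflects the theta series, so `term c a` supplies the terms of negative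
      -- index.
      term : ℕ → ℕ → ℕ → 𝔾
      term a c k = χ (ℤ.+ k) *ᴳ g ^ᴳ degree a c (ℤ.+ k)

      term-0 : ∀ a c → term a c 0 ≡ 1ᴳ
      term-0 a c = cong (λ k → 1ᴳ *ᴳ g ^ᴳ k) (cong₂ ℕ._+_ (ℕ.*-zeroʳ a) (ℕ.*-zeroʳ c))

      term-suc : ∀ a c k → term a c (suc k) ≡ ⊝ (g ^ᴳ a *ᴳ (g ^ᴳ (a ℕ.+ c)) ^ᴳ k *ᴳ term a c k)
      term-suc a c k = begin
        χ (ℤ.+ suc k) *ᴳ g ^ᴳ (a ℕ.* tri (suc k) ℕ.+ c ℕ.* tri k)
          ≡⟨ cong₂ _*ᴳ_ (χ-suc (ℤ.+ k)) (cong (g ^ᴳ_) exponents) ⟩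
        ⊝ χ (ℤ.+ k) *ᴳ g ^ᴳ (a ℕ.+ (a ℕ.+ c) ℕ.* k ℕ.+ degree a c (ℤ.+ k))
          ≡⟨ cong (⊝ χ (ℤ.+ k) *ᴳ_) (trans (^-homo-* g (a ℕ.+ (a ℕ.+ c) ℕ.* k) (degree a c (ℤ.+ k)))
               (cong (_*ᴳ g ^ᴳ degree a c (ℤ.+ k)) (trans (^-homo-* g a ((a ℕ.+ c) ℕ.* k))
                 (cong (g ^ᴳ a *ᴳ_) (sym (^-assocʳ g (a ℕ.+ c) k)))))) ⟩
        ⊝ χ (ℤ.+ k) *ᴳ (g ^ᴳ a *ᴳ (g ^ᴳ (a ℕ.+ c)) ^ᴳ k *ᴳ g ^ᴳ degree a c (ℤ.+ k))
          ≡⟨ lemma (χ (ℤ.+ k)) (g ^ᴳ a *ᴳ (g ^ᴳ (a ℕ.+ c)) ^ᴳ k) (g ^ᴳ degree a c (ℤ.+ k)) ⟩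
        ⊝ (g ^ᴳ a *ᴳ (g ^ᴳ (a ℕ.+ c)) ^ᴳ k *ᴳ term a c k) ∎
        where
        open ≡-Reasoning
        arith : ∀ a c k t → a ℕ.* ((1 ℕ.+ k) ℕ.+ (k ℕ.+ t)) ℕ.+ c ℕ.* (k ℕ.+ t) ≡
          a ℕ.+ (a ℕ.+ c) ℕ.* k ℕ.+ (a ℕ.* (k ℕ.+ t) ℕ.+ c ℕ.* t)
        arith = ℕSolver.solve-∀
        exponents : a ℕ.* tri (suc k) ℕ.+ c ℕ.* tri k ≡ a ℕ.+ (a ℕ.+ c) ℕ.* k ℕ.+ degree a c (ℤ.+ k)
        exponents = subst (λ t → a ℕ.* (suc k ℕ.+ t) ℕ.+ c ℕ.* t ≡ a ℕ.+ (a ℕ.+ c) ℕ.* k ℕ.+ (a ℕ.* t ℕ.+ c ℕ.* pre k))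
          (sym (tri≡n+pre k)) (arith a c k (pre k))
        lemma : ∀ x u v → ⊝ x *ᴳ (u *ᴳ v) ≡ ⊝ (u *ᴳ (x *ᴳ v))
        lemma = solve-∀ 𝔾-ring

      term-≼ : ∀ {a c} → 1 ℕ.≤ a → 1 ℕ.≤ c → ∀ k → term a c k ≼ ρ ^ℚ k
      term-≼ {a} {c} 1≤a 1≤c k = Reindexing.monomial-≼ ρ 0≤ρ ρ<1 g≼ρ χ (degree a c) χ≼1 (ℤ.+ k) (∣j∣≤degree 1≤a 1≤c (ℤ.+ k))

      θ≡ : ∀ n → Σᴳ n (term a c) +ᴳ Σᴳ n (term c a ∘ suc) ≡ θ g χ (degree a c) n
      θ≡ n = trans (cong (Σᴳ n (term a c) +ᴳ_) (Σᴳ-cong n (λ k _ →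
          cong (λ e → χ (ℤ.+ suc k) *ᴳ g ^ᴳ e) (ℕ.+-comm (c ℕ.* tri (suc k)) (a ℕ.* tri k)))))
        (sym (sumᴸ-window (monomial g χ (degree a c)) n))

    jacobi-close : ∀ n →
      qfac p n *ᴳ (Πᴳ n (λ j → 1ᴳ -ᴳ g ^ᴳ a *ᴳ p ^ᴳ j) *ᴳ Πᴳ n (λ j → 1ᴳ -ᴳ g ^ᴳ c *ᴳ p ^ᴳ j))
        -ᴳ θ g χ (degree a c) n ≼ K₃ * ε n
    jacobi-close n = subst (λ t → qfac p n *ᴳ (Πᴳ n (λ j → 1ᴳ -ᴳ g ^ᴳ a *ᴳ p ^ᴳ j) *ᴳ Πᴳ n (λ j → 1ᴳ -ᴳ g ^ᴳ c *ᴳ p ^ᴳ j)) -ᴳ t ≼ K₃ * ε n) (θ≡ n)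
      (triple-product-close {g ^ᴳ a} {g ^ᴳ c} (sym (^-homo-* g a c)) (term-0 a c) (term-0 c a) (term-suc a c)
        (λ k → trans (term-suc c a k) (cong (λ e → ⊝ (g ^ᴳ c *ᴳ (g ^ᴳ e) ^ᴳ k *ᴳ term c a k)) (ℕ.+-comm c a)))
        p≼ρ (term-≼ 1≤a 1≤c) (term-≼ 1≤c 1≤a) n)
      where
      p≼ρ : p ≼ ρ
      p≼ρ = ≼-mono (ℚ.≤-trans (ρ^-anti {1} (ℕ.≤-trans 1≤a (ℕ.m≤m+n a c))) (ℚ.≤-reflexive (ℚ.*-identityʳ ρ)))
        (^-≼ g≼ρ (a ℕ.+ c))

-- Complex numbers through their rational approximations

open GaussianRationals
open import Data.Nat.Base using (_≤_) renaming (_+_ to _+ℕ_; _*_ to _*ℕ_)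
open import Defs

-- For fixed n this commutes with the ring operations definitionally, since those act termwise;
-- powers, sums and products need only induction.
at : ℂ → ℕ → 𝔾
at z n = seq (re z) n +ⁱ seq (im z) n

at-^ : ∀ z k n → at (z ^ k) n ≡ at z n ^ᴳ k
at-^ z zero    n = refl
at-^ z (suc k) n = cong (at z n *ᴳ_) (at-^ z k n)

at-sum : ∀ (t : ℕ → ℂ) k n → at (sum {k} (λ j → t (toℕ j))) n ≡ Σᴳ k (λ j → at (t j) n)
at-sum t zero    n = refl
at-sum t (suc k) n = cong (at (t 0) n +ᴳ_) (at-sum (t ∘ suc) k n)

at-product : ∀ (t : ℕ → ℂ) k n → at (product {k} (λ j → t (toℕ j))) n ≡ Πᴳ k (λ j → at (t j) n)
at-product t zero    n = refl
at-product t (suc k) n = cong (at (t 0) n *ᴳ_) (at-product (t ∘ suc) k n)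

both : ∀ {P Q : ℕ → Set} → Eventually P → Eventually Q → Eventually (λ n → P n × Q n)
both (M , p) (N , q) = M ℕ.⊔ N , λ n le → p n (ℕ.m⊔n≤o⇒m≤o M N le) , q n (ℕ.m⊔n≤o⇒n≤o M N le)

eventually-map : ∀ {P Q : ℕ → Set} → (∀ n → P n → Q n) → Eventually P → Eventually Q
eventually-map h (N , p) = N , λ n N≤n → h n (p n N≤n)

½ε+½ε≡ε : ∀ ε → ½ ℚ.* ε ℚ.+ ½ ℚ.* ε ≡ ε
½ε+½ε≡ε ε = trans (sym (ℚ.*-distribʳ-+ ε ½ ½)) (ℚ.*-identityˡ ε)

0<½ε : ∀ {ε} → 0ℚ ℚ.< ε → 0ℚ ℚ.< ½ ℚ.* ε
0<½ε = 0<p*q 0<½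

½ε<ε : ∀ {ε} → 0ℚ ℚ.< ε → ½ ℚ.* ε ℚ.< ε
½ε<ε {ε} 0<ε = subst₂ ℚ._<_ (ℚ.+-identityʳ (½ ℚ.* ε)) (½ε+½ε≡ε ε) (ℚ.+-monoʳ-< (½ ℚ.* ε) (0<½ε 0<ε))

-- Equality of complex numbers in terms of the norm of 𝔾

infix 4 _∼_

-- A record, so that both numbers can be inferred from z ∼ w.
record _∼_ (z w : ℂ) : Set where
  constructor ∼-intro
  field
    eventually-close : ∀ ε → 0ℚ ℚ.< ε → Eventually λ n → at z n -ᴳ at w n ≼ ε
open _∼_

∼⇒≈ : ∀ {z w} → z ∼ w → z ≈ w
∼⇒≈ (∼-intro h) = (λ ε 0<ε → eventually-map (λ n h → ℚ.≤-<-trans (∣reᴳ∣≤ h) (½ε<ε 0<ε)) (h (½ ℚ.* ε) (0<½ε 0<ε)))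
                , (λ ε 0<ε → eventually-map (λ n h → ℚ.≤-<-trans (∣imᴳ∣≤ h) (½ε<ε 0<ε)) (h (½ ℚ.* ε) (0<½ε 0<ε)))

close⇒∼ : ∀ {z w x} → Null x → Eventually (λ n → at z n -ᴳ at w n ≼ x n) → z ∼ w
close⇒∼ x→0 h = ∼-intro λ ε 0<ε → eventually-map (λ n (z-w≼x , x≤ε) → ≼-mono x≤ε z-w≼x) (both h (x→0 ε 0<ε))

private
  x-x≡0 : ∀ x → x -ᴳ x ≡ 0ᴳ
  x-x≡0 = solve-∀ 𝔾-ring

-- Carries exact identities in `𝔾`, such as the ring laws, over to ℂ.
pointwise : ∀ {z w} → (∀ n → at z n ≡ at w n) → z ∼ w
pointwise {z} {w} z≡w = ∼-intro λ ε 0<ε → 0 , λ n _ →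
  subst (_≼ ε) (sym (trans (cong (_-ᴳ at w n) (z≡w n)) (x-x≡0 (at w n)))) (0≼ (ℚ.<⇒≤ 0<ε))

∼-refl : ∀ {z} → z ∼ z
∼-refl = pointwise λ _ → refl

∼-sym : ∀ {z w} → z ∼ w → w ∼ z
∼-sym {z} {w} (∼-intro h) = ∼-intro λ ε 0<ε → eventually-map
  (λ n h → subst (_≼ ε) (flip (at z n) (at w n)) (⊝-≼ h)) (h ε 0<ε)
  where
  flip : ∀ x y → ⊝ (x -ᴳ y) ≡ y -ᴳ x
  flip = solve-∀ 𝔾-ring

∼-trans : ∀ {z w v} → z ∼ w → w ∼ v → z ∼ v
∼-trans {z} {w} {v} (∼-intro h) (∼-intro h′) = ∼-intro λ ε 0<ε → eventually-map
  (λ n (h , h′) → subst₂ _≼_ (chain (at z n) (at w n) (at v n)) (½ε+½ε≡ε ε) (+-≼ h h′))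
  (both (h (½ ℚ.* ε) (0<½ε 0<ε)) (h′ (½ ℚ.* ε) (0<½ε 0<ε)))
  where
  chain : ∀ x y z → (x -ᴳ y) +ᴳ (y -ᴳ z) ≡ x -ᴳ z
  chain = solve-∀ 𝔾-ring

+-cong : ∀ {z z′ w w′} → z ∼ z′ → w ∼ w′ → z + w ∼ z′ + w′
+-cong {z} {z′} {w} {w′} (∼-intro h) (∼-intro h′) = ∼-intro λ ε 0<ε → eventually-map
  (λ n (h , h′) → subst₂ _≼_ (lemma (at z n) (at z′ n) (at w n) (at w′ n)) (½ε+½ε≡ε ε) (+-≼ h h′))
  (both (h (½ ℚ.* ε) (0<½ε 0<ε)) (h′ (½ ℚ.* ε) (0<½ε 0<ε)))
  where
  lemma : ∀ a b c d → (a -ᴳ b) +ᴳ (c -ᴳ d) ≡ (a +ᴳ c) -ᴳ (b +ᴳ d)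
  lemma = solve-∀ 𝔾-ring

-‿cong : ∀ {z w} → z ∼ w → - z ∼ - w
-‿cong {z} {w} (∼-intro h) = ∼-intro λ ε 0<ε → eventually-map
  (λ n h → subst (_≼ ε) (lemma (at z n) (at w n)) (⊝-≼ h)) (h ε 0<ε)
  where
  lemma : ∀ x y → ⊝ (x -ᴳ y) ≡ ⊝ x -ᴳ ⊝ y
  lemma = solve-∀ 𝔾-ring

abstract
  bounded : ∀ z → ∃[ B ] (0ℚ ℚ.< B × Eventually λ n → at z n ≼ B)
  bounded z = B , 0<B , K , λ n K≤n → subst (_≼ B) (add (at z n) (at z K))
    (+-≼ (components-≼ (ℚ.<⇒≤ (proj₂ re-cauchy n K (ℕ.m⊔n≤o⇒m≤o M N K≤n) (ℕ.m≤m⊔n M N)))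
                       (ℚ.<⇒≤ (proj₂ im-cauchy n K (ℕ.m⊔n≤o⇒n≤o M N K≤n) (ℕ.m≤n⊔m M N))))
         (components-≼ ℚ.≤-refl ℚ.≤-refl))
    where
    re-cauchy : ∃[ N ] (∀ m n → N ℕ.≤ m → N ℕ.≤ n → ℚ.∣ seq (re z) m ℚ.- seq (re z) n ∣ ℚ.< 1ℚ)
    re-cauchy = cauchy (re z) 1ℚ 0<1
    im-cauchy : ∃[ N ] (∀ m n → N ℕ.≤ m → N ℕ.≤ n → ℚ.∣ seq (im z) m ℚ.- seq (im z) n ∣ ℚ.< 1ℚ)
    im-cauchy = cauchy (im z) 1ℚ 0<1
    M N K : ℕ
    M = proj₁ re-cauchy
    N = proj₁ im-cauchy
    K = M ℕ.⊔ N
    B : ℚ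
    -- From K on each component moves by less than 1, which accounts for 1 + 1.
    B = (1ℚ ℚ.+ 1ℚ) ℚ.+ (ℚ.∣ seq (re z) K ∣ ℚ.+ ℚ.∣ seq (im z) K ∣)
    0<B : 0ℚ ℚ.< B
    0<B = ℚ.+-mono-<-≤ (ℚ.positive⁻¹ (1ℚ ℚ.+ 1ℚ)) (0≤p+q (ℚ.0≤∣p∣ (seq (re z) K)) (ℚ.0≤∣p∣ (seq (im z) K)))
    add : ∀ x y → (x -ᴳ y) +ᴳ y ≡ x
    add = solve-∀ 𝔾-ring

private abstract
  divide : ∀ {B ε} → 0ℚ ℚ.< B → 0ℚ ℚ.< ε → ∃[ δ ] (0ℚ ℚ.< δ × B ℚ.* δ ≡ ε)
  divide {B} {ε} 0<B 0<ε with reciprocal 0<B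
  ... | r , 0<r , rB≡1 = r ℚ.* ε , 0<p*q 0<r 0<ε , trans (lemma B r ε) (trans (cong (ℚ._* ε) rB≡1) (ℚ.*-identityˡ ε))
    where
    lemma : ∀ b r e → b ℚ.* (r ℚ.* e) ≡ r ℚ.* b ℚ.* e
    lemma = solve-∀ ℚ-ring

*-cong : ∀ {z z′ w w′} → z ∼ z′ → w ∼ w′ → z * w ∼ z′ * w′
*-cong {z} {z′} {w} {w′} (∼-intro h) (∼-intro h′) = ∼-intro λ ε 0<ε →
  let A , 0<A , z≼A   = bounded z
      B , 0<B , w′≼B  = bounded w′
      δ , 0<δ , Aδ    = divide 0<A (0<½ε 0<ε)
      η , 0<η , Bη    = divide 0<B (0<½ε 0<ε)
  in eventually-map
    (λ n ((z≼ , w′≼) , (z-z′≼ , w-w′≼)) → subst₂ _≼_ (lemma (at z n) (at z′ n) (at w n) (at w′ n))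
      (trans (cong₂ ℚ._+_ Aδ Bη) (½ε+½ε≡ε ε)) (+-≼ (*-≼ z≼ w-w′≼) (*-≼ w′≼ z-z′≼)))
    (both (both z≼A w′≼B) (both (h η 0<η) (h′ δ 0<δ)))
  where
  lemma : ∀ a b c d → a *ᴳ (c -ᴳ d) +ᴳ d *ᴳ (a -ᴳ b) ≡ a *ᴳ c -ᴳ b *ᴳ d
  lemma = solve-∀ 𝔾-ring

-- Complex numbers bounded away from zero

Apart : ℂ → Set
Apart z = ∃[ c ] (0ℚ ℚ.< c × Eventually λ n → at z n ≽ c)

apart⇒0<∣∣² : ∀ {z} → Apart z → 0ℝ <ᴿ ∣ z ∣²
-- Half of c² as the gap, because `_<ᴿ_` is strict and c² ≤ |z|² is not.
apart⇒0<∣∣² {z} (c , 0<c , h) = ½ ℚ.* (c ℚ.* c) , 0<½ε 0<c² , eventually-map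
  (λ n z≽c → ℚ.<-≤-trans (subst (ℚ._< c ℚ.* c) (sym (ℚ.+-identityˡ (½ ℚ.* (c ℚ.* c)))) (½ε<ε 0<c²)) (≤normSq z≽c)) h
  where
  0<c² = 0<p*q 0<c 0<c

-- Since c = ε / (1 + ε) satisfies c ≤ ε and c ≤ 1, it satisfies c² ≤ ε.
0<∣∣²⇒apart : ∀ {z} → 0ℝ <ᴿ ∣ z ∣² → Apart z
0<∣∣²⇒apart {z} (ε , 0<ε , h) with reciprocal {1ℚ ℚ.+ ε} (ℚ.+-mono-< 0<1 0<ε)
... | r , 0<r , r[1+ε]≡1 = c , 0<c , eventually-map
  (λ n ε<∣z∣² → ≽-intro (ℚ.<⇒≤ 0<c) (ℚ.≤-trans c²≤ε (ℚ.<⇒≤ (subst (ℚ._< normSq (at z n)) (ℚ.+-identityˡ ε) ε<∣z∣²)))) h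
  where
  c = r ℚ.* ε
  0<c = 0<p*q 0<r 0<ε
  r+c≡1 : r ℚ.+ c ≡ 1ℚ
  r+c≡1 = trans (lemma r ε) r[1+ε]≡1
    where
    lemma : ∀ r e → r ℚ.+ r ℚ.* e ≡ r ℚ.* (1ℚ ℚ.+ e)
    lemma = solve-∀ ℚ-ring
  r≤1 : r ℚ.≤ 1ℚ
  r≤1 = subst₂ ℚ._≤_ (ℚ.+-identityʳ r) r+c≡1 (ℚ.+-monoʳ-≤ r (ℚ.<⇒≤ 0<c))
  c≤1 : c ℚ.≤ 1ℚ
  c≤1 = subst₂ ℚ._≤_ (ℚ.+-identityˡ c) r+c≡1 (ℚ.+-monoˡ-≤ c (ℚ.<⇒≤ 0<r))
  c²≤ε : c ℚ.* c ℚ.≤ ε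
  c²≤ε = subst (c ℚ.* c ℚ.≤_) (trans (ℚ.*-identityˡ (1ℚ ℚ.* ε)) (ℚ.*-identityˡ ε))
    (*-mono-≤ (ℚ.<⇒≤ 0<c) c≤1 (ℚ.<⇒≤ 0<c) (*-mono-≤ (ℚ.<⇒≤ 0<r) r≤1 (ℚ.<⇒≤ 0<ε) ℚ.≤-refl))

apart-* : ∀ {z w} → Apart z → Apart w → Apart (z * w)
apart-* (c , 0<c , h) (d , 0<d , h′) = c ℚ.* d , 0<p*q 0<c 0<d ,
  eventually-map (λ n (z≽c , w≽d) → *-≽ z≽c w≽d) (both h h′)

apart-^ : ∀ {z} → Apart z → ∀ k → Apart (z ^ k)
apart-^ a zero    = 1ℚ , 0<1 , 0 , λ _ _ → 1≽1
apart-^ {z} a (suc k) = apart-* {z} {z ^ k} a (apart-^ a k)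

-- With e = c/2 and d = c/4, |w| ≤ e would give |z| ≤ e + d < c. The case distinction is made on
-- rational approximations, where the order is total.
apart-resp-∼ : ∀ {z w} → z ∼ w → Apart z → Apart w
apart-resp-∼ {z} {w} z∼w (c , 0<c , h) = e , 0<e , eventually-map
  (λ n (z≽c , z-w≼d) → lower n z≽c z-w≼d) (both h (eventually-close z∼w d 0<d))
  where
  e = ½ ℚ.* c
  d = ½ ℚ.* e
  0<e = 0<½ε 0<c
  0<d = 0<½ε 0<e
  e+d<c : e ℚ.+ d ℚ.< c
  e+d<c = subst (e ℚ.+ d ℚ.<_) (½ε+½ε≡ε c) (ℚ.+-monoʳ-< e (½ε<ε 0<e))
  add : ∀ x y → y +ᴳ (x -ᴳ y) ≡ x
  add = solve-∀ 𝔾-ring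
  lower : ∀ n → at z n ≽ c → at z n -ᴳ at w n ≼ d → at w n ≽ e
  lower n (≽-intro _ c²≤) z-w≼d with ℚ.≤-total (e ℚ.* e) (normSq (at w n))
  ... | inj₁ e²≤ = ≽-intro (ℚ.<⇒≤ 0<e) e²≤
  ... | inj₂ ≤e² = ⊥-elim (ℚ.<-irrefl refl (ℚ.<-≤-trans e+d<c (p*p≤q*q⇒p≤q
    (0≤bound z≼) (ℚ.≤-trans c²≤ (normSq≤ z≼)))))
    where
    z≼ : at z n ≼ e ℚ.+ d
    z≼ = subst (_≼ e ℚ.+ d) (add (at z n) (at w n)) (+-≼ {at w n} (≼-intro (ℚ.<⇒≤ 0<e) ≤e²) z-w≼d)

-- The inverse of z is conj z / |z|². The value of 1/ at 0 is irrelevant,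
-- since |z|² is eventually positive.
private
  1/ : ℚ → ℚ
  1/ p with p ℚ.≟ 0ℚ
  ... | yes _  = 0ℚ
  ... | no p≢0 = ℚ.1/_ p {{ℚ.≢-nonZero p≢0}}

  1/-inverse : ∀ {p} → 0ℚ ℚ.< p → 1/ p ℚ.* p ≡ 1ℚ
  1/-inverse {p} 0<p with p ℚ.≟ 0ℚ
  ... | yes refl = ⊥-elim (ℚ.<-irrefl refl 0<p)
  ... | no p≢0   = ℚ.*-inverseˡ p {{ℚ.≢-nonZero p≢0}}

inverse : ∀ {z} → Apart z → ∃[ w ] (w * z ∼ 1ℂ)
inverse {z} (c , 0<c , N , z≽c) = w , close⇒∼ {x = λ _ → 0ℚ} (λ ε 0<ε → 0 , λ _ _ → ℚ.<⇒≤ 0<ε)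
    (N , λ n N≤n → subst (_≼ 0ℚ) (sym (identity n N≤n)) (0≼ ℚ.≤-refl))
  where
  a r : ℕ → ℚ
  a n = normSq (at z n)
  r n = 1/ (a n)

  D : ℚ
  D = proj₁ (reciprocal (0<p*q 0<c 0<c))
  0<D : 0ℚ ℚ.< D
  0<D = proj₁ (proj₂ (reciprocal (0<p*q 0<c 0<c)))
  Dc²≡1 : D ℚ.* (c ℚ.* c) ≡ 1ℚ
  Dc²≡1 = proj₂ (proj₂ (reciprocal (0<p*q 0<c 0<c)))

  0<a : ∀ n → N ℕ.≤ n → 0ℚ ℚ.< a n
  0<a n N≤n = ℚ.<-≤-trans (0<p*q 0<c 0<c) (≤normSq (z≽c n N≤n))

  ra≡1 : ∀ n → N ℕ.≤ n → r n ℚ.* a n ≡ 1ℚ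
  ra≡1 n N≤n = 1/-inverse (0<a n N≤n)

  0≤r : ∀ n → N ℕ.≤ n → 0ℚ ℚ.≤ r n
  0≤r n N≤n = *-cancelʳ-≤ (0<a n N≤n) (subst₂ ℚ._≤_ (sym (ℚ.*-zeroˡ (a n))) (sym (ra≡1 n N≤n)) 0≤1)

  r≤D : ∀ n → N ℕ.≤ n → r n ℚ.≤ D
  r≤D n N≤n = *-cancelʳ-≤ (0<a n N≤n) (ℚ.≤-trans (ℚ.≤-reflexive (trans (ra≡1 n N≤n) (sym Dc²≡1)))
    (ℚ.*-monoˡ-≤-nonNeg D {{ℚ.nonNegative (ℚ.<⇒≤ 0<D)}} (≤normSq (z≽c n N≤n))))

  -- 1/a - 1/a′ = (a′ - a) / (a a′), and both reciprocals are at most `D` = 1/c².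
  r-cauchy : IsCauchy r
  r-cauchy ε 0<ε with divide (0<p*q 0<D 0<D) 0<ε
  ... | δ , 0<δ , D²δ≡ε with cauchy ∣ z ∣² δ 0<δ
  ... | M , h = M ℕ.⊔ N , λ m n le le′ →
    let M≤m = ℕ.m⊔n≤o⇒m≤o M N le
        M≤n = ℕ.m⊔n≤o⇒m≤o M N le′
        N≤m = ℕ.m⊔n≤o⇒n≤o M N le
        N≤n = ℕ.m⊔n≤o⇒n≤o M N le′
        ∣rr∣≡rr = ℚ.0≤p⇒∣p∣≡p (0≤p*q (0≤r m N≤m) (0≤r n N≤n))
    in begin-strict
      ℚ.∣ r m ℚ.- r n ∣                                ≡⟨ cong ℚ.∣_∣ (difference m n N≤m N≤n) ⟩
      ℚ.∣ r m ℚ.* r n ℚ.* (a n ℚ.- a m) ∣              ≡⟨ ℚ.∣p*q∣≡∣p∣*∣q∣ (r m ℚ.* r n) (a n ℚ.- a m) ⟩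
      ℚ.∣ r m ℚ.* r n ∣ ℚ.* ℚ.∣ a n ℚ.- a m ∣          ≡⟨ cong (ℚ._* ℚ.∣ a n ℚ.- a m ∣) ∣rr∣≡rr ⟩
      r m ℚ.* r n ℚ.* ℚ.∣ a n ℚ.- a m ∣                ≤⟨ ℚ.*-monoʳ-≤-nonNeg ℚ.∣ a n ℚ.- a m ∣ {{ℚ.nonNegative (ℚ.0≤∣p∣ (a n ℚ.- a m))}}
                                                            (*-mono-≤ (0≤r m N≤m) (r≤D m N≤m) (0≤r n N≤n) (r≤D n N≤n)) ⟩
      D ℚ.* D ℚ.* ℚ.∣ a n ℚ.- a m ∣                    <⟨ ℚ.*-monoʳ-<-pos (D ℚ.* D) {{ℚ.positive (0<p*q 0<D 0<D)}} (h n m M≤n M≤m) ⟩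
      D ℚ.* D ℚ.* δ                                    ≡⟨ D²δ≡ε ⟩
      ε                                                ∎
    where
    open ℚ.≤-Reasoning
    expand : ∀ r r′ a a′ → r ℚ.* r′ ℚ.* (a′ ℚ.- a) ≡ r ℚ.* (r′ ℚ.* a′) ℚ.- r′ ℚ.* (r ℚ.* a)
    expand = solve-∀ ℚ-ring
    difference : ∀ m n → N ℕ.≤ m → N ℕ.≤ n → r m ℚ.- r n ≡ r m ℚ.* r n ℚ.* (a n ℚ.- a m)
    difference m n N≤m N≤n = sym (trans (expand (r m) (r n) (a m) (a n))
      (cong₂ ℚ._-_ (trans (cong (r m ℚ.*_) (ra≡1 n N≤n)) (ℚ.*-identityʳ (r m)))
                   (trans (cong (r n ℚ.*_) (ra≡1 m N≤m)) (ℚ.*-identityʳ (r n)))))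

  R : ℝ
  R = mkℝ r r-cauchy

  w : ℂ
  w = (re z +i (-ᴿ im z)) * (R +i 0ℝ)

  identity : ∀ n → N ℕ.≤ n → at (w * z) n -ᴳ 1ᴳ ≡ 0ᴳ
  identity n N≤n = trans (cong₂ (λ u v → (u +ⁱ v) -ᴳ 1ᴳ)
      (trans (real (seq (re z) n) (seq (im z) n) (r n)) (ra≡1 n N≤n))
      (imaginary (seq (re z) n) (seq (im z) n) (r n)))
    refl
    where
    real : ∀ x y r → (x ℚ.* r ℚ.+ ℚ.- (ℚ.- y ℚ.* 0ℚ)) ℚ.* x ℚ.+ ℚ.- ((x ℚ.* 0ℚ ℚ.+ ℚ.- y ℚ.* r) ℚ.* y)
      ≡ r ℚ.* (x ℚ.* x ℚ.+ y ℚ.* y)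
    real = solve-∀ ℚ-ring
    imaginary : ∀ x y r → (x ℚ.* r ℚ.+ ℚ.- (ℚ.- y ℚ.* 0ℚ)) ℚ.* y ℚ.+ (x ℚ.* 0ℚ ℚ.+ ℚ.- y ℚ.* r) ℚ.* x ≡ 0ℚ
    imaginary = solve-∀ ℚ-ring

-- Limits

small⇒∣∣²< : ∀ z {ε} → 0ℚ ℚ.< ε → Eventually (λ n → at z n ≼ ½ ℚ.* ε) → ∣ z ∣² <ᴿ fromℚ (ε ℚ.* ε)
small⇒∣∣²< z {ε} 0<ε h = δ , 0<δ , eventually-map
  (λ n z≼ → ℚ.≤-<-trans (ℚ.+-monoˡ-≤ δ (normSq≤ z≼))
    (subst (δ ℚ.+ δ ℚ.<_) (sym (quarter ε)) (subst (ℚ._< (δ ℚ.+ δ) ℚ.+ (δ ℚ.+ δ)) (ℚ.+-identityʳ (δ ℚ.+ δ))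
      (ℚ.+-monoʳ-< (δ ℚ.+ δ) (ℚ.+-mono-< 0<δ 0<δ))))) h
  where
  -- δ = ε²/4 is both the bound of |z|² and the gap required by `_<ᴿ_`, as 2δ < 4δ = ε².
  δ = (½ ℚ.* ε) ℚ.* (½ ℚ.* ε)
  0<δ = 0<p*q (0<½ε 0<ε) (0<½ε 0<ε)
  quarter : ∀ e → e ℚ.* e ≡ ((½ ℚ.* e) ℚ.* (½ ℚ.* e) ℚ.+ (½ ℚ.* e) ℚ.* (½ ℚ.* e)) ℚ.+ ((½ ℚ.* e) ℚ.* (½ ℚ.* e) ℚ.+ (½ ℚ.* e) ℚ.* (½ ℚ.* e))
  quarter = solve-∀ ℚ-ring

-- The diagonal sequence n ↦ Z n at n represents the limit, because the tails
-- are bounded uniformly in the index of the rational approximations.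
module DiagonalLimit {ρ : ℚ} (0≤ρ : 0ℚ ℚ.≤ ρ) (ρ<1 : ρ ℚ.< 1ℚ) (Z : ℕ → ℂ) {B : ℚ} (0≤B : 0ℚ ℚ.≤ B) {N₀ : ℕ}
  (uniform : ∀ n → N₀ ℕ.≤ n → ∀ M k → at (Z (k ℕ.+ M)) n -ᴳ at (Z M) n ≼ B ℚ.* ρ ^ℚ M) where

  open Geometric ρ 0≤ρ ρ<1

  private
    tail : ∀ {M N n} → N₀ ℕ.≤ n → M ℕ.≤ N → at (Z N) n -ᴳ at (Z M) n ≼ B ℚ.* ρ ^ℚ M
    tail {M} {N} {n} N₀≤n M≤N = subst (λ N → at (Z N) n -ᴳ at (Z M) n ≼ B ℚ.* ρ ^ℚ M) (ℕ.m∸n+n≡m M≤N)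
      (uniform n N₀≤n M (N ℕ.∸ M))

    -- Split as ε/4 + ε/4 + ε/2: the index M makes both uniform tails small, and K is the Cauchy
    -- modulus of the single number `Z M`. The projection π is `re` or `im`.
    diagonal : ∀ (π : ℂ → ℝ) →
      (∀ {M m} {c} → at (Z m) m -ᴳ at (Z M) m ≼ c → ℚ.∣ seq (π (Z m)) m ℚ.- seq (π (Z M)) m ∣ ℚ.≤ c) →
      IsCauchy (λ n → seq (π (Z n)) n)
    diagonal π component ε 0<ε = (M ℕ.⊔ N₀) ℕ.⊔ K , λ m n le le′ → begin-strict
        ℚ.∣ x m m ℚ.- x n n ∣
          ≡⟨ cong ℚ.∣_∣ (split (x m m) (x M m) (x M n) (x n n)) ⟩
        ℚ.∣ ((x m m ℚ.- x M m) ℚ.- (x n n ℚ.- x M n)) ℚ.+ (x M m ℚ.- x M n) ∣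
          ≤⟨ ℚ.∣p+q∣≤∣p∣+∣q∣ ((x m m ℚ.- x M m) ℚ.- (x n n ℚ.- x M n)) (x M m ℚ.- x M n) ⟩
        ℚ.∣ (x m m ℚ.- x M m) ℚ.- (x n n ℚ.- x M n) ∣ ℚ.+ ℚ.∣ x M m ℚ.- x M n ∣
          ≤⟨ ℚ.+-monoˡ-≤ ℚ.∣ x M m ℚ.- x M n ∣ (∣p-q∣≤ (x m m ℚ.- x M m) (x n n ℚ.- x M n)) ⟩
        (ℚ.∣ x m m ℚ.- x M m ∣ ℚ.+ ℚ.∣ x n n ℚ.- x M n ∣) ℚ.+ ℚ.∣ x M m ℚ.- x M n ∣
          <⟨ ℚ.+-mono-≤-< (ℚ.+-mono-≤ (near le) (near le′)) (h m n (ℕ.m⊔n≤o⇒n≤o (M ℕ.⊔ N₀) K le) (ℕ.m⊔n≤o⇒n≤o (M ℕ.⊔ N₀) K le′)) ⟩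
        (½ ℚ.* (½ ℚ.* ε) ℚ.+ ½ ℚ.* (½ ℚ.* ε)) ℚ.+ ½ ℚ.* ε
          ≡⟨ trans (cong (ℚ._+ ½ ℚ.* ε) (½ε+½ε≡ε (½ ℚ.* ε))) (½ε+½ε≡ε ε) ⟩
        ε ∎
      where
      open ℚ.≤-Reasoning
      small : Eventually λ M → B ℚ.* ρ ^ℚ M ℚ.≤ ½ ℚ.* (½ ℚ.* ε)
      small = null-* B 0≤B null-ρ^ (½ ℚ.* (½ ℚ.* ε)) (0<½ε (0<½ε 0<ε))
      M K : ℕ
      M = proj₁ small
      K = proj₁ (cauchy (π (Z M)) (½ ℚ.* ε) (0<½ε 0<ε))
      h = proj₂ (cauchy (π (Z M)) (½ ℚ.* ε) (0<½ε 0<ε))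
      x : ℕ → ℕ → ℚ
      x M m = seq (π (Z M)) m
      near : ∀ {m} → (M ℕ.⊔ N₀) ℕ.⊔ K ℕ.≤ m → ℚ.∣ x m m ℚ.- x M m ∣ ℚ.≤ ½ ℚ.* (½ ℚ.* ε)
      near {m} le = ℚ.≤-trans (component (tail (ℕ.m⊔n≤o⇒n≤o M N₀ (ℕ.m⊔n≤o⇒m≤o (M ℕ.⊔ N₀) K le))
        (ℕ.m⊔n≤o⇒m≤o M N₀ (ℕ.m⊔n≤o⇒m≤o (M ℕ.⊔ N₀) K le)))) (proj₂ small M ℕ.≤-refl)
      split : ∀ a b c d → a ℚ.- d ≡ ((a ℚ.- b) ℚ.- (d ℚ.- c)) ℚ.+ (b ℚ.- c)
      split = solve-∀ ℚ-ring
      ∣p-q∣≤ : ∀ p q → ℚ.∣ p ℚ.- q ∣ ℚ.≤ ℚ.∣ p ∣ ℚ.+ ℚ.∣ q ∣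
      ∣p-q∣≤ p q = ℚ.≤-trans (ℚ.∣p+q∣≤∣p∣+∣q∣ p (ℚ.- q)) (ℚ.≤-reflexive (cong (ℚ.∣ p ∣ ℚ.+_) (ℚ.∣-p∣≡∣p∣ q)))

  limit : ℂ
  limit = mkℝ (λ n → seq (re (Z n)) n) (diagonal re ∣reᴳ∣≤)
       +i mkℝ (λ n → seq (im (Z n)) n) (diagonal im ∣imᴳ∣≤)

  limit-close : ∀ ε → 0ℚ ℚ.< ε → Eventually λ N → Eventually λ n → at (Z N) n -ᴳ at limit n ≼ ε
  limit-close ε 0<ε = proj₁ small , λ N M≤N → N ℕ.⊔ N₀ , λ n le →
    ≼-mono (proj₂ small N M≤N) (subst (_≼ B ℚ.* ρ ^ℚ N) (flip (at (Z n) n) (at (Z N) n))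
      (⊝-≼ (tail (ℕ.m⊔n≤o⇒n≤o N N₀ le) (ℕ.m⊔n≤o⇒m≤o N N₀ le))))
    where
    small : Eventually λ M → B ℚ.* ρ ^ℚ M ℚ.≤ ε
    small = null-* B 0≤B null-ρ^ ε 0<ε
    flip : ∀ x y → ⊝ (x -ᴳ y) ≡ y -ᴳ x
    flip = solve-∀ 𝔾-ring

-- |w| = |wz| / |z| with |z| bounded above. It yields that the quotient in `Y` is nonzero because
-- its numerator is.
apart-factor : ∀ {w z} → Apart (w * z) → Apart w
apart-factor {w} {z} wz# = c ℚ.* r , 0<p*q 0<c 0<r ,
  eventually-map (λ n (z≼ , wz≽) → lower n z≼ wz≽) (both (proj₂ (proj₂ (bounded z))) (proj₂ (proj₂ wz#)))
  where
  B c r : ℚ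
  B = proj₁ (bounded z)
  c = proj₁ wz#
  0<B : 0ℚ ℚ.< B
  0<B = proj₁ (proj₂ (bounded z))
  0<c : 0ℚ ℚ.< c
  0<c = proj₁ (proj₂ wz#)
  r = proj₁ (reciprocal 0<B)
  0<r : 0ℚ ℚ.< r
  0<r = proj₁ (proj₂ (reciprocal 0<B))
  lemma : ∀ c r b → c ℚ.* r ℚ.* (c ℚ.* r) ℚ.* (b ℚ.* b) ≡ c ℚ.* c ℚ.* (r ℚ.* b ℚ.* (r ℚ.* b))
  lemma = solve-∀ ℚ-ring
  lower : ∀ n → at z n ≼ B → at (w * z) n ≽ c → at w n ≽ c ℚ.* r
  lower n z≼ wz≽ = ≽-intro (ℚ.<⇒≤ (0<p*q 0<c 0<r)) (*-cancelʳ-≤ (0<p*q 0<B 0<B) (begin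
    c ℚ.* r ℚ.* (c ℚ.* r) ℚ.* (B ℚ.* B)    ≡⟨ lemma c r B ⟩
    c ℚ.* c ℚ.* (r ℚ.* B ℚ.* (r ℚ.* B))    ≡⟨ cong (λ t → c ℚ.* c ℚ.* (t ℚ.* t)) (proj₂ (proj₂ (reciprocal 0<B))) ⟩
    c ℚ.* c ℚ.* (1ℚ ℚ.* 1ℚ)                ≡⟨ ℚ.*-identityʳ (c ℚ.* c) ⟩
    c ℚ.* c                                ≤⟨ ≤normSq wz≽ ⟩
    normSq (at w n *ᴳ at z n)              ≡⟨ normSq-* (at w n) (at z n) ⟩
    normSq (at w n) ℚ.* normSq (at z n)    ≤⟨ ℚ.*-monoˡ-≤-nonNeg (normSq (at w n)) {{ℚ.nonNegative (0≤normSq (at w n))}} (normSq≤ z≼) ⟩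
    normSq (at w n) ℚ.* (B ℚ.* B)          ∎))
    where open ℚ.≤-Reasoning

-- The ring of complex numbers and the algebra of the theorem

ℂ-isCommutativeRing : IsCommutativeRing _∼_ _+_ _*_ -_ 0ℂ 1ℂ
ℂ-isCommutativeRing = record
  { isRing = record
    { +-isAbelianGroup = record
      { isGroup = record
        { isMonoid = record
          { isSemigroup = record
            { isMagma = record
              { isEquivalence = record { refl = ∼-refl ; sym = ∼-sym ; trans = ∼-trans }
              ; ∙-cong = +-cong }
            ; assoc = λ x y z → pointwise λ n → 𝔾ᵣ.+-assoc (at x n) (at y n) (at z n) }
          ; identity = (λ x → pointwise λ n → 𝔾ᵣ.+-identityˡ (at x n))
                     , (λ x → pointwise λ n → 𝔾ᵣ.+-identityʳ (at x n)) }
        ; inverse = (λ x → pointwise λ n → 𝔾ᵣ.-‿inverseˡ (at x n))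
                  , (λ x → pointwise λ n → 𝔾ᵣ.-‿inverseʳ (at x n))
        ; ⁻¹-cong = -‿cong }
      ; comm = λ x y → pointwise λ n → 𝔾ᵣ.+-comm (at x n) (at y n) }
    ; *-cong = *-cong
    ; *-assoc = λ x y z → pointwise λ n → 𝔾ᵣ.*-assoc (at x n) (at y n) (at z n)
    ; *-identity = (λ x → pointwise λ n → 𝔾ᵣ.*-identityˡ (at x n))
                 , (λ x → pointwise λ n → 𝔾ᵣ.*-identityʳ (at x n))
    ; distrib = (λ x y z → pointwise λ n → 𝔾ᵣ.distribˡ (at x n) (at y n) (at z n))
              , (λ x y z → pointwise λ n → 𝔾ᵣ.distribʳ (at x n) (at y n) (at z n)) }
  ; *-comm = λ x y → pointwise λ n → 𝔾ᵣ.*-comm (at x n) (at y n)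
  }

ℂ-commutativeRing : CommutativeRing 0ℓ 0ℓ
ℂ-commutativeRing = record { isCommutativeRing = ℂ-isCommutativeRing }

module KeyIdentity {a b} (R : CommutativeRing a b) where
  private
    module R = CommutativeRing R
    open R using (Carrier) renaming (_≈_ to infix 4 _≃_; _+_ to infixl 6 _∔_; _*_ to infixl 7 _·_; 1# to 𝟙; -_ to infix 8 ∸_)
    open SetoidReasoning R.setoid

    -- With e in place of ±1 no subtraction occurs, so a semiring identity covers the sum and the
    -- difference.
    lemma : ∀ e x u w c d → (x ∔ e · (u · w)) · (u · (c · (w · d) · (c · d))) ≃
      x · (u · w) · (c · d · (c · d)) ∔ e · (u · u) · (c · (w · d) · (c · (w · d)))
    lemma = solve 6 (λ e x u w c d →
      (x :+ e :* (u :* w)) :* (u :* (c :* (w :* d) :* (c :* d))) :=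
      x :* (u :* w) :* (c :* d :* (c :* d)) :+ e :* (u :* u) :* (c :* (w :* d) :* (c :* (w :* d)))) R.refl
      where open import Algebra.Solver.Ring.NaturalCoefficients.Default R.commutativeSemiring

  divide-inverse : ∀ x {y w} → w · y ≃ 𝟙 → w · x · y ≃ x
  divide-inverse x {y} {w} wy≃1 = begin
    w · x · y    ≈⟨ R.*-congʳ (R.*-comm w x) ⟩
    x · w · y    ≈⟨ R.*-assoc x w y ⟩
    x · (w · y)  ≈⟨ R.*-congˡ wy≃1 ⟩
    x · 𝟙        ≈⟨ R.*-identityʳ x ⟩
    x            ∎

  -- With y = u w the value of Y, this computes (1/y ± y) · (u ψ g), e being ±1.
  key-identity : ∀ e {x u w c v d t₁ t₂ ψ g} → x · (u · w) ≃ 𝟙 → w · d ≃ v →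
    c · d ≃ t₁ → c · v ≃ t₂ → ψ · g ≃ t₂ · t₁ →
    (x ∔ e · (u · w)) · (u · ψ · g) ≃ t₁ · t₁ ∔ e · (u · u) · (t₂ · t₂)
  key-identity e {x} {u} {w} {c} {v} {d} {t₁} {t₂} {ψ} {g} x[uw]≃1 wd≃v cd≃t₁ cv≃t₂ ψg≃ = begin
    (x ∔ e · (u · w)) · (u · ψ · g)                       ≈⟨ R.*-congˡ (R.*-assoc u ψ g) ⟩
    (x ∔ e · (u · w)) · (u · (ψ · g))                     ≈⟨ R.*-congˡ (R.*-congˡ (R.trans ψg≃ (R.*-cong (R.sym c[wd]≃t₂) (R.sym cd≃t₁)))) ⟩
    (x ∔ e · (u · w)) · (u · (c · (w · d) · (c · d)))     ≈⟨ lemma e x u w c d ⟩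
    x · (u · w) · (c · d · (c · d)) ∔ e · (u · u) · (c · (w · d) · (c · (w · d)))
                                                          ≈⟨ R.+-cong (R.*-cong x[uw]≃1 (R.*-cong cd≃t₁ cd≃t₁)) (R.*-congˡ (R.*-cong c[wd]≃t₂ c[wd]≃t₂)) ⟩
    𝟙 · (t₁ · t₁) ∔ e · (u · u) · (t₂ · t₂)               ≈⟨ R.+-congʳ (R.*-identityˡ (t₁ · t₁)) ⟩
    t₁ · t₁ ∔ e · (u · u) · (t₂ · t₂)                     ∎
    where
    c[wd]≃t₂ : c · (w · d) ≃ t₂
    c[wd]≃t₂ = R.trans (R.*-congˡ wd≃v) cv≃t₂

open KeyIdentity ℂ-commutativeRing

abstract
  quotient : ∀ x {y} → Apart y → ∃[ z ] (z * y ∼ x)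
  quotient x {y} y# = proj₁ (inverse y#) * x , divide-inverse x {y} {proj₁ (inverse y#)} (proj₂ (inverse y#))

1ᴳ^ : ∀ k → 1ᴳ ^ᴳ k ≡ 1ᴳ
1ᴳ^ zero    = refl
1ᴳ^ (suc k) = trans (𝔾ᵣ.*-identityˡ (1ᴳ ^ᴳ k)) (1ᴳ^ k)

-- Convergence of q-products and theta series in the disc

module Disc (q : ℂ) {ρ : ℚ} (0≤ρ : 0ℚ ℚ.≤ ρ) (ρ<1 : ρ ℚ.< 1ℚ) (q≼ρ : Eventually λ n → at q n ≼ ρ) where
  open Estimates ρ 0≤ρ ρ<1

  private
    N₀ : ℕ
    N₀ = proj₁ q≼ρ

  at-q^ : ∀ k n → at (q ^ k) n ≡ at q n ^ᴳ k
  at-q^ = at-^ q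

  at-q^* : ∀ a d j n → at (q ^ a * (q ^ d) ^ j) n ≡ at q n ^ᴳ a *ᴳ (at q n ^ᴳ d) ^ᴳ j
  at-q^* a d j n = cong₂ _*ᴳ_ (at-q^ a n) (trans (at-^ (q ^ d) j n) (cong (_^ᴳ j) (at-q^ d n)))

  abstract
    -- The j-th factor is 1 - q^(a+dj) with a + dj ≥ j + 1, so the uniform bounds apply. The values
    -- along the diagonal are recorded because the later identities are checked on them.
    qPoch-exists : ∀ a d → 1 ≤ a → 1 ≤ d → ∃[ P ] (qPoch (q ^ a) (q ^ d) P × Apart P ×
      (∀ n → at P n ≡ Πᴳ n (λ j → 1ᴳ -ᴳ at q n ^ᴳ a *ᴳ (at q n ^ᴳ d) ^ᴳ j)))
    qPoch-exists a d 1≤a 1≤d = limit , converges , (c , 0<c , N₀ , λ n N₀≤n → subst (_≽ c) (sym (at-Z n n)) (Π[1-w]≽c (small n N₀≤n) n)) , λ n → at-Z n n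
      where
      w : ℕ → ℕ → 𝔾
      w n j = at q n ^ᴳ a *ᴳ (at q n ^ᴳ d) ^ᴳ j

      small : ∀ n → N₀ ≤ n → ∀ j → w n j ≼ ρ ^ℚ suc j
      small n N₀≤n j = ≼-mono (ρ^-anti 1+j≤a+dj) (subst (_≼ ρ ^ℚ (a +ℕ d *ℕ j)) power (^-≼ (proj₂ q≼ρ n N₀≤n) (a +ℕ d *ℕ j)))
        where
        power : at q n ^ᴳ (a +ℕ d *ℕ j) ≡ w n j
        power = trans (^-homo-* (at q n) a (d *ℕ j)) (cong (at q n ^ᴳ a *ᴳ_) (sym (^-assocʳ (at q n) d j)))
        1+j≤a+dj : suc j ≤ a +ℕ d *ℕ j
        1+j≤a+dj = ℕ.+-mono-≤ 1≤a (ℕ.≤-trans (ℕ.≤-reflexive (sym (ℕ.*-identityˡ j))) (ℕ.*-monoˡ-≤ j 1≤d))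

      Z : ℕ → ℂ
      Z N = product {N} (λ j → 1ℂ - q ^ a * (q ^ d) ^ toℕ j)

      at-Z : ∀ N n → at (Z N) n ≡ Πᴳ N (λ j → 1ᴳ -ᴳ w n j)
      at-Z N n = trans (at-product (λ j → 1ℂ - q ^ a * (q ^ d) ^ j) N n)
        (Πᴳ-cong N (λ j → cong (λ t → 1ᴳ -ᴳ t) (at-q^* a d j n)))

      open DiagonalLimit 0≤ρ ρ<1 Z (0≤p*q 0≤B 0≤κ) {N₀} (λ n N₀≤n M k →
        subst₂ (λ s t → s -ᴳ t ≼ B ℚ.* κ ℚ.* ρ ^ℚ M) (sym (at-Z (k +ℕ M) n)) (sym (at-Z M n)) (Π[1-w]-cauchy (small n N₀≤n) M k))

      converges : qPoch (q ^ a) (q ^ d) limit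
      converges ε 0<ε = eventually-map (λ N h → small⇒∣∣²< (Z N - limit) 0<ε h) (limit-close (½ ℚ.* ε) (0<½ε 0<ε))

  private
    module Series (t : ℕ → ℂ) (t≼ : ∀ n → N₀ ≤ n → ∀ j → at (t j) n ≼ ρ ^ℚ j) where
      Z : ℕ → ℂ
      Z N = sum {N} (λ j → t (toℕ j))

      at-Z : ∀ N n → at (Z N) n ≡ Σᴳ N (λ j → at (t j) n)
      at-Z = at-sum t

      step : ∀ n → N₀ ≤ n → ∀ j → at (Z (suc j)) n -ᴳ at (Z j) n ≼ 1ℚ ℚ.* ρ ^ℚ j
      step n N₀≤n j = subst₂ _≼_ difference (sym (ℚ.*-identityˡ (ρ ^ℚ j))) (t≼ n N₀≤n j)
        where
        lemma : ∀ s x → x ≡ s +ᴳ x -ᴳ s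
        lemma = solve-∀ 𝔾-ring
        difference : at (t j) n ≡ at (Z (suc j)) n -ᴳ at (Z j) n
        difference = trans (lemma (Σᴳ j (λ j → at (t j) n)) (at (t j) n))
          (cong₂ _-ᴳ_ (sym (trans (at-Z (suc j) n) (Σᴳ-last j (λ j → at (t j) n)))) (sym (at-Z j n)))

      open DiagonalLimit 0≤ρ ρ<1 Z (0≤p*q 0≤1 0≤κ) {N₀} (λ n N₀≤n →
        telescope (λ N → at (Z N) n) 1ℚ 0≤1 (step n N₀≤n)) public

  abstract
    -- ς = ±1 is the common sign of the two arguments and σ the resulting sign of the terms. The two
    -- halves of the series converge separately, so their ends may move independently, as `∑ℤ`
    -- demands.
    f-exists : ∀ {x y} (σ : ℤ → 𝔾) (ς : 𝔾) α γ → 1 ≤ α → 1 ≤ γ →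
      (∀ n → at x n ≡ ς *ᴳ at q n ^ᴳ α) → (∀ n → at y n ≡ ς *ᴳ at q n ^ᴳ γ) →
      (∀ j → σ j ≼ 1ℚ) → (∀ j → ς ^ᴳ (tri⁺ j +ℕ tri⁻ j) ≡ σ j) →
      ∃[ F ] (f x y F × (∀ n → at F n ≡ θ (at q n) σ (degree α γ) n))
    f-exists {x} {y} σ ς α γ 1≤α 1≤γ at-x at-y σ≼1 σ≡ = P.limit + Q.limit , converges , at-value
      where
      t : ℤ → ℂ
      t j = x ^ (ℤ.∣ j ℤ.* (j ℤ.+ ℤ.1ℤ) ∣ ℕ./ 2) * y ^ (ℤ.∣ j ℤ.* (j ℤ.- ℤ.1ℤ) ∣ ℕ./ 2)

      at-power : ∀ z k n β → (∀ n → at z n ≡ ς *ᴳ at q n ^ᴳ β) → at (z ^ k) n ≡ ς ^ᴳ k *ᴳ at q n ^ᴳ (β *ℕ k)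
      at-power z k n β at-z = trans (at-^ z k n) (trans (cong (_^ᴳ k) (at-z n))
        (trans (^-distrib-* ς (at q n ^ᴳ β) k) (cong (ς ^ᴳ k *ᴳ_) (^-assocʳ (at q n) β k))))

      at-t : ∀ j n → at (t j) n ≡ monomial (at q n) σ (degree α γ) j
      at-t j n = begin
        at (t j) n
          ≡⟨ cong₂ (λ k l → at (x ^ k * y ^ l) n) (tri⁺-correct j) (tri⁻-correct j) ⟩
        at (x ^ tri⁺ j) n *ᴳ at (y ^ tri⁻ j) n
          ≡⟨ cong₂ _*ᴳ_ (at-power x (tri⁺ j) n α at-x) (at-power y (tri⁻ j) n γ at-y) ⟩
        ς ^ᴳ tri⁺ j *ᴳ at q n ^ᴳ (α *ℕ tri⁺ j) *ᴳ (ς ^ᴳ tri⁻ j *ᴳ at q n ^ᴳ (γ *ℕ tri⁻ j))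
          ≡⟨ interchange (ς ^ᴳ tri⁺ j) (at q n ^ᴳ (α *ℕ tri⁺ j)) (ς ^ᴳ tri⁻ j) (at q n ^ᴳ (γ *ℕ tri⁻ j)) ⟩
        ς ^ᴳ tri⁺ j *ᴳ ς ^ᴳ tri⁻ j *ᴳ (at q n ^ᴳ (α *ℕ tri⁺ j) *ᴳ at q n ^ᴳ (γ *ℕ tri⁻ j))
          ≡⟨ cong₂ _*ᴳ_ (trans (sym (^-homo-* ς (tri⁺ j) (tri⁻ j))) (σ≡ j)) (sym (^-homo-* (at q n) (α *ℕ tri⁺ j) (γ *ℕ tri⁻ j))) ⟩
        monomial (at q n) σ (degree α γ) j ∎
        where
        open ≡-Reasoning
        interchange : ∀ a b c d → a *ᴳ b *ᴳ (c *ᴳ d) ≡ a *ᴳ c *ᴳ (b *ᴳ d)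
        interchange = solve-∀ 𝔾-ring

      t≼ : ∀ n → N₀ ≤ n → ∀ j → at (t j) n ≼ ρ ^ℚ ℤ.∣ j ∣
      t≼ n N₀≤n j = subst (_≼ ρ ^ℚ ℤ.∣ j ∣) (sym (at-t j n))
        (Reindexing.monomial-≼ ρ 0≤ρ ρ<1 (proj₂ q≼ρ n N₀≤n) σ (degree α γ) σ≼1 j (∣j∣≤degree 1≤α 1≤γ j))

      module P = Series (λ k → t (ℤ.+ k)) (λ n N₀≤n k → t≼ n N₀≤n (ℤ.+ k))
      module Q = Series (λ k → t -[1+ k ]) (λ n N₀≤n k → ≼-mono (ρ^-anti (ℕ.n≤1+n k)) (t≼ n N₀≤n -[1+ k ]))

      converges : f x y (P.limit + Q.limit)
      converges ε 0<ε =
        let M , p = P.limit-close (½ ℚ.* (½ ℚ.* ε)) (0<½ε (0<½ε 0<ε))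
            N , r = Q.limit-close (½ ℚ.* (½ ℚ.* ε)) (0<½ε (0<½ε 0<ε))
        in M ℕ.⊔ N , λ m n le le′ → small⇒∣∣²< ((P.Z n + Q.Z m) - (P.limit + Q.limit)) 0<ε
          (eventually-map (λ k (h , h′) → subst₂ _≼_ (lemma (at (P.Z n) k) (at P.limit k) (at (Q.Z m) k) (at Q.limit k)) (½ε+½ε≡ε (½ ℚ.* ε)) (+-≼ h h′))
            (both (p n (ℕ.m⊔n≤o⇒m≤o M N le′)) (r m (ℕ.m⊔n≤o⇒n≤o M N le))))
        where
        lemma : ∀ a b c d → (a -ᴳ b) +ᴳ (c -ᴳ d) ≡ (a +ᴳ c) -ᴳ (b +ᴳ d)
        lemma = solve-∀ 𝔾-ring

      at-value : ∀ n → at (P.limit + Q.limit) n ≡ θ (at q n) σ (degree α γ) n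
      at-value n = trans (cong₂ _+ᴳ_
          (trans (P.at-Z n n) (Σᴳ-cong n (λ k _ → at-t (ℤ.+ k) n)))
          (trans (Q.at-Z n n) (Σᴳ-cong n (λ k _ → at-t -[1+ k ] n))))
        (sym (sumᴸ-window (monomial (at q n) σ (degree α γ)) n))

  f⁺-exists : ∀ {x y} α γ → 1 ≤ α → 1 ≤ γ →
    (∀ n → at x n ≡ at q n ^ᴳ α) → (∀ n → at y n ≡ at q n ^ᴳ γ) →
    ∃[ F ] (f x y F × (∀ n → at F n ≡ θ (at q n) 𝟏 (degree α γ) n))
  f⁺-exists α γ 1≤α 1≤γ at-x at-y = f-exists 𝟏 1ᴳ α γ 1≤α 1≤γ
    (λ n → trans (at-x n) (sym (𝔾ᵣ.*-identityˡ (at q n ^ᴳ α)))) (λ n → trans (at-y n) (sym (𝔾ᵣ.*-identityˡ (at q n ^ᴳ γ))))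
    (λ _ → 1≼1) (λ j → 1ᴳ^ (tri⁺ j +ℕ tri⁻ j))

  f⁻-exists : ∀ {x y} α γ → 1 ≤ α → 1 ≤ γ →
    (∀ n → at x n ≡ at q n ^ᴳ α) → (∀ n → at y n ≡ at q n ^ᴳ γ) →
    ∃[ F ] (f (- x) (- y) F × (∀ n → at F n ≡ θ (at q n) χ (degree α γ) n))
  f⁻-exists α γ 1≤α 1≤γ at-x at-y = f-exists χ (⊝ 1ᴳ) α γ 1≤α 1≤γ
    (λ n → trans (cong ⊝_ (at-x n)) (negate (at q n ^ᴳ α))) (λ n → trans (cong ⊝_ (at-y n)) (negate (at q n ^ᴳ γ)))
    χ≼1 χ-tri
    where
    negate : ∀ x → ⊝ x ≡ ⊝ 1ᴳ *ᴳ x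
    negate = solve-∀ 𝔾-ring

  ∼-from-ε : ∀ {z w} K → 0ℚ ℚ.≤ K → (∀ n → N₀ ≤ n → at z n -ᴳ at w n ≼ K ℚ.* ε n) → z ∼ w
  ∼-from-ε K 0≤K h = close⇒∼ (null-* K 0≤K null-ε) (N₀ , h)

  jacobi : ∀ {a c} → 1 ≤ a → 1 ≤ c → ∀ {C P Q F} →
    (∀ n → at C n ≡ qfac (at q n ^ᴳ (a +ℕ c)) n) →
    (∀ n → at P n ≡ Πᴳ n (λ j → 1ᴳ -ᴳ at q n ^ᴳ a *ᴳ (at q n ^ᴳ (a +ℕ c)) ^ᴳ j)) →
    (∀ n → at Q n ≡ Πᴳ n (λ j → 1ᴳ -ᴳ at q n ^ᴳ c *ᴳ (at q n ^ᴳ (a +ℕ c)) ^ᴳ j)) →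
    (∀ n → at F n ≡ θ (at q n) χ (degree a c) n) →
    C * (P * Q) ∼ F
  jacobi {a} {c} 1≤a 1≤c at-C at-P at-Q at-F = ∼-from-ε K₃ 0≤K₃ λ n N₀≤n →
    subst₂ (λ s t → s -ᴳ t ≼ K₃ ℚ.* ε n) (sym (cong₂ _*ᴳ_ (at-C n) (cong₂ _*ᴳ_ (at-P n) (at-Q n)))) (sym (at-F n))
      (JacobiTripleProduct.jacobi-close ρ 0≤ρ ρ<1 (proj₂ q≼ρ n N₀≤n) a c 1≤a 1≤c n)

-- |q|² < 1 - ε ≤ (1 - ε/2)²
abstract
  radius : ∀ q → ∣ q ∣² <ᴿ 1ℝ → ∃[ ρ ] (0ℚ ℚ.≤ ρ × ρ ℚ.< 1ℚ × Eventually λ n → at q n ≼ ρ)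
  radius q (ε , 0<ε , N , h) = ρ , 0≤ρ , ρ<1 , N , λ n N≤n → ≼-intro 0≤ρ (bound n N≤n)
    where
    ρ : ℚ
    ρ = 1ℚ ℚ.- ½ ℚ.* ε
    ε<1 : ε ℚ.< 1ℚ
    ε<1 = ℚ.≤-<-trans (subst (ℚ._≤ normSq (at q N) ℚ.+ ε) (ℚ.+-identityˡ ε) (ℚ.+-monoˡ-≤ ε (0≤normSq (at q N)))) (h N ℕ.≤-refl)
    0≤ρ : 0ℚ ℚ.≤ ρ
    0≤ρ = p≤q⇒0≤q-p (ℚ.<⇒≤ (ℚ.<-trans (½ε<ε 0<ε) ε<1))
    ρ<1 : ρ ℚ.< 1ℚ
    ρ<1 = subst (ρ ℚ.<_) (ℚ.+-identityʳ 1ℚ) (ℚ.+-monoʳ-< 1ℚ (ℚ.neg-antimono-< (0<½ε 0<ε)))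
    square-ρ : ∀ e → (1ℚ ℚ.- ½ ℚ.* e) ℚ.* (1ℚ ℚ.- ½ ℚ.* e) ≡ (1ℚ ℚ.- e) ℚ.+ (½ ℚ.* e) ℚ.* (½ ℚ.* e)
    square-ρ = solve-∀ ℚ-ring
    cancel : ∀ x e → x ℚ.+ e ℚ.- e ≡ x
    cancel = solve-∀ ℚ-ring
    bound : ∀ n → N ≤ n → normSq (at q n) ℚ.≤ ρ ℚ.* ρ
    bound n N≤n = begin
      normSq (at q n)                                 ≡⟨ cancel (normSq (at q n)) ε ⟨
      normSq (at q n) ℚ.+ ε ℚ.- ε                     ≤⟨ ℚ.+-monoˡ-≤ (ℚ.- ε) (ℚ.<⇒≤ (h n N≤n)) ⟩
      1ℚ ℚ.- ε                                        ≡⟨ ℚ.+-identityʳ (1ℚ ℚ.- ε) ⟨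
      1ℚ ℚ.- ε ℚ.+ 0ℚ                                 ≤⟨ ℚ.+-monoʳ-≤ (1ℚ ℚ.- ε) (0≤p*p (½ ℚ.* ε)) ⟩
      1ℚ ℚ.- ε ℚ.+ (½ ℚ.* ε) ℚ.* (½ ℚ.* ε)            ≡⟨ square-ρ ε ⟨
      ρ ℚ.* ρ                                         ∎
      where open ℚ.≤-Reasoning

≈-refl : ∀ z → z ≈ z
≈-refl z = ∼⇒≈ (∼-refl {z})

-- The two identities for `Y`

module Order76 (q : ℂ) (q# : Apart q) {ρ : ℚ} (0≤ρ : 0ℚ ℚ.≤ ρ) (ρ<1 : ρ ℚ.< 1ℚ) (q≼ρ : Eventually λ k → at q k ≼ ρ)
  (n : ℕ) (1≤n : 1 ≤ n) (n≤9 : n ≤ 9) where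
  open Disc q 0≤ρ ρ<1 q≼ρ

  α m : ℕ
  α = 19 ∸ 2 *ℕ n
  m = 2 *ℕ n

  private
    m≤18 : m ≤ 18
    m≤18 = ℕ.*-monoʳ-≤ 2 n≤9
    m≤19 : m ≤ 19
    m≤19 = ℕ.m≤n⇒m≤1+n m≤18
    1≤m : 1 ≤ m
    1≤m = ℕ.≤-trans 1≤n (ℕ.m≤m+n n (n +ℕ 0))
    1≤α : 1 ≤ α
    1≤α = ℕ.m+n≤o⇒m≤o∸n 1 (ℕ.s≤s m≤18)

  open Exponents α m
  open Estimates ρ 0≤ρ ρ<1

  private
    1≤s : 1 ≤ s
    1≤s = 1≤+ m 1≤α

    -- As n is a variable, (19 ∸ 2n) + 2n is 19 only by proof. The exponents of the theorem are
    -- translated here, once, into those of `Exponents`.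
    19≡s : 19 ≡ s
    19≡s = sym (ℕ.m∸n+n≡m m≤19)
    38≡ : 38 ≡ s +ℕ s
    38≡ = cong₂ _+ℕ_ 19≡s 19≡s
    38-m≡ : 38 ∸ m ≡ s +ℕ α
    38-m≡ = trans (ℕ.+-∸-assoc 19 m≤19) (cong (_+ℕ α) 19≡s)
    57-m≡ : 57 ∸ m ≡ s +ℕ s +ℕ α
    57-m≡ = trans (ℕ.+-∸-assoc 38 m≤19) (cong (_+ℕ α) 38≡)
    57+m≡ : 57 +ℕ m ≡ s +ℕ s +ℕ s +ℕ m
    57+m≡ = cong₂ (λ a b → a +ℕ b +ℕ m) {38} {s +ℕ s} {19} {s} 38≡ 19≡s
    19+m≡ : 19 +ℕ m ≡ s +ℕ m
    19+m≡ = cong (_+ℕ m) 19≡s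
    -- In the numerator of `Y` as in the denominator the two exponents add up to 76, so the base in
    -- Jacobi's identity is q^76 for both.
    76≡₂ : 76 ≡ α +ℕ (s +ℕ s +ℕ s +ℕ m)
    76≡₂ = trans (cong₂ _+ℕ_ 19≡s (cong₂ _+ℕ_ 38≡ 19≡s)) (lemma α m (s +ℕ s +ℕ s))
      where
      lemma : ∀ a m t → (a +ℕ m) +ℕ t ≡ a +ℕ (t +ℕ m)
      lemma = ℕSolver.solve-∀
    76≡₁ : 76 ≡ (s +ℕ m) +ℕ (s +ℕ s +ℕ α)
    76≡₁ = trans (cong₂ _+ℕ_ 19≡s (cong₂ _+ℕ_ 38≡ 19≡s)) (lemma α m s (s +ℕ s))
      where
      lemma : ∀ a m s t → s +ℕ (t +ℕ (a +ℕ m)) ≡ (s +ℕ m) +ℕ (t +ℕ a)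
      lemma = ℕSolver.solve-∀

    at-q^≡ : ∀ {a b} → a ≡ b → ∀ k → at (q ^ a) k ≡ at q k ^ᴳ b
    at-q^≡ {a} refl = at-q^ a

    IsProduct : ℂ → ℕ → ℕ → Set
    IsProduct P a d = ∀ k → at P k ≡ Πᴳ k (λ j → 1ᴳ -ᴳ at q k ^ᴳ a *ᴳ (at q k ^ᴳ d) ^ᴳ j)

    1≤76 : 1 ≤ 76
    1≤76 = ℕ.s≤s ℕ.z≤n

    C-ex = qPoch-exists 76 76 1≤76 1≤76
    P₂-ex = qPoch-exists α 76 1≤α 1≤76
    Q₂-ex = qPoch-exists (57 +ℕ m) 76 (ℕ.s≤s ℕ.z≤n) 1≤76
    P₁-ex = qPoch-exists (19 +ℕ m) 76 (ℕ.s≤s ℕ.z≤n) 1≤76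
    Q₁-ex = qPoch-exists (57 ∸ m) 76 (subst (1 ≤_) (sym 57-m≡) (1≤+ α (1≤+ s 1≤s))) 1≤76

    -- Index 2 marks the numerator of `Y` and index 1 its denominator; `C` is (q^76; q^76)_∞.
    C P₂ Q₂ P₁ Q₁ : ℂ
    C = proj₁ C-ex
    P₂ = proj₁ P₂-ex
    Q₂ = proj₁ Q₂-ex
    P₁ = proj₁ P₁-ex
    Q₁ = proj₁ Q₁-ex

    θ₁-ex = f⁻-exists {q ^ (s +ℕ m)} {q ^ (s +ℕ s +ℕ α)} (s +ℕ m) (s +ℕ s +ℕ α) (1≤+ m 1≤s) (1≤+ α (1≤+ s 1≤s))
      (at-q^ (s +ℕ m)) (at-q^ (s +ℕ s +ℕ α))
    θ₂-ex = f⁻-exists {q ^ α} {q ^ (s +ℕ s +ℕ s +ℕ m)} α (s +ℕ s +ℕ s +ℕ m) 1≤α (1≤+ m (1≤+ s (1≤+ s 1≤s)))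
      (at-q^ α) (at-q^ (s +ℕ s +ℕ s +ℕ m))
    φ⁻-ex = f⁻-exists {q ^ 19} {q ^ 19} s s 1≤s 1≤s (at-q^≡ 19≡s) (at-q^≡ 19≡s)
    φ⁺-ex = f⁺-exists {q ^ 19} {q ^ 19} s s 1≤s 1≤s (at-q^≡ 19≡s) (at-q^≡ 19≡s)
    f⁺-ex = f⁺-exists {q ^ m} {q ^ (38 ∸ m)} m (s +ℕ α) 1≤m (1≤+ α 1≤s) (at-q^ m) (at-q^≡ 38-m≡)
    f⁻-ex = f⁻-exists {q ^ m} {q ^ (38 ∸ m)} m (s +ℕ α) 1≤m (1≤+ α 1≤s) (at-q^ m) (at-q^≡ 38-m≡)
    g-ex = f⁻-exists {q ^ α} {q ^ (19 +ℕ m)} α (s +ℕ m) 1≤α (1≤+ m 1≤s) (at-q^ α) (at-q^≡ 19+m≡)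
    ψ-ex = f⁺-exists {q ^ 38} {(q ^ 38) ^ 3} (s +ℕ s) (3 *ℕ (s +ℕ s)) (1≤+ s 1≤s) (1≤+ (2 *ℕ (s +ℕ s)) (1≤+ s 1≤s))
      (at-q^≡ 38≡)
      λ k → trans (at-^ (q ^ 38) 3 k) (trans (cong (_^ᴳ 3) (at-q^ 38 k)) (trans (^-assocʳ (at q k) 38 3)
        (cong (λ t → at q k ^ᴳ (3 *ℕ t)) 38≡)))

    θ₁ θ₂ : ℂ
    θ₁ = proj₁ θ₁-ex
    θ₂ = proj₁ θ₂-ex

    CP₁Q₁∼θ₁ : C * (P₁ * Q₁) ∼ θ₁
    CP₁Q₁∼θ₁ = jacobi (1≤+ m 1≤s) (1≤+ α (1≤+ s 1≤s))
      (subst (λ d → IsProduct C d d) 76≡₁ (proj₂ (proj₂ (proj₂ C-ex))))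
      (subst₂ (IsProduct P₁) 19+m≡ 76≡₁ (proj₂ (proj₂ (proj₂ P₁-ex))))
      (subst₂ (IsProduct Q₁) 57-m≡ 76≡₁ (proj₂ (proj₂ (proj₂ Q₁-ex))))
      (proj₂ (proj₂ θ₁-ex))

    CP₂Q₂∼θ₂ : C * (P₂ * Q₂) ∼ θ₂
    CP₂Q₂∼θ₂ = jacobi 1≤α (1≤+ m (1≤+ s (1≤+ s 1≤s)))
      (subst (λ d → IsProduct C d d) 76≡₂ (proj₂ (proj₂ (proj₂ C-ex))))
      (subst (IsProduct P₂ α) 76≡₂ (proj₂ (proj₂ (proj₂ P₂-ex))))
      (subst₂ (IsProduct Q₂) 57+m≡ 76≡₂ (proj₂ (proj₂ (proj₂ Q₂-ex))))
      (proj₂ (proj₂ θ₂-ex))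

    -- The estimates are used on the diagonal only: g is the k-th approximation of q, and the
    -- partial sums have length k as well.
    module At k (le : proj₁ q≼ρ ≤ k) = Identities ρ 0≤ρ ρ<1 (proj₂ q≼ρ k le) α m 1≤α 1≤m

    Ψ G u : ℂ
    Ψ = proj₁ ψ-ex
    G = proj₁ g-ex
    u = q ^ n

    ΨG∼θ₂θ₁ : Ψ * G ∼ θ₂ * θ₁
    ΨG∼θ₂θ₁ = ∼-from-ε (fromℕ 24) (0≤fromℕ 24) λ k le → subst₂ _≼_
      (sym (cong₂ _-ᴳ_ (cong₂ _*ᴳ_ (proj₂ (proj₂ ψ-ex) k) (proj₂ (proj₂ g-ex) k))
                       (cong₂ _*ᴳ_ (proj₂ (proj₂ θ₂-ex) k) (proj₂ (proj₂ θ₁-ex) k))))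
      (sym (ℚ.*-distribʳ-+ (ε k) (fromℕ 12) (fromℕ 12)))
      (At.ψg-close k le k)

    sum-of-squares : ℂ → ℂ
    sum-of-squares e = θ₁ * θ₁ + e * (u * u) * (θ₂ * θ₂)

    at-sum-of-squares : ∀ e k → at (sum-of-squares e) k ≡
      θ (at q k) χ deg₁ k *ᴳ θ (at q k) χ deg₁ k +ᴳ at e k *ᴳ at q k ^ᴳ m *ᴳ (θ (at q k) χ deg₂ k *ᴳ θ (at q k) χ deg₂ k)
    at-sum-of-squares e k = cong₂ _+ᴳ_ (cong₂ _*ᴳ_ at-θ₁ at-θ₁)
      (cong₂ _*ᴳ_ (cong (at e k *ᴳ_) at-uu) (cong₂ _*ᴳ_ at-θ₂ at-θ₂))
      where
      at-θ₁ = proj₂ (proj₂ θ₁-ex) k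
      at-θ₂ = proj₂ (proj₂ θ₂-ex) k
      at-uu : at u k *ᴳ at u k ≡ at q k ^ᴳ m
      at-uu = trans (cong₂ _*ᴳ_ (at-q^ n k) (at-q^ n k)) (trans (sym (^-homo-* (at q k) n n))
        (cong (λ t → at q k ^ᴳ (n +ℕ t)) (sym (ℕ.+-identityʳ n))))

    φf⁺ : proj₁ φ⁻-ex * proj₁ f⁺-ex ∼ sum-of-squares 1ℂ
    φf⁺ = ∼-from-ε (fromℕ 12) (0≤fromℕ 12) λ k le → subst (_≼ fromℕ 12 ℚ.* ε k)
      (sym (cong₂ _-ᴳ_ (trans (𝔾ᵣ.*-comm (at (proj₁ φ⁻-ex) k) (at (proj₁ f⁺-ex) k))
          (cong₂ _*ᴳ_ (proj₂ (proj₂ f⁺-ex) k) (proj₂ (proj₂ φ⁻-ex) k))) (at-sum-of-squares 1ℂ k)))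
      (At.φf-close⁺ k le k)

    φf⁻ : proj₁ φ⁺-ex * proj₁ f⁻-ex ∼ sum-of-squares (- 1ℂ)
    φf⁻ = ∼-from-ε (fromℕ 12) (0≤fromℕ 12) λ k le → subst (_≼ fromℕ 12 ℚ.* ε k)
      (sym (cong₂ _-ᴳ_ (trans (𝔾ᵣ.*-comm (at (proj₁ φ⁺-ex) k) (at (proj₁ f⁻-ex) k))
          (cong₂ _*ᴳ_ (proj₂ (proj₂ f⁻-ex) k) (proj₂ (proj₂ φ⁺-ex) k))) (at-sum-of-squares (- 1ℂ) k)))
      (At.φf-close⁻ k le k)

    C# : Apart C
    C# = proj₁ (proj₂ (proj₂ C-ex))
    P₁Q₁# : Apart (P₁ * Q₁)
    P₁Q₁# = apart-* {P₁} {Q₁} (proj₁ (proj₂ (proj₂ P₁-ex))) (proj₁ (proj₂ (proj₂ Q₁-ex)))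
    P₂Q₂# : Apart (P₂ * Q₂)
    P₂Q₂# = apart-* {P₂} {Q₂} (proj₁ (proj₂ (proj₂ P₂-ex))) (proj₁ (proj₂ (proj₂ Q₂-ex)))
    u# : Apart u
    u# = apart-^ {q} q# n

    θ₂θ₁# : Apart (θ₂ * θ₁)
    θ₂θ₁# = apart-* {θ₂} {θ₁} (apart-resp-∼ CP₂Q₂∼θ₂ (apart-* {C} {P₂ * Q₂} C# P₂Q₂#))
                              (apart-resp-∼ CP₁Q₁∼θ₁ (apart-* {C} {P₁ * Q₁} C# P₁Q₁#))

    -- The lower bound for ψ f is taken from θ₂ θ₁, where Jacobi's identity supplies it.
    denominator# : Apart (u * Ψ * G)
    denominator# = apart-resp-∼ {u * (Ψ * G)} {u * Ψ * G} (pointwise λ k → sym (𝔾ᵣ.*-assoc (at u k) (at Ψ k) (at G k)))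
      (apart-* {u} {Ψ * G} u# (apart-resp-∼ (∼-sym ΨG∼θ₂θ₁) θ₂θ₁#))

    w-ex = quotient (P₂ * Q₂) {P₁ * Q₁} P₁Q₁#

    w y : ℂ
    w = proj₁ w-ex
    y = u * w

    w# : Apart w
    w# = apart-factor {w} {P₁ * Q₁} (apart-resp-∼ (∼-sym (proj₂ w-ex)) P₂Q₂#)

    y# : Apart y
    y# = apart-* {u} {w} u# w#

    x-ex = quotient 1ℂ {y} y#

    x : ℂ
    x = proj₁ x-ex

    Y-value : Y n q y
    Y-value = u , w , ≈-refl u ,
      (P₂ * Q₂ , P₁ * Q₁ , (P₂ , Q₂ , proj₁ (proj₂ P₂-ex) , proj₁ (proj₂ Q₂-ex) , ≈-refl (P₂ * Q₂))
        , (P₁ , Q₁ , proj₁ (proj₂ P₁-ex) , proj₁ (proj₂ Q₁-ex) , ≈-refl (P₁ * Q₁))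
        , apart⇒0<∣∣² {P₁ * Q₁} P₁Q₁# , ∼⇒≈ (proj₂ w-ex))
      , ≈-refl y

    1/Y-value : (⟨ 1ℂ ⟩ ⊘ Y n q) x
    1/Y-value = 1ℂ , y , ≈-refl 1ℂ , Y-value , apart⇒0<∣∣² {y} y# , ∼⇒≈ (proj₂ x-ex)

    denominator : (⟨ q ^ n ⟩ ⊗ ψ (q ^ 38) ⊗ f (- (q ^ (19 ∸ 2 *ℕ n))) (- (q ^ (19 +ℕ 2 *ℕ n)))) (u * Ψ * G)
    denominator = u * Ψ , G , (u , Ψ , ≈-refl u , proj₁ (proj₂ ψ-ex) , ≈-refl (u * Ψ)) , proj₁ (proj₂ g-ex) , ≈-refl (u * Ψ * G)

    key : ∀ e → (x + e * y) * (u * Ψ * G) ∼ sum-of-squares e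
    key e = key-identity e {x} {u} {w} {C} {P₂ * Q₂} {P₁ * Q₁} {θ₁} {θ₂} {Ψ} {G} (proj₂ x-ex) (proj₂ w-ex) CP₁Q₁∼θ₁ CP₂Q₂∼θ₂ ΨG∼θ₂θ₁

    x+1y : x + 1ℂ * y ∼ x + y
    x+1y = pointwise λ k → cong (at x k +ᴳ_) (𝔾ᵣ.*-identityˡ (at y k))

    x-1y : x + (- 1ℂ) * y ∼ x - y
    x-1y = pointwise λ k → lemma (at x k) (at y k)
      where
      lemma : ∀ x y → x +ᴳ ⊝ 1ᴳ *ᴳ y ≡ x -ᴳ y
      lemma = solve-∀ 𝔾-ring

  sum-identity : (⟨ 1ℂ ⟩ ⊘ Y n q) ⊕ Y n q
    ≐ (φ (- (q ^ 19)) ⊗ f (q ^ (2 *ℕ n)) (q ^ (38 ∸ 2 *ℕ n)))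
      ⊘ (⟨ q ^ n ⟩ ⊗ ψ (q ^ 38) ⊗ f (- (q ^ (19 ∸ 2 *ℕ n))) (- (q ^ (19 +ℕ 2 *ℕ n))))
  sum-identity = x + y , (x , y , 1/Y-value , Y-value , ≈-refl (x + y))
    , (Φ * F , u * Ψ * G , (Φ , F , proj₁ (proj₂ φ⁻-ex) , proj₁ (proj₂ f⁺-ex) , ≈-refl (Φ * F)) , denominator
      , apart⇒0<∣∣² {u * Ψ * G} denominator#
      , ∼⇒≈ (∼-trans (*-cong (∼-sym x+1y) ∼-refl) (∼-trans (key 1ℂ) (∼-sym φf⁺))))
    where
    Φ F : ℂ
    Φ = proj₁ φ⁻-ex
    F = proj₁ f⁺-ex

  difference-identity : (⟨ 1ℂ ⟩ ⊘ Y n q) ⊖ Y n q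
    ≐ (φ (q ^ 19) ⊗ f (- (q ^ (2 *ℕ n))) (- (q ^ (38 ∸ 2 *ℕ n))))
      ⊘ (⟨ q ^ n ⟩ ⊗ ψ (q ^ 38) ⊗ f (- (q ^ (19 ∸ 2 *ℕ n))) (- (q ^ (19 +ℕ 2 *ℕ n))))
  difference-identity = x - y , (x , y , 1/Y-value , Y-value , ≈-refl (x - y))
    , (Φ * F , u * Ψ * G , (Φ , F , proj₁ (proj₂ φ⁺-ex) , proj₁ (proj₂ f⁻-ex) , ≈-refl (Φ * F)) , denominator
      , apart⇒0<∣∣² {u * Ψ * G} denominator#
      , ∼⇒≈ (∼-trans (*-cong (∼-sym x-1y) ∼-refl) (∼-trans (key (- 1ℂ)) (∼-sym φf⁻))))
    where
    Φ F : ℂ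
    Φ = proj₁ φ⁺-ex
    F = proj₁ f⁻-ex

theorem4p1 : (q : ℂ) → 0ℝ <ᴿ ∣ q ∣² → ∣ q ∣² <ᴿ 1ℝ →
    (n : ℕ) → 1 ≤ n → n ≤ 9 →
    ((⟨ 1ℂ ⟩ ⊘ Y n q) ⊕ Y n q
    ≐ (φ (- (q ^ 19)) ⊗ f (q ^ (2 *ℕ n)) (q ^ (38 ∸ 2 *ℕ n)))
    ⊘ (⟨ q ^ n ⟩ ⊗ ψ (q ^ 38) ⊗ f (- (q ^ (19 ∸ 2 *ℕ n))) (- (q ^ (19 +ℕ 2 *ℕ n)))))
    ×
    ((⟨ 1ℂ ⟩ ⊘ Y n q) ⊖ Y n q
    ≐ (φ (q ^ 19) ⊗ f (- (q ^ (2 *ℕ n))) (- (q ^ (38 ∸ 2 *ℕ n))))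
    ⊘ (⟨ q ^ n ⟩ ⊗ ψ (q ^ 38) ⊗ f (- (q ^ (19 ∸ 2 *ℕ n))) (- (q ^ (19 +ℕ 2 *ℕ n)))))
theorem4p1 q 0<∣q∣² ∣q∣²<1 n 1≤n n≤9 = sum-identity , difference-identity
  where
  disc = radius q ∣q∣²<1
  open Order76 q (0<∣∣²⇒apart {q} 0<∣q∣²) (proj₁ (proj₂ disc)) (proj₁ (proj₂ (proj₂ disc))) (proj₂ (proj₂ (proj₂ disc))) n 1≤n n≤9
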